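{- For $n,i,j\ge 0$ let $g(n;i,j)$ be the number of Gessel walks of length $n$ ending at the point $(i,j)$, and let $$G(t;x,y)=\sum_{n\ge 0}\Bigl(\sum_{i,j\ge 0} g(n;i,j)\,x^i y^j\Bigr)t^n\in\mathbb{Q}[x,y][[t]].$$ Then $G(t;x,y)$ is algebraic, i.e., there exists a nonzero polynomial $P\in\mathbb{Q}[T,t,x,y]$ with $P(G(t;x,y),t,x,y)=0$.
   Context: A Gessel walk of length $n$ is a sequence of $n$ steps in $\mathbb{Z}^2$, each step taken from $\{(-1,0),(-1,-1),(1,1),(1,0)\}$ (i.e., $\leftarrow,\swarrow,\nearrow,\rightarrow$), starting at the origin $(0,0)$ and never leaving the quarter plane $\mathbb{N}^2=\{(i,j): i,j\ge 0\}$. -}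

module Defs where

open import Data.Nat as ℕ using (ℕ; zero; suc; _∸_)
open import Data.Integer as ℤ using (ℤ; +_; -[1+_]; 0ℤ)
open import Data.Rational as ℚ using (ℚ; 0ℚ; 1ℚ)
open import Data.Product using (_×_; _,_; proj₁; proj₂)
open import Data.Unit using (⊤; tt)
open import Data.List using (List; []; _∷_; length; filter; concatMap; map)
open import Data.Bool using (if_then_else_)
open import Relation.Nullary using (Dec; yes; does)
open import Relation.Nullary.Decidable using (_×-dec_)
open import Relation.Binary.PropositionalEquality using (_≡_)
open import Data.Product.Properties using (≡-dec)

data Step : Set where
  W SW NE E : Step

allSteps : List Step
allSteps = W ∷ SW ∷ NE ∷ E ∷ []

Point : Set
Point = ℤ × ℤ

origin : Point
origin = (0ℤ , 0ℤ)

move : Point → Step → Point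
move (x , y) W  = (x ℤ.- ℤ.1ℤ , y)
move (x , y) SW = (x ℤ.- ℤ.1ℤ , y ℤ.- ℤ.1ℤ)
move (x , y) NE = (x ℤ.+ ℤ.1ℤ , y ℤ.+ ℤ.1ℤ)
move (x , y) E  = (x ℤ.+ ℤ.1ℤ , y)

InQuadrant : Point → Set
InQuadrant (x , y) = (0ℤ ℤ.≤ x) × (0ℤ ℤ.≤ y)

inQuadrant? : (p : Point) → Dec (InQuadrant p)
inQuadrant? (x , y) = (0ℤ ℤ.≤? x) ×-dec (0ℤ ℤ.≤? y)

StaysIn : Point → List Step → Set
StaysIn p [] = ⊤
StaysIn p (s ∷ w) = InQuadrant (move p s) × StaysIn (move p s) w

staysIn? : (p : Point) (w : List Step) → Dec (StaysIn p w)
staysIn? p [] = yes tt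
staysIn? p (s ∷ w) = inQuadrant? (move p s) ×-dec staysIn? (move p s) w

endpoint : Point → List Step → Point
endpoint p [] = p
endpoint p (s ∷ w) = endpoint (move p s) w

GesselWalkTo : ℕ → ℕ → List Step → Set
GesselWalkTo i j w = StaysIn origin w × (endpoint origin w ≡ (+ i , + j))

gesselWalkTo? : (i j : ℕ) (w : List Step) → Dec (GesselWalkTo i j w)
gesselWalkTo? i j w =
  staysIn? origin w ×-dec ≡-dec ℤ._≟_ ℤ._≟_ (endpoint origin w) (+ i , + j)

words : ℕ → List (List Step)
words zero = [] ∷ []
words (suc n) = concatMap (λ s → map (s ∷_) (words n)) allSteps

g : ℕ → ℕ → ℕ → ℕ
g n i j = length (filter (gesselWalkTo? i j) (words n))

-- Formal power series in t, x, y over ℚ: coefficient of t^n x^i y^j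
Series : Set
Series = ℕ → ℕ → ℕ → ℚ

G : Series
G n i j = (+ g n i j) ℚ./ 1

sumBelow : ℕ → (ℕ → ℚ) → ℚ
sumBelow zero f = 0ℚ
sumBelow (suc n) f = sumBelow n f ℚ.+ f n

_⊛_ : Series → Series → Series
(F ⊛ H) n i j =
  sumBelow (suc n) λ n₁ → sumBelow (suc i) λ i₁ → sumBelow (suc j) λ j₁ →
    F n₁ i₁ j₁ ℚ.* H (n ∸ n₁) (i ∸ i₁) (j ∸ j₁)

oneS : Series
oneS zero zero zero = 1ℚ
oneS _ _ _ = 0ℚ

_^S_ : Series → ℕ → Series
F ^S zero = oneS
F ^S suc a = F ⊛ (F ^S a)

shift : ℕ → ℕ → ℕ → Series → Series
shift b c d F n i j =
  if does (b ℕ.≤? n) then (if does (c ℕ.≤? i) then (if does (d ℕ.≤? j)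
    then F (n ∸ b) (i ∸ c) (j ∸ d) else 0ℚ) else 0ℚ) else 0ℚ

-- A polynomial P ∈ ℚ[T,t,x,y] of degree ≤ D in each variable:
-- P = Σ_{a,b,c,d ≤ D} coef a b c d · T^a t^b x^c y^d
-- (coefficients with some exponent > D are ignored).
record Poly4 : Set where
  constructor poly4
  field
    D    : ℕ
    coef : ℕ → ℕ → ℕ → ℕ → ℚ
open Poly4 public

NonzeroPoly : Poly4 → Set
NonzeroPoly P = ∃ λ a → ∃ λ b → ∃ λ c → ∃ λ d →
  (a ℕ.≤ D P) × (b ℕ.≤ D P) × (c ℕ.≤ D P) × (d ℕ.≤ D P) × ¬ (coef P a b c d ≡ 0ℚ)
  where open import Data.Product using (∃)
        open import Relation.Nullary using (¬_)

evalAt : Poly4 → Series → Series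
evalAt P F n i j =
  sumBelow (suc (D P)) λ a → sumBelow (suc (D P)) λ b →
  sumBelow (suc (D P)) λ c → sumBelow (suc (D P)) λ d →
    coef P a b c d ℚ.* shift b c d (F ^S a) n i j

{-# OPTIONS --safe #-}

-- The kernel K = xy - t(1+y)(1+x²y) satisfies K G = xy - t(1+y) G(0,y) - t (G(x,0) - G(0,0)).
-- Following Bernardi, Bousquet-Mélou and Raschel, modulo K the functions
--   (x + 1/x)(1/t - x - 1/x)   and   t (G(x,0) - G(0,0)) + 1/x
-- of x agree with functions of y (Tutte invariants). A polynomial combination of them has no
-- pole on either side, hence is constant; this is a cubic equation for G(x,0) with coefficients
-- depending on three unknown series in t, and likewise a cubic for G(0,y).
-- The equation for G(x,0) has a unique power series solution, so it suffices to exhibit one: the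
-- curve is rational over ℚ(Z), where 256 t² Z⁶ = (Z² - 1)(Z² + 3)³, and a parametrisation can be
-- checked by polynomial arithmetic. Thus the three unknown series lie in ℚ(t, Z), so
-- G(x,0), G(0,y) and finally G lie in a finite extension of ℚ(t, x, y).

module Submission where

open import Level using (0ℓ)
open import Data.Bool using (Bool; true; false; _∧_; T; if_then_else_)
open import Data.Empty using (⊥-elim)
open import Data.Nat as ℕ using (ℕ; zero; suc; _≤_; _<_; _∸_; z≤n; s≤s; z<s; s<s)
import Data.Nat.Properties as ℕₚ
open import Data.Nat.Induction using (<-rec)
open import Data.Fin using (Fin; zero; suc; punchIn; toℕ)
open import Data.Fin.Properties using (toℕ<n)
open import Data.List as List using (List; []; _∷_; _++_; length)
open import Data.Vec as Vec using (Vec; []; _∷_)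
open import Data.Vec.Functional as Vector using (Vector; insertAt)
import Data.Vec.Functional.Properties as Vectorₚ
open import Data.Product using (Σ; ∃; ∃₂; _×_; _,_; proj₁; proj₂)
open import Data.Sum using (_⊎_; inj₁; inj₂; [_,_])
open import Relation.Binary.PropositionalEquality as ≡ using (_≡_; _≢_; module ≡-Reasoning)
import Relation.Binary.Reasoning.Setoid as SetoidReasoning
open import Algebra.Bundles using (CommutativeRing; RawRing)
import Algebra.Definitions.RawSemiring as RawSemiringDefinitions
import Algebra.Properties.AbelianGroup as AbelianGroupProperties
import Algebra.Properties.CommutativeSemigroup as CommutativeSemigroupProperties
import Algebra.Properties.Ring as RingProperties
import Algebra.Properties.Semiring.Exp as SemiringExp
import Algebra.Properties.Semiring.Mult as SemiringMult
import Algebra.Properties.Semiring.Sum as SemiringSum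

-- Formal power series

-- Equality of power series is not decidable, so no field of fractions of series is at hand.
-- Everything stays in ℚ[[y]][[x]][[t]], treated as a domain with a positive notion of nonzero: an
-- element of an extension field becomes a series with a nonzero polynomial clearing its
-- denominators, and zero tests are confined to polynomials. Likewise, "modulo K" means up to
-- multiples of K in this ring; no root of the kernel is substituted. Since K is xy at t = 0, such
-- congruences can be compared one power of t at a time.
--
-- The combination of invariants is (U² - U/t + J + 2 - 2 t a₁)(U + t a₀), where U = t (G(x,0) - a₀)
-- + 1/x, J = (x + 1/x)(1/t - x - 1/x), and a₀, a₁ are the first two coefficients of G(x,0) in x.
-- The first factor vanishes at x = 0 and absorbs the pole of the second; in terms of y, the zero of
-- the second factor at y = 0 absorbs the pole of the first.
--
-- Uniqueness of G(x,0) rests on the coefficient of tⁿ having degree at most n in x, so the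
-- exhibited solution must satisfy this bound too; it is followed through fixed point equations.

CRing : Set₁
CRing = CommutativeRing 0ℓ 0ℓ

module PowerSeries (C : CRing) where
  open CommutativeRing C
  open CommutativeSemigroupProperties +-commutativeSemigroup using (interchange)
  open SetoidReasoning setoid

  PS : Set
  PS = ℕ → Carrier

  infix 4 _≋_
  _≋_ : PS → PS → Set
  F ≋ H = ∀ n → F n ≈ H n

  infixl 6 _⊕_
  infixl 7 _⊗_ _·_

  _⊕_ : PS → PS → PS
  (F ⊕ H) n = F n + H n

  ⊖_ : PS → PS
  (⊖ F) n = - F n

  const : Carrier → PS
  const a zero    = a
  const a (suc _) = 0#

  _·_ : Carrier → PS → PS
  (a · F) n = a * F n

  tail : PS → PS
  tail F n = F (suc n)

  -- The Cauchy product through F = F₀ + X · tail F: with recursion on the index in place of a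
  -- convolution sum, the ring laws are plain inductions. `⊗-Σ<` recovers the sum.
  _⊗_ : PS → PS → PS
  (F ⊗ H) zero    = F 0 * H 0
  (F ⊗ H) (suc n) = F 0 * H (suc n) + (tail F ⊗ H) n

  X : PS
  X zero    = 0#
  X (suc n) = const 1# n

  ⊗-cong : ∀ {F F′ H H′} → F ≋ F′ → H ≋ H′ → F ⊗ H ≋ F′ ⊗ H′
  ⊗-cong p q zero    = *-cong (p 0) (q 0)
  ⊗-cong p q (suc n) = +-cong (*-cong (p 0) (q (suc n))) (⊗-cong (λ k → p (suc k)) q n)

  const-0 : ∀ n → const 0# n ≈ 0#
  const-0 zero    = refl
  const-0 (suc _) = refl

  ⊗-zeroˡ : ∀ F → const 0# ⊗ F ≋ const 0#
  ⊗-zeroˡ F zero    = zeroˡ _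
  ⊗-zeroˡ F (suc n) =
    trans (+-cong (zeroˡ _) (trans (⊗-cong {H = F} (λ k → sym (const-0 k)) (λ _ → refl) n) (⊗-zeroˡ F n)))
          (trans (+-identityˡ _) (const-0 n))

  const-⊗ : ∀ a F → const a ⊗ F ≋ a · F
  const-⊗ a F zero    = refl
  const-⊗ a F (suc n) = begin
    a * F (suc n) + (tail (const a) ⊗ F) n ≈⟨ +-congˡ (⊗-cong tail-const (λ _ → refl) n) ⟩
    a * F (suc n) + (const 0# ⊗ F) n       ≈⟨ +-congˡ (trans (⊗-zeroˡ F n) (const-0 n)) ⟩
    a * F (suc n) + 0#                     ≈⟨ +-identityʳ _ ⟩
    a * F (suc n)                          ∎
    where
    tail-const : tail (const a) ≋ const 0#
    tail-const n = sym (const-0 n)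

  ⊗-identityˡ : ∀ F → const 1# ⊗ F ≋ F
  ⊗-identityˡ F n = trans (const-⊗ 1# F n) (*-identityˡ _)

  X-⊗-zero : ∀ F → (X ⊗ F) 0 ≈ 0#
  X-⊗-zero F = zeroˡ _

  X-⊗-suc : ∀ F n → (X ⊗ F) (suc n) ≈ F n
  X-⊗-suc F n = begin
    0# * F (suc n) + (const 1# ⊗ F) n ≈⟨ +-cong (zeroˡ _) (⊗-identityˡ F n) ⟩
    0# + F n                          ≈⟨ +-identityˡ _ ⟩
    F n                               ∎

  ⊗-distribʳ : ∀ F H K → (H ⊕ K) ⊗ F ≋ H ⊗ F ⊕ K ⊗ F
  ⊗-distribʳ F H K zero    = distribʳ _ _ _
  ⊗-distribʳ F H K (suc n) =
    trans (+-cong (distribʳ _ _ _) (⊗-distribʳ F (tail H) (tail K) n)) (interchange _ _ _ _)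

  ·-⊗ : ∀ a F H → (a · F) ⊗ H ≋ a · (F ⊗ H)
  ·-⊗ a F H zero    = *-assoc _ _ _
  ·-⊗ a F H (suc n) = trans (+-cong (*-assoc _ _ _) (·-⊗ a (tail F) H n)) (sym (distribˡ _ _ _))

  -- The unfolding that peels the second factor; commutativity exchanges it with the defining one.
  ⊗-suc′ : ∀ F H n → (F ⊗ H) (suc n) ≈ (F ⊗ tail H) n + F (suc n) * H 0
  ⊗-suc′ F H zero    = refl
  ⊗-suc′ F H (suc n) = trans (+-congˡ (⊗-suc′ (tail F) H n)) (sym (+-assoc _ _ _))

  ⊗-comm : ∀ F H → F ⊗ H ≋ H ⊗ F
  ⊗-comm F H zero    = *-comm _ _
  ⊗-comm F H (suc n) = begin
    F 0 * H (suc n) + (tail F ⊗ H) n ≈⟨ +-cong (*-comm _ _) (⊗-comm (tail F) H n) ⟩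
    H (suc n) * F 0 + (H ⊗ tail F) n ≈⟨ +-comm _ _ ⟩
    (H ⊗ tail F) n + H (suc n) * F 0 ≈⟨ ⊗-suc′ H F n ⟨
    (H ⊗ F) (suc n)                  ∎

  ⊗-assoc : ∀ F H K → (F ⊗ H) ⊗ K ≋ F ⊗ (H ⊗ K)
  ⊗-assoc F H K zero    = *-assoc _ _ _
  ⊗-assoc F H K (suc n) = begin
    (F 0 * H 0) * K (suc n) + ((F 0 · tail H ⊕ tail F ⊗ H) ⊗ K) n
      ≈⟨ +-cong (*-assoc _ _ _) (⊗-distribʳ K (F 0 · tail H) (tail F ⊗ H) n) ⟩
    F 0 * (H 0 * K (suc n)) + (((F 0 · tail H) ⊗ K) n + ((tail F ⊗ H) ⊗ K) n)
      ≈⟨ +-congˡ (+-cong (·-⊗ (F 0) (tail H) K n) (⊗-assoc (tail F) H K n)) ⟩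
    F 0 * (H 0 * K (suc n)) + (F 0 * (tail H ⊗ K) n + (tail F ⊗ (H ⊗ K)) n)
      ≈⟨ +-assoc _ _ _ ⟨
    (F 0 * (H 0 * K (suc n)) + F 0 * (tail H ⊗ K) n) + (tail F ⊗ (H ⊗ K)) n
      ≈⟨ +-congʳ (distribˡ _ _ _) ⟨
    F 0 * ((H ⊗ K) (suc n)) + (tail F ⊗ (H ⊗ K)) n ∎

  ps-ring : CRing
  ps-ring = record
    { Carrier = PS
    ; _≈_ = _≋_
    ; _+_ = _⊕_
    ; _*_ = _⊗_
    ; -_ = ⊖_
    ; 0# = λ _ → 0#
    ; 1# = const 1#
    ; isCommutativeRing = record
      { isRing = record
        { +-isAbelianGroup = record
          { isGroup = record
            { isMonoid = record
              { isSemigroup = record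
                { isMagma = record
                  { isEquivalence = record
                    { refl = λ _ → refl
                    ; sym = λ p n → sym (p n)
                    ; trans = λ p q n → trans (p n) (q n)
                    }
                  ; ∙-cong = λ p q n → +-cong (p n) (q n)
                  }
                ; assoc = λ _ _ _ _ → +-assoc _ _ _
                }
              ; identity = (λ _ _ → +-identityˡ _) , (λ _ _ → +-identityʳ _)
              }
            ; inverse = (λ _ _ → -‿inverseˡ _) , (λ _ _ → -‿inverseʳ _)
            ; ⁻¹-cong = λ p n → -‿cong (p n)
            }
          ; comm = λ _ _ _ → +-comm _ _
          }
        ; *-cong = ⊗-cong
        ; *-assoc = ⊗-assoc
        ; *-identity = ⊗-identityˡ , (λ F n → trans (⊗-comm F (const 1#) n) (⊗-identityˡ F n))
        ; distrib = (λ F H K n → trans (⊗-comm F (H ⊕ K) n)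
                       (trans (⊗-distribʳ F H K n) (+-cong (⊗-comm H F n) (⊗-comm K F n))))
                  , ⊗-distribʳ
        }
      ; *-comm = ⊗-comm
      }
    }

-- Polynomial identities by reflection

infix  8 :-_
infixl 7 _:*_
infixl 6 _:+_ _:-_

data Expr (n : ℕ) : Set where
  var       : Fin n → Expr n
  :0 :1     : Expr n
  _:+_ _:*_ : Expr n → Expr n → Expr n
  :-_       : Expr n → Expr n

_:-_ : ∀ {n} → Expr n → Expr n → Expr n
e :- f = e :+ (:- f)

-- The long formulas below are written once, over a raw ring. At this ring they are syntax, for the
-- solver as well as for `has-⟦⟧`, `⟦⟧-cong` and `⟦⟧-agree`; at the raw ring of R they are values,
-- and `⟦_⟧` computes the first into the second.
exprRing : ℕ → RawRing 0ℓ 0ℓ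
exprRing n = record
  { Carrier = Expr n ; _≈_ = _≡_ ; _+_ = _:+_ ; _*_ = _:*_ ; -_ = :-_ ; 0# = :0 ; 1# = :1 }

-- Dense Horner representation; a constant (a , b) stands for the integer a - b.
Poly : ℕ → Set
Poly zero    = ℕ × ℕ
Poly (suc n) = List (Poly n)

0ᴾ : ∀ n → Poly n
0ᴾ zero    = 0 , 0
0ᴾ (suc n) = []

1ᴾ : ∀ n → Poly n
1ᴾ zero    = 1 , 0
1ᴾ (suc n) = 1ᴾ n ∷ []

varᴾ : ∀ {n} → Fin n → Poly n
varᴾ {suc n} zero    = 0ᴾ n ∷ 1ᴾ n ∷ []
varᴾ {suc n} (suc i) = varᴾ i ∷ []

add : ∀ n → Poly n → Poly n → Poly n
add zero    (a , b) (c , d) = a ℕ.+ c , b ℕ.+ d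
add (suc n) []       qs       = qs
add (suc n) (p ∷ ps) []       = p ∷ ps
add (suc n) (p ∷ ps) (q ∷ qs) = add n p q ∷ add (suc n) ps qs

neg : ∀ n → Poly n → Poly n
neg zero    (a , b)  = b , a
neg (suc n) []       = []
neg (suc n) (p ∷ ps) = neg n p ∷ neg (suc n) ps

mutual
  mul : ∀ n → Poly n → Poly n → Poly n
  mul zero    (a , b) (c , d) = a ℕ.* c ℕ.+ b ℕ.* d , a ℕ.* d ℕ.+ b ℕ.* c
  mul (suc n) []       qs = []
  mul (suc n) (p ∷ ps) qs = add (suc n) (scale n p qs) (0ᴾ n ∷ mul (suc n) ps qs)

  scale : ∀ n → Poly n → List (Poly n) → List (Poly n)
  scale n p []       = []
  scale n p (q ∷ qs) = mul n p q ∷ scale n p qs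

-- Lists are never trimmed, so zero has many representatives and every coefficient is inspected. The
-- coefficients are pairs of naturals, so the test runs without deciding equality in the ring.
isZero : ∀ n → Poly n → Bool
isZero zero    (a , b)  = a ℕ.≡ᵇ b
isZero (suc n) []       = true
isZero (suc n) (p ∷ ps) = isZero n p ∧ isZero (suc n) ps

norm : ∀ {n} → Expr n → Poly n
norm (var i)  = varᴾ i
norm :0       = 0ᴾ _
norm :1       = 1ᴾ _
norm (e :+ f) = add _ (norm e) (norm f)
norm (e :* f) = mul _ (norm e) (norm f)
norm (:- e)   = neg _ (norm e)

module Solver (R : CRing) where
  open CommutativeRing R
  open RingProperties ring using (-‿distribˡ-*; -‿distribʳ-*; -0#≈0#; -‿involutive)
  open AbelianGroupProperties +-abelianGroup using () renaming (⁻¹-∙-comm to -‿+-comm)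
  open CommutativeSemigroupProperties +-commutativeSemigroup using (interchange)
  open SemiringMult semiring using (×-homo-+; ×1-homo-*) renaming (_×_ to _×ᴿ_)
  open SetoidReasoning setoid

  ⟦_⟧ : ∀ {n} → Expr n → Vec Carrier n → Carrier
  ⟦ var i ⟧  ρ = Vec.lookup ρ i
  ⟦ :0 ⟧     ρ = 0#
  ⟦ :1 ⟧     ρ = 1#
  ⟦ e :+ f ⟧ ρ = ⟦ e ⟧ ρ + ⟦ f ⟧ ρ
  ⟦ e :* f ⟧ ρ = ⟦ e ⟧ ρ * ⟦ f ⟧ ρ
  ⟦ :- e ⟧   ρ = - ⟦ e ⟧ ρ

  ⟦⟧-cong : ∀ {n} (e : Expr n) {ρ ρ′ : Vec Carrier n} → (∀ i → Vec.lookup ρ i ≈ Vec.lookup ρ′ i) → ⟦ e ⟧ ρ ≈ ⟦ e ⟧ ρ′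
  ⟦⟧-cong (var i)  h = h i
  ⟦⟧-cong :0       h = refl
  ⟦⟧-cong :1       h = refl
  ⟦⟧-cong (e :+ f) h = +-cong (⟦⟧-cong e h) (⟦⟧-cong f h)
  ⟦⟧-cong (e :* f) h = *-cong (⟦⟧-cong e h) (⟦⟧-cong f h)
  ⟦⟧-cong (:- e)   h = -‿cong (⟦⟧-cong e h)

  num : ℕ → Carrier
  num k = k ×ᴿ 1#

  eval : ∀ n → Poly n → Vec Carrier n → Carrier
  eval zero    (a , b)  ρ       = num a - num b
  eval (suc n) []       (x ∷ ρ) = 0#
  eval (suc n) (p ∷ ps) (x ∷ ρ) = eval n p ρ + x * eval (suc n) ps (x ∷ ρ)

  eval-0 : ∀ n ρ → eval n (0ᴾ n) ρ ≈ 0#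
  eval-0 zero    ρ       = -‿inverseʳ _
  eval-0 (suc n) (x ∷ ρ) = refl

  eval-1 : ∀ n ρ → eval n (1ᴾ n) ρ ≈ 1#
  eval-1 zero    ρ       = trans (+-cong (+-identityʳ _) -0#≈0#) (+-identityʳ _)
  eval-1 (suc n) (x ∷ ρ) = trans (+-cong (eval-1 n ρ) (zeroʳ _)) (+-identityʳ _)

  eval-var : ∀ {n} (i : Fin n) ρ → eval n (varᴾ i) ρ ≈ Vec.lookup ρ i
  eval-var {suc n} zero (x ∷ ρ) = begin
    eval n (0ᴾ n) ρ + x * (eval n (1ᴾ n) ρ + x * 0#) ≈⟨ +-cong (eval-0 n ρ) (*-congˡ (+-cong (eval-1 n ρ) (zeroʳ x))) ⟩
    0# + x * (1# + 0#)                               ≈⟨ trans (+-identityˡ _) (*-congˡ (+-identityʳ _)) ⟩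
    x * 1#                                           ≈⟨ *-identityʳ x ⟩
    x                                                ∎
  eval-var {suc n} (suc i) (x ∷ ρ) = trans (+-cong (eval-var i ρ) (zeroʳ _)) (+-identityʳ _)

  eval-add : ∀ n p q ρ → eval n (add n p q) ρ ≈ eval n p ρ + eval n q ρ
  eval-add zero (a , b) (c , d) ρ = begin
    num (a ℕ.+ c) - num (b ℕ.+ d)         ≈⟨ +-cong (×-homo-+ 1# a c) (-‿cong (×-homo-+ 1# b d)) ⟩
    (num a + num c) - (num b + num d)     ≈⟨ +-congˡ (-‿+-comm _ _) ⟨
    (num a + num c) + (- num b + - num d) ≈⟨ interchange _ _ _ _ ⟩
    (num a - num b) + (num c - num d)     ∎
  eval-add (suc n) []       qs       (x ∷ ρ) = sym (+-identityˡ _)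
  eval-add (suc n) (p ∷ ps) []       (x ∷ ρ) = sym (+-identityʳ _)
  eval-add (suc n) (p ∷ ps) (q ∷ qs) (x ∷ ρ) = begin
    eval n (add n p q) ρ + x * eval (suc n) (add (suc n) ps qs) (x ∷ ρ)
      ≈⟨ +-cong (eval-add n p q ρ) (trans (*-congˡ (eval-add (suc n) ps qs (x ∷ ρ))) (distribˡ _ _ _)) ⟩
    (eval n p ρ + eval n q ρ) + (x * eval (suc n) ps (x ∷ ρ) + x * eval (suc n) qs (x ∷ ρ))
      ≈⟨ interchange _ _ _ _ ⟩
    (eval n p ρ + x * eval (suc n) ps (x ∷ ρ)) + (eval n q ρ + x * eval (suc n) qs (x ∷ ρ)) ∎

  eval-neg : ∀ n p ρ → eval n (neg n p) ρ ≈ - eval n p ρ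
  eval-neg zero (a , b) ρ = begin
    num b - num a         ≈⟨ +-comm _ _ ⟩
    - num a + num b       ≈⟨ +-congˡ (-‿involutive _) ⟨
    - num a + - - num b   ≈⟨ -‿+-comm _ _ ⟩
    - (num a - num b)     ∎
  eval-neg (suc n) []       (x ∷ ρ) = sym -0#≈0#
  eval-neg (suc n) (p ∷ ps) (x ∷ ρ) = begin
    eval n (neg n p) ρ + x * eval (suc n) (neg (suc n) ps) (x ∷ ρ)
      ≈⟨ +-cong (eval-neg n p ρ) (trans (*-congˡ (eval-neg (suc n) ps (x ∷ ρ))) (sym (-‿distribʳ-* _ _))) ⟩
    - eval n p ρ + - (x * eval (suc n) ps (x ∷ ρ)) ≈⟨ -‿+-comm _ _ ⟩
    - (eval n p ρ + x * eval (suc n) ps (x ∷ ρ))   ∎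

  private
    sub-* : ∀ a b c d → (a - b) * (c - d) ≈ (a * c + b * d) - (a * d + b * c)
    sub-* a b c d = begin
      (a - b) * (c - d)                             ≈⟨ distribʳ _ _ _ ⟩
      a * (c - d) + - b * (c - d)                   ≈⟨ +-cong (distribˡ _ _ _) (distribˡ _ _ _) ⟩
      (a * c + a * - d) + (- b * c + - b * - d)     ≈⟨ +-cong (+-congˡ (-‿distribʳ-* _ _)) (+-comm _ _) ⟨
      (a * c + - (a * d)) + (- b * - d + - b * c)   ≈⟨ interchange _ _ _ _ ⟩
      (a * c + - b * - d) + (- (a * d) + - b * c)   ≈⟨ +-cong (+-congˡ neg-neg) (+-congˡ (sym (-‿distribˡ-* _ _))) ⟩
      (a * c + b * d) + (- (a * d) + - (b * c))     ≈⟨ +-congˡ (-‿+-comm _ _) ⟩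
      (a * c + b * d) - (a * d + b * c)             ∎
      where
      neg-neg : - b * - d ≈ b * d
      neg-neg = trans (sym (-‿distribˡ-* _ _)) (trans (-‿cong (sym (-‿distribʳ-* _ _))) (-‿involutive _))

  mutual
    eval-mul : ∀ n p q ρ → eval n (mul n p q) ρ ≈ eval n p ρ * eval n q ρ
    eval-mul zero (a , b) (c , d) ρ = begin
      num (a ℕ.* c ℕ.+ b ℕ.* d) - num (a ℕ.* d ℕ.+ b ℕ.* c)
        ≈⟨ +-cong (num-+-* a c b d) (-‿cong (num-+-* a d b c)) ⟩
      (num a * num c + num b * num d) - (num a * num d + num b * num c)
        ≈⟨ sub-* _ _ _ _ ⟨
      (num a - num b) * (num c - num d) ∎
      where
      num-+-* : ∀ a c b d → num (a ℕ.* c ℕ.+ b ℕ.* d) ≈ num a * num c + num b * num d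
      num-+-* a c b d = trans (×-homo-+ 1# (a ℕ.* c) (b ℕ.* d)) (+-cong (×1-homo-* a c) (×1-homo-* b d))
    eval-mul (suc n) []       qs (x ∷ ρ) = sym (zeroˡ _)
    eval-mul (suc n) (p ∷ ps) qs (x ∷ ρ) = begin
      eval (suc n) (add (suc n) (scale n p qs) (0ᴾ n ∷ mul (suc n) ps qs)) (x ∷ ρ)
        ≈⟨ eval-add (suc n) (scale n p qs) (0ᴾ n ∷ mul (suc n) ps qs) (x ∷ ρ) ⟩
      eval (suc n) (scale n p qs) (x ∷ ρ) + (eval n (0ᴾ n) ρ + x * eval (suc n) (mul (suc n) ps qs) (x ∷ ρ))
        ≈⟨ +-cong (eval-scale n p qs x ρ) (trans (+-congʳ (eval-0 n ρ)) (+-identityˡ _)) ⟩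
      eval n p ρ * eval (suc n) qs (x ∷ ρ) + x * eval (suc n) (mul (suc n) ps qs) (x ∷ ρ)
        ≈⟨ +-congˡ (trans (*-congˡ (eval-mul (suc n) ps qs (x ∷ ρ))) (sym (*-assoc _ _ _))) ⟩
      eval n p ρ * eval (suc n) qs (x ∷ ρ) + (x * eval (suc n) ps (x ∷ ρ)) * eval (suc n) qs (x ∷ ρ)
        ≈⟨ distribʳ _ _ _ ⟨
      (eval n p ρ + x * eval (suc n) ps (x ∷ ρ)) * eval (suc n) qs (x ∷ ρ) ∎

    eval-scale : ∀ n p qs x ρ → eval (suc n) (scale n p qs) (x ∷ ρ) ≈ eval n p ρ * eval (suc n) qs (x ∷ ρ)
    eval-scale n p []       x ρ = sym (zeroʳ _)
    eval-scale n p (q ∷ qs) x ρ = begin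
      eval n (mul n p q) ρ + x * eval (suc n) (scale n p qs) (x ∷ ρ)
        ≈⟨ +-cong (eval-mul n p q ρ) (*-congˡ (eval-scale n p qs x ρ)) ⟩
      P * Q + x * (P * Qs) ≈⟨ +-congˡ (sym (*-assoc _ _ _)) ⟩
      P * Q + x * P * Qs   ≈⟨ +-congˡ (*-congʳ (*-comm _ _)) ⟩
      P * Q + P * x * Qs   ≈⟨ +-congˡ (*-assoc _ _ _) ⟩
      P * Q + P * (x * Qs) ≈⟨ distribˡ _ _ _ ⟨
      P * (Q + x * Qs)     ∎
      where
      P  = eval n p ρ
      Q  = eval n q ρ
      Qs = eval (suc n) qs (x ∷ ρ)

  eval-norm : ∀ {n} (e : Expr n) ρ → eval n (norm e) ρ ≈ ⟦ e ⟧ ρ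
  eval-norm (var i)  ρ = eval-var i ρ
  eval-norm :0       ρ = eval-0 _ ρ
  eval-norm :1       ρ = eval-1 _ ρ
  eval-norm (e :+ f) ρ = trans (eval-add _ (norm e) (norm f) ρ) (+-cong (eval-norm e ρ) (eval-norm f ρ))
  eval-norm (e :* f) ρ = trans (eval-mul _ (norm e) (norm f) ρ) (*-cong (eval-norm e ρ) (eval-norm f ρ))
  eval-norm (:- e)   ρ = trans (eval-neg _ (norm e) ρ) (-‿cong (eval-norm e ρ))

  ∧-true : ∀ {a b} → a ∧ b ≡ true → a ≡ true × b ≡ true
  ∧-true {true} p = ≡.refl , p

  eval-isZero : ∀ n p ρ → isZero n p ≡ true → eval n p ρ ≈ 0#
  eval-isZero zero (a , b) ρ h with ℕₚ.≡ᵇ⇒≡ a b (≡.subst T (≡.sym h) _)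
  ... | ≡.refl = -‿inverseʳ _
  eval-isZero (suc n) []       (x ∷ ρ) h = refl
  eval-isZero (suc n) (p ∷ ps) (x ∷ ρ) h =
    trans (+-cong (eval-isZero n p ρ (proj₁ (∧-true h)))
                  (trans (*-congˡ (eval-isZero (suc n) ps (x ∷ ρ) (proj₂ (∧-true h)))) (zeroʳ x)))
          (+-identityˡ _)

  variables : ∀ n → Vec (Expr n) n
  variables n = Vec.map var (Vec.allFin n)

  abstract
    solve : ∀ n (f : Vec (Expr n) n → Expr n × Expr n) →
            let (e₁ , e₂) = f (variables n) in
            isZero n (norm (e₁ :+ (:- e₂))) ≡ true →
            ∀ ρ → ⟦ e₁ ⟧ ρ ≈ ⟦ e₂ ⟧ ρ
    solve n f h ρ = begin
      ⟦ e₁ ⟧ ρ                       ≈⟨ +-identityʳ _ ⟨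
      ⟦ e₁ ⟧ ρ + 0#                  ≈⟨ +-congˡ (-‿inverseˡ _) ⟨
      ⟦ e₁ ⟧ ρ + (- ⟦ e₂ ⟧ ρ + ⟦ e₂ ⟧ ρ) ≈⟨ +-assoc _ _ _ ⟨
      (⟦ e₁ ⟧ ρ - ⟦ e₂ ⟧ ρ) + ⟦ e₂ ⟧ ρ ≈⟨ +-congʳ (trans (sym (eval-norm (e₁ :+ (:- e₂)) ρ)) (eval-isZero n (norm (e₁ :+ (:- e₂))) ρ h)) ⟩
      0# + ⟦ e₂ ⟧ ρ                  ≈⟨ +-identityˡ _ ⟩
      ⟦ e₂ ⟧ ρ                       ∎
      where
      e₁ e₂ : Expr n
      e₁ = proj₁ (f (variables n))
      e₂ = proj₂ (f (variables n))

-- Fixed points and integral domains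

record IsSubring (C : CRing) (P : CommutativeRing.Carrier C → Set) : Set where
  open CommutativeRing C
  field
    resp   : ∀ {a b} → a ≈ b → P a → P b
    has-0  : P 0#
    has-1  : P 1#
    has-+  : ∀ {a b} → P a → P b → P (a + b)
    has-*  : ∀ {a b} → P a → P b → P (a * b)
    has--  : ∀ {a} → P a → P (- a)

  has-⟦⟧ : ∀ {n} (e : Expr n) (ρ : Vec Carrier n) → (∀ i → P (Vec.lookup ρ i)) → P (Solver.⟦_⟧ C e ρ)
  has-⟦⟧ (var i)  ρ h = h i
  has-⟦⟧ :0       ρ h = has-0
  has-⟦⟧ :1       ρ h = has-1
  has-⟦⟧ (e :+ f) ρ h = has-+ (has-⟦⟧ e ρ h) (has-⟦⟧ f ρ h)
  has-⟦⟧ (e :* f) ρ h = has-* (has-⟦⟧ e ρ h) (has-⟦⟧ f ρ h)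
  has-⟦⟧ (:- e)   ρ h = has-- (has-⟦⟧ e ρ h)

  has-× : ∀ n → P (Solver.num C n)
  has-× zero    = has-0
  has-× (suc n) = has-+ has-1 (has-× n)

-- An integral domain with a positive notion of being nonzero, together with a
-- subring on which being zero is decidable.
record Domain (C : CRing) : Set₁ where
  open CommutativeRing C
  field
    Apart      : Carrier → Set
    apart-resp : ∀ {a b} → a ≈ b → Apart a → Apart b
    apart-1    : Apart 1#
    apart-*    : ∀ {a b} → Apart a → Apart b → Apart (a * b)
    cancel-0   : ∀ {a b} → Apart a → a * b ≈ 0# → b ≈ 0#
    Pol        : Carrier → Set
    pol        : IsSubring C Pol
    zero?      : ∀ {a} → Pol a → a ≈ 0# ⊎ Apart a

  open RingProperties ring using (-‿distribʳ-*)

  cancel : ∀ {a b c} → Apart a → a * b ≈ a * c → b ≈ c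
  cancel {a} {b} {c} h eq = begin
    b               ≈⟨ +-identityʳ b ⟨
    b + 0#          ≈⟨ +-congˡ (-‿inverseˡ c) ⟨
    b + (- c + c)   ≈⟨ +-assoc _ _ _ ⟨
    (b - c) + c     ≈⟨ +-congʳ (cancel-0 h a[b-c]≈0) ⟩
    0# + c          ≈⟨ +-identityˡ c ⟩
    c               ∎
    where
    open SetoidReasoning setoid
    a[b-c]≈0 : a * (b - c) ≈ 0#
    a[b-c]≈0 = begin
      a * (b - c)       ≈⟨ distribˡ _ _ _ ⟩
      a * b + a * - c   ≈⟨ +-cong eq (sym (-‿distribʳ-* _ _)) ⟩
      a * c - a * c     ≈⟨ -‿inverseʳ _ ⟩
      0#                ∎

module SeriesProperties (C : CRing) where
  open CommutativeRing C hiding (_-_; zero)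
  open PowerSeries C
  private module P = CommutativeRing ps-ring
  open RingProperties ring using (-0#≈0#)

  infix 4 _≈[_]_
  _≈[_]_ : PS → ℕ → PS → Set
  F ≈[ n ] H = ∀ k → k < n → F k ≈ H k

  ⊗-local : ∀ {F F′ H H′} n → F ≈[ suc n ] F′ → H ≈[ suc n ] H′ → (F ⊗ H) n ≈ (F′ ⊗ H′) n
  ⊗-local zero    p q = *-cong (p 0 z<s) (q 0 z<s)
  ⊗-local (suc n) p q =
    +-cong (*-cong (p 0 z<s) (q (suc n) (ℕₚ.n<1+n _)))
           (⊗-local n (λ k k<n → p (suc k) (s<s k<n)) (λ k k<n → q k (ℕₚ.m<n⇒m<1+n k<n)))

  ⊗-agree : ∀ {F F′ H H′ n} → F ≈[ n ] F′ → H ≈[ n ] H′ → F ⊗ H ≈[ n ] F′ ⊗ H′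
  ⊗-agree p q k k<n =
    ⊗-local k (λ j j≤k → p j (ℕₚ.<-≤-trans j≤k k<n)) (λ j j≤k → q j (ℕₚ.<-≤-trans j≤k k<n))

  -- A factor without constant term gains one order of agreement; every contraction below comes from
  -- this.
  ⊗-vanishing : ∀ {z F H n} → z 0 ≈ 0# → F ≈[ n ] H → z ⊗ F ≈[ suc n ] z ⊗ H
  ⊗-vanishing z₀ p zero    _         = trans (*-congʳ z₀) (trans (zeroˡ _) (sym (trans (*-congʳ z₀) (zeroˡ _))))
  ⊗-vanishing z₀ p (suc k) (s<s k<n) =
    +-cong (trans (*-congʳ z₀) (trans (zeroˡ _) (sym (trans (*-congʳ z₀) (zeroˡ _)))))
           (⊗-agree (λ _ _ → refl) p k k<n)

  ⟦⟧-agree : ∀ {k n} (e : Expr k) {ρ ρ′ : Vec PS k} → (∀ i → Vec.lookup ρ i ≈[ n ] Vec.lookup ρ′ i) →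
             Solver.⟦_⟧ ps-ring e ρ ≈[ n ] Solver.⟦_⟧ ps-ring e ρ′
  ⟦⟧-agree (var i)  h = h i
  ⟦⟧-agree :0       h = λ _ _ → refl
  ⟦⟧-agree :1       h = λ _ _ → refl
  ⟦⟧-agree (e :+ f) h = λ k k<n → +-cong (⟦⟧-agree e h k k<n) (⟦⟧-agree f h k k<n)
  ⟦⟧-agree (e :* f) h = ⊗-agree (⟦⟧-agree e h) (⟦⟧-agree f h)
  ⟦⟧-agree (:- e)   h = λ k k<n → -‿cong (⟦⟧-agree e h k k<n)

  module _ (Φ : PS → PS) (Φ-contractive : ∀ {n F H} → F ≈[ n ] H → Φ F ≈[ suc n ] Φ H) where

    private
      iterate : ℕ → PS
      iterate zero    = λ _ → 0#
      iterate (suc n) = Φ (iterate n)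

      iterate-agree : ∀ {m n} → m ≤ n → iterate m ≈[ m ] iterate n
      iterate-agree z≤n       = λ _ ()
      iterate-agree (s≤s m≤n) = Φ-contractive (iterate-agree m≤n)

    -- The coefficient of index n is settled after n + 1 iterations from 0, so the limit is read off
    -- the diagonal.
    fix : PS
    fix n = iterate (suc n) n

    fix-eq : fix ≋ Φ fix
    fix-eq n = sym (Φ-contractive {n} (λ k k<n → iterate-agree k<n k (ℕₚ.n<1+n k)) n (ℕₚ.n<1+n n))

    -- Each coefficient is reached at a finite stage, so an invariant of `Φ` passes to the limit.
    -- Degree bounds and independence of x are obtained in this way for series that are only known
    -- implicitly.
    fix-preserves : (Q : ℕ → Carrier → Set) → (∀ n → Q n 0#) →
                    (∀ F → (∀ n → Q n (F n)) → ∀ n → Q n (Φ F n)) → ∀ n → Q n (fix n)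
    fix-preserves Q Q-0 Q-Φ n = preserved (suc n) n
      where
      preserved : ∀ m n → Q n (iterate m n)
      preserved zero    n = Q-0 n
      preserved (suc m) n = Q-Φ (iterate m) (preserved m) n

  module _ {k} (a z₁ z₂ : PS) (z₁₀ : z₁ 0 ≈ 0#) (z₂₀ : z₂ 0 ≈ 0#) (e₁ e₂ : Expr (suc k)) (ρ : Vec PS k) where
    open Solver ps-ring using (⟦_⟧)

    private
      Φ : PS → PS
      Φ W = a ⊕ z₁ ⊗ ⟦ e₁ ⟧ (W ∷ ρ) ⊕ z₂ ⊗ ⟦ e₂ ⟧ (W ∷ ρ)

      Φ-contractive : ∀ {n F H} → F ≈[ n ] H → Φ F ≈[ suc n ] Φ H
      Φ-contractive {n} {F} {H} p k k≤n =
        +-cong (+-congˡ (⊗-vanishing {z₁} z₁₀ (⟦⟧-agree e₁ agree) k k≤n)) (⊗-vanishing {z₂} z₂₀ (⟦⟧-agree e₂ agree) k k≤n)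
        where
        agree : ∀ i → Vec.lookup (F ∷ ρ) i ≈[ n ] Vec.lookup (H ∷ ρ) i
        agree zero    = p
        agree (suc i) = λ _ _ → refl

    abstract
      -- The root of W = a + z₁ e₁(W) + z₂ e₂(W). There are two small factors because the equation
      -- for `r̃` contracts through both `ζ` and `w`.
      solution : PS
      solution = fix Φ Φ-contractive

      solution-eq : solution ≋ a ⊕ z₁ ⊗ ⟦ e₁ ⟧ (solution ∷ ρ) ⊕ z₂ ⊗ ⟦ e₂ ⟧ (solution ∷ ρ)
      solution-eq = fix-eq Φ Φ-contractive

      solution-preserves : (Q : ℕ → Carrier → Set) → (sub : IsSubring ps-ring (λ F → ∀ n → Q n (F n))) →
        (∀ n → Q n (a n)) → (∀ n → Q n (z₁ n)) → (∀ n → Q n (z₂ n)) → (∀ i n → Q n (Vec.lookup ρ i n)) →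
        ∀ n → Q n (solution n)
      solution-preserves Q sub Qa Qz₁ Qz₂ Qρ =
        fix-preserves Φ Φ-contractive Q has-0 λ F QF →
          let Qs : ∀ i n → Q n (Vec.lookup (F ∷ ρ) i n)
              Qs = λ { zero → QF ; (suc i) → Qρ i } in
          has-+ (has-+ Qa (has-* Qz₁ (has-⟦⟧ e₁ (F ∷ ρ) Qs))) (has-* Qz₂ (has-⟦⟧ e₂ (F ∷ ρ) Qs))
        where open IsSubring sub

  private
    vanish-⊗ : ∀ F {H n} → (∀ k → k < n → H k ≈ 0#) → ∀ k → k < n → (F ⊗ H) k ≈ 0#
    vanish-⊗ F {H} p zero    k<n = trans (*-congˡ (p 0 k<n)) (zeroʳ _)
    vanish-⊗ F {H} p (suc k) k<n =
      trans (+-cong (trans (*-congˡ (p (suc k) k<n)) (zeroʳ _)) (vanish-⊗ (tail F) p k (ℕₚ.<-trans (ℕₚ.n<1+n k) k<n)))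
            (+-identityˡ _)

  ⊗-below : ∀ {F H} n m → (∀ k → k < n → F k ≈ 0#) → (∀ k → k < m → H k ≈ 0#) →
            ∀ k → k < n ℕ.+ m → (F ⊗ H) k ≈ 0#
  ⊗-below {F} zero    m p q k       k<m         = vanish-⊗ F q k k<m
  ⊗-below     (suc n) m p q zero    _           = trans (*-congʳ (p 0 z<s)) (zeroˡ _)
  ⊗-below     (suc n) m p q (suc k) (s<s k<n+m) =
    trans (+-cong (trans (*-congʳ (p 0 z<s)) (zeroˡ _)) (⊗-below n m (λ j j<n → p (suc j) (s<s j<n)) q k k<n+m))
          (+-identityˡ _)

  -- Orders add and lowest coefficients multiply: this is what carries the domain property from
  -- coefficients to series.
  ⊗-lowest : ∀ {F H} n m → (∀ k → k < n → F k ≈ 0#) → (∀ k → k < m → H k ≈ 0#) →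
             (F ⊗ H) (n ℕ.+ m) ≈ F n * H m
  ⊗-lowest {F} zero    zero    p q = refl
  ⊗-lowest {F} zero    (suc m) p q = trans (+-congˡ (vanish-⊗ (tail F) q m (ℕₚ.n<1+n m))) (+-identityʳ _)
  ⊗-lowest     (suc n) m       p q =
    trans (+-cong (trans (*-congʳ (p 0 z<s)) (zeroˡ _)) (⊗-lowest n m (λ j j<n → p (suc j) (s<s j<n)) q))
          (+-identityˡ _)

  ⊗-coefficient : ∀ (K : Carrier → Set) → (∀ {a b} → K a → K b → K (a + b)) → ∀ {F H} n →
                  (∀ k l → k ℕ.+ l ≡ n → K (F k * H l)) → K ((F ⊗ H) n)
  ⊗-coefficient K K-+ zero    h = h 0 0 ≡.refl
  ⊗-coefficient K K-+ (suc n) h =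
    K-+ (h 0 (suc n) ≡.refl) (⊗-coefficient K K-+ n (λ k l e → h (suc k) l (≡.cong suc e)))

  ⊗-above : ∀ {F H} n m → (∀ k → n < k → F k ≈ 0#) → (∀ k → m < k → H k ≈ 0#) →
            ∀ k → n ℕ.+ m < k → (F ⊗ H) k ≈ 0#
  ⊗-above {F} {H} n m p q k n+m<k =
    ⊗-coefficient (_≈ 0#) (λ a≈0 b≈0 → trans (+-cong a≈0 b≈0) (+-identityˡ _)) k term
    where
    term : ∀ i j → i ℕ.+ j ≡ k → F i * H j ≈ 0#
    term i j i+j≡k with ℕₚ.<-≤-connex n i
    ... | inj₁ n<i = trans (*-congʳ (p i n<i)) (zeroˡ _)
    ... | inj₂ i≤n with ℕₚ.<-≤-connex m j
    ...   | inj₁ m<j = trans (*-congˡ (q j m<j)) (zeroʳ _)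
    ...   | inj₂ j≤m = ⊥-elim (ℕₚ.<⇒≱ n+m<k (≡.subst (_≤ n ℕ.+ m) i+j≡k (ℕₚ.+-mono-≤ i≤n j≤m)))

  module _ {K : Carrier → Set} (sub : IsSubring C K) where
    open IsSubring sub

    coefficientwise : IsSubring ps-ring (λ F → ∀ n → K (F n))
    coefficientwise = record
      { resp  = λ F≋H KF n → resp (F≋H n) (KF n)
      ; has-0 = λ _ → has-0
      ; has-1 = λ { zero → has-1 ; (suc _) → has-0 }
      ; has-+ = λ KF KH n → has-+ (KF n) (KH n)
      ; has-* = λ KF KH n → ⊗-coefficient K has-+ n (λ k l _ → has-* (KF k) (KH l))
      ; has-- = λ KF n → has-- (KF n)
      }

  IsConst : PS → Set
  IsConst F = ∀ n → F (suc n) ≈ 0#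

  isConst : IsSubring ps-ring IsConst
  isConst = record
    { resp  = λ F≋H cF n → trans (sym (F≋H (suc n))) (cF n)
    ; has-0 = λ _ → refl
    ; has-1 = λ _ → refl
    ; has-+ = λ cF cH n → trans (+-cong (cF n) (cH n)) (+-identityˡ _)
    ; has-* = λ {F} {H} cF cH n → ⊗-above {F} {H} 0 0 (λ { (suc k) _ → cF k }) (λ { (suc k) _ → cH k }) (suc n) z<s
    ; has-- = λ cF n → trans (-‿cong (cF n)) -0#≈0#
    }

  module _ (F : PS) (v : Carrier) (F₀v≈1 : F 0 * v ≈ 1#) where
    open CommutativeRing ps-ring using () renaming (_*_ to _*ᴾ_; _+_ to _+ᴾ_; -_ to -ᴾ_; 1# to 1ᴾˢ; 0# to 0ᴾˢ)

    private
      z : PS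
      z = 1ᴾˢ +ᴾ -ᴾ (F *ᴾ const v)

      z₀ : z 0 ≈ 0#
      z₀ = trans (+-congˡ (-‿cong F₀v≈1)) (-‿inverseʳ 1#)

      W : PS
      W = solution 1ᴾˢ z 0ᴾˢ z₀ refl (var zero) :0 []

    -- As v inverts F 0, the series z = 1 - F v has no constant term, and W = 1 + z W means W = 1 /
    -- (F v). Being built from `solution`, the inverse inherits coefficientwise properties.
    inverse : PS
    inverse = const v *ᴾ W

    inverse-eq : F *ᴾ inverse ≋ 1ᴾˢ
    inverse-eq = P.trans (Solver.solve ps-ring 3 (λ { (f ∷ v ∷ w ∷ []) → f :* (v :* w) , w :+ (:- (((:1 :+ (:- (f :* v))) :* w) :+ (:0 :* :0))) }) ≡.refl (F ∷ const v ∷ W ∷ []))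
      (P.trans (P.+-congʳ {x = -ᴾ (z *ᴾ W +ᴾ 0ᴾˢ *ᴾ 0ᴾˢ)} (P.trans (solution-eq 1ᴾˢ z 0ᴾˢ z₀ refl (var zero) :0 []) (P.+-assoc 1ᴾˢ (z *ᴾ W) (0ᴾˢ *ᴾ 0ᴾˢ))))
      (Solver.solve ps-ring 1 (λ { (a ∷ []) → (:1 :+ a) :+ (:- a) , :1 }) ≡.refl (z *ᴾ W +ᴾ 0ᴾˢ *ᴾ 0ᴾˢ ∷ [])))

    inverse-preserves : (Q : ℕ → Carrier → Set) → IsSubring ps-ring (λ F → ∀ n → Q n (F n)) →
      (∀ n → Q n (F n)) → (∀ n → Q n (const v n)) → ∀ n → Q n (inverse n)
    inverse-preserves Q sub QF Qv = has-* Qv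
      (solution-preserves 1ᴾˢ z 0ᴾˢ z₀ refl (var zero) :0 [] Q sub has-1 (has-+ has-1 (has-- (has-* QF Qv))) has-0 (λ ()))
      where open IsSubring sub

module _ {C : CRing} (D : Domain C) where
  open CommutativeRing C hiding (_-_; zero)
  open PowerSeries C
  open SeriesProperties C
  open Domain D
  private module S = IsSubring pol
  open RingProperties ring using (-0#≈0#)

  ps-pol : IsSubring ps-ring (λ F → (∀ n → Pol (F n)) × ∃ λ N → ∀ n → N ≤ n → F n ≈ 0#)
  ps-pol = record
    { resp  = λ { p (q , N , z) → (λ n → S.resp (p n) (q n)) , N , (λ n N≤n → trans (sym (p n)) (z n N≤n)) }
    ; has-0 = (λ _ → S.has-0) , 0 , (λ _ _ → refl)
    ; has-1 = (λ { zero → S.has-1 ; (suc _) → S.has-0 }) , 1 , (λ { (suc _) _ → refl })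
    ; has-+ = λ { (p , N , y) (q , M , z) → (λ n → S.has-+ (p n) (q n)) , N ℕ.+ M ,
                  (λ n N+M≤n → trans (+-cong (y n (ℕₚ.m+n≤o⇒m≤o N N+M≤n)) (z n (ℕₚ.m+n≤o⇒n≤o N N+M≤n))) (+-identityˡ _)) }
    ; has-* = λ { (p , N , y) (q , M , z) → IsSubring.has-* (coefficientwise pol) p q , suc (N ℕ.+ M) ,
                  ⊗-above N M (λ k N<k → y k (ℕₚ.<⇒≤ N<k)) (λ k M<k → z k (ℕₚ.<⇒≤ M<k)) }
    ; has-- = λ { (p , N , y) → (λ n → S.has-- (p n)) , N , (λ n N≤n → trans (-‿cong (y n N≤n)) -0#≈0#) }
    }

  -- A nonzero series is presented by its order n and an apart lowest coefficient. For `cancel-0`,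
  -- once H vanishes below m, the coefficient of index n + m in F H is F n * H m. A polynomial comes
  -- with a bound on its degree, so a finite search decides whether it is zero.
  ps-domain : Domain ps-ring
  ps-domain = record
    { Apart      = λ F → ∃ λ n → (∀ k → k < n → F k ≈ 0#) × Apart (F n)
    ; apart-resp = λ { p (n , z , a) → n , (λ k k<n → trans (sym (p k)) (z k k<n)) , apart-resp (p n) a }
    ; apart-1    = 0 , (λ _ ()) , apart-1
    ; apart-*    = λ { (n , y , a) (m , z , b) →
                       n ℕ.+ m , ⊗-below n m y z , apart-resp (sym (⊗-lowest n m y z)) (apart-* a b) }
    ; cancel-0   = λ { {F} {H} (n , y , a) eq → <-rec (λ m → H m ≈ 0#) λ m rec →
                       cancel-0 a (trans (sym (⊗-lowest n m y (λ k k<m → rec k<m))) (eq (n ℕ.+ m))) }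
    ; Pol        = λ F → (∀ n → Pol (F n)) × ∃ λ N → ∀ n → N ≤ n → F n ≈ 0#
    ; pol        = ps-pol
    ; zero?      = λ { {F} (p , N , y) → decide F p N y }
    }
    where
    search : ∀ F → (∀ n → Pol (F n)) → ∀ N → (∀ k → k < N → F k ≈ 0#) ⊎ ∃ λ n → (∀ k → k < n → F k ≈ 0#) × Apart (F n)
    search F p zero = inj₁ λ _ ()
    search F p (suc N) with search F p N
    ... | inj₂ found = inj₂ found
    ... | inj₁ below with zero? (p N)
    ...   | inj₂ a = inj₂ (N , below , a)
    ...   | inj₁ z = inj₁ λ k k≤N → [ below k , (λ { ≡.refl → z }) ] (ℕₚ.m<1+n⇒m<n∨m≡n k≤N)

    decide : ∀ F → (∀ n → Pol (F n)) → ∀ N → (∀ n → N ≤ n → F n ≈ 0#) →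
             (∀ n → F n ≈ 0#) ⊎ ∃ λ n → (∀ k → k < n → F k ≈ 0#) × Apart (F n)
    decide F p N above with search F p N
    ... | inj₂ found = inj₂ found
    ... | inj₁ below = inj₁ λ n → [ below n , above n ] (ℕₚ.<-≤-connex n N)

-- Algebraic elements

module AlgebraicElements {S : CRing} (D : Domain S) where
  open CommutativeRing S hiding (_-_; zero)
  open Domain D
  open IsSubring pol renaming (resp to pol-resp; has-0 to pol-0; has-1 to pol-1; has-+ to pol-+; has-* to pol-*; has-- to pol--) hiding (has-×; has-⟦⟧)
  open RingProperties ring using (-‿distribʳ-*)
  open SemiringSum semiring using (sum; sum-remove; sum-cong-≋; ∑-distrib-+; *-distribʳ-sum)
  open SemiringExp semiring using (_^_)
  open Solver S
  open SetoidReasoning setoid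

  Span : List Carrier → Carrier → Set
  Span []       p = p ≈ 0#
  Span (m ∷ ms) p = ∃₂ λ c q → Pol c × Span ms q × p ≈ c * m + q

  span-resp : ∀ ms {p q} → p ≈ q → Span ms p → Span ms q
  span-resp []       p≈q p≈0                   = trans (sym p≈q) p≈0
  span-resp (m ∷ ms) p≈q (c , r , pc , sr , e) = c , r , pc , sr , trans (sym p≈q) e

  span-0 : ∀ ms → Span ms 0#
  span-0 []       = refl
  span-0 (m ∷ ms) = 0# , 0# , pol-0 , span-0 ms , sym (trans (+-identityʳ _) (zeroˡ m))

  span-scale : ∀ ms {a p} → Pol a → Span ms p → Span ms (a * p)
  span-scale []       pa p≈0 = trans (*-congˡ p≈0) (zeroʳ _)
  span-scale (m ∷ ms) {a} pa (c , r , pc , sr , e) =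
    a * c , a * r , pol-* pa pc , span-scale ms pa sr ,
    trans (*-congˡ e) (solve 4 (λ { (a ∷ c ∷ m ∷ r ∷ []) → a :* ((c :* m) :+ r) , ((a :* c) :* m) :+ (a :* r) }) ≡.refl (a ∷ c ∷ m ∷ r ∷ []))

  span-+ : ∀ ms {p q} → Span ms p → Span ms q → Span ms (p + q)
  span-+ []       p≈0 q≈0 = trans (+-cong p≈0 q≈0) (+-identityˡ _)
  span-+ (m ∷ ms) (c , r , pc , sr , e) (c′ , r′ , pc′ , sr′ , e′) =
    c + c′ , r + r′ , pol-+ pc pc′ , span-+ ms sr sr′ ,
    trans (+-cong e e′) (solve 5 (λ { (c ∷ r ∷ c′ ∷ r′ ∷ m ∷ []) →
      ((c :* m) :+ r) :+ ((c′ :* m) :+ r′) , ((c :+ c′) :* m) :+ (r :+ r′) }) ≡.refl (c ∷ r ∷ c′ ∷ r′ ∷ m ∷ []))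

  span-++ : ∀ ms ns {p q} → Span ms p → Span ns q → Span (ms ++ ns) (p + q)
  span-++ []       ns p≈0 sq = span-resp ns (sym (trans (+-congʳ p≈0) (+-identityˡ _))) sq
  span-++ (m ∷ ms) ns (c , r , pc , sr , e) sq =
    c , _ , pc , span-++ ms ns sr sq , trans (+-congʳ e) (+-assoc _ _ _)

  span-map : ∀ z ms {p} → Span ms p → Span (List.map (z *_) ms) (z * p)
  span-map z []       p≈0 = trans (*-congˡ p≈0) (zeroʳ z)
  span-map z (m ∷ ms) (c , r , pc , sr , e) =
    c , z * r , pc , span-map z ms sr ,
    trans (*-congˡ e) (solve 4 (λ { (z ∷ c ∷ m ∷ r ∷ []) → z :* ((c :* m) :+ r) , (c :* (z :* m)) :+ (z :* r) }) ≡.refl (z ∷ c ∷ m ∷ r ∷ []))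

  private
    find-apart : ∀ {n} (c : Vector Carrier n) → (∀ i → Pol (c i)) → (∀ i → c i ≈ 0#) ⊎ ∃ λ i → Apart (c i)
    find-apart {zero}  c pc = inj₁ λ ()
    find-apart {suc n} c pc with zero? (pc zero)
    ... | inj₂ a = inj₂ (zero , a)
    ... | inj₁ z with find-apart (λ i → c (suc i)) (λ i → pc (suc i))
    ...   | inj₂ (i , a) = inj₂ (suc i , a)
    ...   | inj₁ zs      = inj₁ λ { zero → z ; (suc i) → zs i }

    sum-0 : ∀ {n} (t : Vector Carrier n) → (∀ i → t i ≈ 0#) → sum t ≈ 0#
    sum-0 {zero}  t h = refl
    sum-0 {suc n} t h = trans (+-cong (h zero) (sum-0 (λ i → t (suc i)) (λ i → h (suc i)))) (+-identityˡ _)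

    sum-pol : ∀ {n} (t : Vector Carrier n) → (∀ i → Pol (t i)) → Pol (sum t)
    sum-pol {zero}  t h = pol-0
    sum-pol {suc n} t h = pol-+ (h zero) (sum-pol (λ i → t (suc i)) (λ i → h (suc i)))

  Dependent : ∀ {n} → Vector Carrier n → Set
  Dependent {n} q = Σ (Vector Carrier n) λ c → (∀ i → Pol (c i)) × (∃ λ i → Apart (c i)) × sum (λ i → c i * q i) ≈ 0#

  -- Fraction-free Gaussian elimination.
  dependent : ∀ ms (q : Vector Carrier (suc (length ms))) → (∀ i → Span ms (q i)) → Dependent q
  dependent [] q s = (λ _ → 1#) , (λ _ → pol-1) , (zero , apart-1) , trans (+-identityʳ _) (trans (*-identityˡ _) (s zero))
  dependent (m ∷ ms) q s with find-apart (λ i → proj₁ (s i)) (λ i → proj₁ (proj₂ (proj₂ (s i))))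
  -- No vector involves m: the first one gets coefficient 0 and the others lie in the span of `ms`.
  ... | inj₁ c≈0 = c′ , pc′ , (suc (proj₁ ac) , proj₂ ac) , trans (+-cong (zeroˡ _) sc) (+-identityˡ _)
    where
    s′ : ∀ i → Span ms (q (suc i))
    s′ i = let (_ , r , _ , sr , e) = s (suc i) in
      span-resp ms (sym (trans e (trans (+-congʳ (trans (*-congʳ (c≈0 (suc i))) (zeroˡ m))) (+-identityˡ r)))) sr
    ih = dependent ms (λ i → q (suc i)) s′
    ac = proj₁ (proj₂ (proj₂ ih))
    sc = proj₂ (proj₂ (proj₂ ih))
    c′ : Vector Carrier _
    c′ zero    = 0#
    c′ (suc i) = proj₁ ih i
    pc′ : ∀ i → Pol (c′ i)
    pc′ zero    = pol-0
    pc′ (suc i) = proj₁ (proj₂ ih) i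
  ... | inj₂ (i₀ , a₀) = b , pb , (punchIn i₀ (proj₁ ac) , apart-resp (reflexive (≡.sym (b-punch (proj₁ ac)))) (apart-* (proj₂ ac) a₀)) , eq
    where
    c r : Vector Carrier (suc (suc (length ms)))
    c i = proj₁ (s i)
    r i = proj₁ (proj₂ (s i))
    pc : ∀ i → Pol (c i)
    pc i = proj₁ (proj₂ (proj₂ (s i)))
    sr : ∀ i → Span ms (r i)
    sr i = proj₁ (proj₂ (proj₂ (proj₂ (s i))))
    e : ∀ i → q i ≈ c i * m + r i
    e i = proj₂ (proj₂ (proj₂ (proj₂ (s i))))
    -- Cross-multiplication with the apart coefficient `c i₀` cancels m without division.
    q′ : Vector Carrier (suc (length ms))
    q′ j = c i₀ * q (punchIn i₀ j) + - c (punchIn i₀ j) * q i₀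
    s′ : ∀ j → Span ms (q′ j)
    s′ j = span-resp ms (sym (trans (+-cong (*-congˡ (e _)) (*-congˡ (e i₀)))
        (solve 5 (λ { (a ∷ b ∷ r ∷ s ∷ m ∷ []) → (a :* ((b :* m) :+ r)) :+ ((:- b) :* ((a :* m) :+ s)) , (a :* r) :+ ((:- b) :* s) })
          ≡.refl (c i₀ ∷ c (punchIn i₀ j) ∷ r (punchIn i₀ j) ∷ r i₀ ∷ m ∷ []))))
      (span-+ ms (span-scale ms (pc i₀) (sr _)) (span-scale ms (pol-- (pc _)) (sr i₀)))
    ih = dependent ms q′ s′
    a  = proj₁ ih
    pa = proj₁ (proj₂ ih)
    ac = proj₁ (proj₂ (proj₂ ih))
    -- Expanding a relation `a` among the `q′` gives a j * c i₀ in front of each other vector and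
    -- this collected sum in front of q i₀. The result is nontrivial because `c i₀` is apart.
    pivot : Carrier
    pivot = sum (λ j → a j * - c (punchIn i₀ j))
    b : Vector Carrier (suc (suc (length ms)))
    b = insertAt (λ j → a j * c i₀) i₀ pivot
    b-punch : ∀ j → b (punchIn i₀ j) ≡ a j * c i₀
    b-punch = Vectorₚ.insertAt-punchIn (λ j → a j * c i₀) i₀ pivot
    b-pivot : b i₀ ≡ pivot
    b-pivot = Vectorₚ.insertAt-lookup (λ j → a j * c i₀) i₀ pivot
    pb : ∀ i → Pol (b i)
    pb i = pol-insert {t = λ j → a j * c i₀} (λ j → pol-* (pa j) (pc i₀)) (sum-pol _ (λ j → pol-* (pa j) (pol-- (pc (punchIn i₀ j))))) i₀ i
      where
      pol-insert : ∀ {n} {t : Vector Carrier n} {x} → (∀ j → Pol (t j)) → Pol x → ∀ i j → Pol (insertAt t i x j)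
      pol-insert {n}     pt px zero    zero    = px
      pol-insert {n}     pt px zero    (suc j) = pt j
      pol-insert {suc n} pt px (suc i) zero    = pt zero
      pol-insert {suc n} pt px (suc i) (suc j) = pol-insert (λ j → pt (suc j)) px i j
    eq : sum (λ i → b i * q i) ≈ 0#
    eq = begin
      sum (λ i → b i * q i)
        ≈⟨ sum-remove {i = i₀} (λ i → b i * q i) ⟩
      b i₀ * q i₀ + sum (λ j → b (punchIn i₀ j) * q (punchIn i₀ j))
        ≈⟨ +-cong (*-congʳ (reflexive b-pivot)) (sum-cong-≋ (λ j → *-congʳ {q (punchIn i₀ j)} (reflexive (b-punch j)))) ⟩
      pivot * q i₀ + sum (λ j → a j * c i₀ * q (punchIn i₀ j))
        ≈⟨ +-congʳ (*-distribʳ-sum (q i₀) (λ j → a j * - c (punchIn i₀ j))) ⟩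
      sum (λ j → a j * - c (punchIn i₀ j) * q i₀) + sum (λ j → a j * c i₀ * q (punchIn i₀ j))
        ≈⟨ ∑-distrib-+ (λ j → a j * - c (punchIn i₀ j) * q i₀) (λ j → a j * c i₀ * q (punchIn i₀ j)) ⟨
      sum (λ j → a j * - c (punchIn i₀ j) * q i₀ + a j * c i₀ * q (punchIn i₀ j))
        ≈⟨ sum-cong-≋ (λ j → solve 5 (λ { (a ∷ c ∷ q ∷ c₀ ∷ q₀ ∷ []) →
             ((a :* (:- c)) :* q₀) :+ ((a :* c₀) :* q) , a :* ((c₀ :* q) :+ ((:- c) :* q₀)) })
             ≡.refl (a j ∷ c (punchIn i₀ j) ∷ q (punchIn i₀ j) ∷ c i₀ ∷ q i₀ ∷ [])) ⟩
      sum (λ j → a j * q′ j)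
        ≈⟨ proj₂ (proj₂ (proj₂ ih)) ⟩
      0# ∎

  -- Finite-dimensional over the fraction field of Pol.
  record FiniteExtension (L : Carrier → Set) : Set where
    field
      subring   : IsSubring S L
      has-pol   : ∀ {p} → Pol p → L p
      -- Division by a nonzero polynomial whenever the quotient exists in S: the substitute for L
      -- being a field containing the fractions of `Pol`.
      saturated : ∀ {d p} → Pol d → Apart d → L (d * p) → L p
      basis     : List Carrier
      spanned   : ∀ {p} → L p → ∃ λ d → Pol d × Apart d × Span basis (d * p)

  -- The part of the fraction field of `Pol` that lies in S: the one-dimensional base of every
  -- tower.
  Fractions : Carrier → Set
  Fractions p = ∃ λ d → Pol d × Apart d × Pol (d * p)

  fractions : FiniteExtension Fractions
  fractions = record
    { subring = record
      { resp  = λ { p≈q (d , pd , ad , pp) → d , pd , ad , pol-resp (*-congˡ p≈q) pp }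
      ; has-0 = of-pol pol-0
      ; has-1 = of-pol pol-1
      ; has-+ = λ { {p} {q} (d , pd , ad , pp) (d′ , pd′ , ad′ , pq) → d * d′ , pol-* pd pd′ , apart-* ad ad′ ,
                    pol-resp (solve 4 (λ { (d ∷ d′ ∷ p ∷ q ∷ []) → (d′ :* (d :* p)) :+ (d :* (d′ :* q)) , (d :* d′) :* (p :+ q) }) ≡.refl (d ∷ d′ ∷ p ∷ q ∷ []))
                      (pol-+ (pol-* pd′ pp) (pol-* pd pq)) }
      ; has-* = λ { {p} {q} (d , pd , ad , pp) (d′ , pd′ , ad′ , pq) → d * d′ , pol-* pd pd′ , apart-* ad ad′ ,
                    pol-resp (solve 4 (λ { (d ∷ d′ ∷ p ∷ q ∷ []) → (d :* p) :* (d′ :* q) , (d :* d′) :* (p :* q) }) ≡.refl (d ∷ d′ ∷ p ∷ q ∷ []))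
                      (pol-* pp pq) }
      ; has-- = λ { (d , pd , ad , pp) → d , pd , ad , pol-resp (-‿distribʳ-* _ _) (pol-- pp) }
      }
    ; has-pol   = of-pol
    ; saturated = λ { pd ad (d′ , pd′ , ad′ , pp) → _ , pol-* pd′ pd , apart-* ad′ ad , pol-resp (sym (*-assoc _ _ _)) pp }
    ; basis     = 1# ∷ []
    ; spanned   = λ { (d , pd , ad , pp) → d , pd , ad , _ , 0# , pp , refl , sym (trans (+-identityʳ _) (*-identityʳ _)) }
    }
    where
    of-pol : ∀ {p} → Pol p → Fractions p
    of-pol pp = 1# , pol-1 , apart-1 , pol-resp (sym (*-identityˡ _)) pp

  module Adjoin {L} (E : FiniteExtension L) (z : Carrier) where
    open FiniteExtension E
    open IsSubring subring

    Deg< : ℕ → Carrier → Set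
    Deg< zero    p = p ≈ 0#
    Deg< (suc n) p = ∃₂ λ c q → L c × Deg< n q × p ≈ c + z * q

    deg-resp : ∀ n {p q} → p ≈ q → Deg< n p → Deg< n q
    deg-resp zero    p≈q p≈0                   = trans (sym p≈q) p≈0
    deg-resp (suc n) p≈q (c , r , lc , dr , e) = c , r , lc , dr , trans (sym p≈q) e

    deg-0 : ∀ n → Deg< n 0#
    deg-0 zero    = refl
    deg-0 (suc n) = 0# , 0# , has-0 , deg-0 n , sym (trans (+-identityˡ _) (zeroʳ z))

    deg-scale : ∀ n {a p} → L a → Deg< n p → Deg< n (a * p)
    deg-scale zero    la p≈0 = trans (*-congˡ p≈0) (zeroʳ _)
    deg-scale (suc n) {a} la (c , r , lc , dr , e) =
      a * c , a * r , has-* la lc , deg-scale n la dr ,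
      trans (*-congˡ e) (solve 4 (λ { (a ∷ c ∷ z ∷ r ∷ []) → a :* (c :+ (z :* r)) , (a :* c) :+ (z :* (a :* r)) }) ≡.refl (a ∷ c ∷ z ∷ r ∷ []))

    deg-+ : ∀ n {p q} → Deg< n p → Deg< n q → Deg< n (p + q)
    deg-+ zero    p≈0 q≈0 = trans (+-cong p≈0 q≈0) (+-identityˡ _)
    deg-+ (suc n) (c , r , lc , dr , e) (c′ , r′ , lc′ , dr′ , e′) =
      c + c′ , r + r′ , has-+ lc lc′ , deg-+ n dr dr′ ,
      trans (+-cong e e′) (solve 5 (λ { (c ∷ r ∷ c′ ∷ r′ ∷ z ∷ []) →
        (c :+ (z :* r)) :+ (c′ :+ (z :* r′)) , (c :+ c′) :+ (z :* (r :+ r′)) }) ≡.refl (c ∷ r ∷ c′ ∷ r′ ∷ z ∷ []))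

    -- Horner form exposes the constant coefficient, while reduction by a relation needs the leading
    -- one.
    deg-top : ∀ n {p} → Deg< (suc n) p → ∃₂ λ c q → L c × Deg< n q × p ≈ q + c * z ^ n
    deg-top zero (c , r , lc , r≈0 , e) =
      c , 0# , lc , refl , trans e (trans (+-congˡ (trans (*-congˡ r≈0) (zeroʳ z))) (trans (+-comm _ _) (+-congˡ (sym (*-identityʳ c)))))
    deg-top (suc n) (c , r , lc , dr , e) =
      let (c′ , r′ , lc′ , dr′ , e′) = deg-top n dr in
      c′ , c + z * r′ , lc′ , (c , r′ , lc , dr′ , refl) ,
      trans e (trans (+-congˡ (*-congˡ e′)) (solve 5 (λ { (c ∷ z ∷ r′ ∷ c′ ∷ zⁿ ∷ []) →
        c :+ (z :* (r′ :+ (c′ :* zⁿ))) , (c :+ (z :* r′)) :+ (c′ :* (z :* zⁿ)) }) ≡.refl (c ∷ z ∷ r′ ∷ c′ ∷ z ^ n ∷ [])))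

    module Over (n : ℕ) {d} (pd : Pol d) (ad : Apart d) (relation : Deg< (suc n) (d * z ^ suc n)) where

      -- L[z] up to denominators: the relation brings every power of z down to degree at most n, at
      -- the cost of a polynomial factor.
      Adjoined : Carrier → Set
      Adjoined p = ∃ λ d → Pol d × Apart d × Deg< (suc n) (d * p)

      private
        adj-resp : ∀ {p q} → p ≈ q → Adjoined p → Adjoined q
        adj-resp p≈q (d , pd , ad , h) = d , pd , ad , deg-resp (suc n) (*-congˡ p≈q) h

        adj-sat : ∀ {d p} → Pol d → Apart d → Adjoined (d * p) → Adjoined p
        adj-sat pd ad (d′ , pd′ , ad′ , h) = _ , pol-* pd′ pd , apart-* ad′ ad , deg-resp (suc n) (sym (*-assoc _ _ _)) h

        adj-scale : ∀ {a p} → L a → Adjoined p → Adjoined (a * p)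
        adj-scale {a} {p} la (d , pd , ad , h) = d , pd , ad ,
          deg-resp (suc n) (solve 3 (λ { (a ∷ d ∷ p ∷ []) → a :* (d :* p) , d :* (a :* p) }) ≡.refl (a ∷ d ∷ p ∷ [])) (deg-scale (suc n) la h)

        adj-+ : ∀ {p q} → Adjoined p → Adjoined q → Adjoined (p + q)
        adj-+ {p} {q} (d , pd , ad , h) (d′ , pd′ , ad′ , h′) = d * d′ , pol-* pd pd′ , apart-* ad ad′ ,
          deg-resp (suc n) (solve 4 (λ { (d ∷ d′ ∷ p ∷ q ∷ []) → (d′ :* (d :* p)) :+ (d :* (d′ :* q)) , (d :* d′) :* (p :+ q) }) ≡.refl (d ∷ d′ ∷ p ∷ q ∷ []))
            (deg-+ (suc n) (deg-scale (suc n) (has-pol pd′) h) (deg-scale (suc n) (has-pol pd) h′))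

        adj-0 : Adjoined 0#
        adj-0 = 1# , pol-1 , apart-1 , deg-resp (suc n) (sym (zeroʳ _)) (deg-0 (suc n))

        -- Multiplication by z raises the degree by one; the new leading term c z^(n+1) is traded
        -- for lower ones after multiplication by the d of the relation.
        adj-z : ∀ {p} → Adjoined p → Adjoined (z * p)
        adj-z {p} (d′ , pd′ , ad′ , h) =
          let (c , q , lc , dq , e) = deg-top (suc n) (0# , d′ * p , has-0 , h , sym (+-identityˡ _)) in
          d * d′ , pol-* pd pd′ , apart-* ad ad′ ,
          deg-resp (suc n) (begin
            d * q + c * (d * z ^ suc n)  ≈⟨ solve 4 (λ { (d ∷ q ∷ c ∷ zⁿ ∷ []) → (d :* q) :+ (c :* (d :* zⁿ)) , d :* (q :+ (c :* zⁿ)) }) ≡.refl (d ∷ q ∷ c ∷ z ^ suc n ∷ []) ⟩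
            d * (q + c * z ^ suc n)      ≈⟨ *-congˡ e ⟨
            d * (z * (d′ * p))           ≈⟨ solve 4 (λ { (d ∷ z ∷ d′ ∷ p ∷ []) → d :* (z :* (d′ :* p)) , (d :* d′) :* (z :* p) }) ≡.refl (d ∷ z ∷ d′ ∷ p ∷ []) ⟩
            (d * d′) * (z * p)           ∎)
            (deg-+ (suc n) (deg-scale (suc n) (has-pol pd) dq) (deg-scale (suc n) lc relation))

        deg-adj-* : ∀ m {p q} → Deg< m p → Adjoined q → Adjoined (p * q)
        deg-adj-* zero    p≈0 aq = adj-resp (sym (trans (*-congʳ p≈0) (zeroˡ _))) adj-0
        deg-adj-* (suc m) {p} {q} (c , r , lc , dr , e) aq =
          adj-resp (sym (trans (*-congʳ e) (solve 4 (λ { (c ∷ z ∷ r ∷ q ∷ []) → (c :+ (z :* r)) :* q , (c :* q) :+ (z :* (r :* q)) }) ≡.refl (c ∷ z ∷ r ∷ q ∷ []))))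
            (adj-+ (adj-scale lc aq) (adj-z (deg-adj-* m dr aq)))

      adjoined-base : ∀ {p} → L p → Adjoined p
      adjoined-base {p} lp = 1# , pol-1 , apart-1 , p , 0# , lp , deg-0 n , trans (*-identityˡ p) (sym (trans (+-congˡ (zeroʳ z)) (+-identityʳ p)))

      adjoined-z : Adjoined z
      adjoined-z = adj-resp (*-identityʳ z) (adj-z (adjoined-base has-1))

      private
        powers : ℕ → List Carrier
        powers zero    = []
        powers (suc m) = basis ++ List.map (z *_) (powers m)

        deg-spanned : ∀ m {p} → Deg< m p → ∃ λ d → Pol d × Apart d × Span (powers m) (d * p)
        deg-spanned zero    p≈0 = 1# , pol-1 , apart-1 , trans (*-identityˡ _) p≈0
        deg-spanned (suc m) {p} (c , r , lc , dr , e) =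
          let (d , pd , ad , h) = spanned lc
              (d′ , pd′ , ad′ , h′) = deg-spanned m dr in
          d * d′ , pol-* pd pd′ , apart-* ad ad′ ,
          span-resp (powers (suc m)) (trans (solve 5 (λ { (d ∷ d′ ∷ c ∷ z ∷ r ∷ []) →
              (d′ :* (d :* c)) :+ (z :* (d :* (d′ :* r))) , (d :* d′) :* (c :+ (z :* r)) }) ≡.refl (d ∷ d′ ∷ c ∷ z ∷ r ∷ []))
              (*-congˡ (sym e)))
            (span-++ basis (List.map (z *_) (powers m)) (span-scale basis pd′ h) (span-map z (powers m) (span-scale (powers m) pd h′)))

      adjoin : FiniteExtension Adjoined
      adjoin = record
        { subring = record
          { resp  = adj-resp
          ; has-0 = adj-0
          ; has-1 = adjoined-base has-1
          ; has-+ = adj-+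
          ; has-* = λ { {p} {q} (d , pd , ad , h) aq → adj-sat pd ad (adj-resp (*-assoc d p q) (deg-adj-* (suc n) h aq)) }
          ; has-- = λ {p} ap → adj-resp (solve 1 (λ { (p ∷ []) → (:- :1) :* p , :- p }) ≡.refl (p ∷ [])) (adj-scale (has-- has-1) ap)
          }
        ; has-pol   = λ pp → adjoined-base (has-pol pp)
        ; saturated = adj-sat
        ; basis     = powers (suc n)
        ; spanned   = λ { (d , pd , ad , h) →
            let (d′ , pd′ , ad′ , h′) = deg-spanned (suc n) h in
            _ , pol-* pd′ pd , apart-* ad′ ad , span-resp (powers (suc n)) (sym (*-assoc _ _ _)) h′ }
        }

  -- There is one more power p⁰, ..., p^N than the length N of the basis, so the powers, with
  -- denominators cleared, are dependent.
  algebraic : ∀ {L} → FiniteExtension L → ∀ {p} → L p → ∃ λ n → Dependent {suc n} (λ i → p ^ toℕ i)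
  algebraic {L} E {p} lp =
    let (c , pc , (i , ai) , eq) = dependent basis (λ i → den i * p ^ toℕ i) (λ i → proj₂ (proj₂ (proj₂ (spanned (power (toℕ i)))))) in
    length basis , (λ i → c i * den i) , (λ i → pol-* (pc i) (den-pol i)) , (i , apart-* ai (den-apart i)) ,
    trans (sum-cong-≋ (λ i → *-assoc (c i) (den i) (p ^ toℕ i))) eq
    where
    open FiniteExtension E
    open IsSubring subring
    power : ∀ n → L (p ^ n)
    power zero    = has-1
    power (suc n) = has-* lp (power n)
    den : Vector Carrier (suc (length basis))
    den i = proj₁ (spanned (power (toℕ i)))
    den-pol : ∀ i → Pol (den i)
    den-pol i = proj₁ (proj₂ (spanned (power (toℕ i))))
    den-apart : ∀ i → Apart (den i)
    den-apart i = proj₁ (proj₂ (proj₂ (spanned (power (toℕ i)))))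

-- Finite sums and polynomial relations

module FiniteSums (C : CRing) where
  open CommutativeRing C hiding (zero; refl; sym; trans)
  open PowerSeries C using (PS; _⊗_)
  private module C = CommutativeRing C
  open SemiringSum semiring using (sum)

  Σ< : ℕ → (ℕ → Carrier) → Carrier
  Σ< zero    f = 0#
  Σ< (suc n) f = Σ< n f + f n

  Σ<-cong : ∀ n {f h} → (∀ k → k < n → f k ≈ h k) → Σ< n f ≈ Σ< n h
  Σ<-cong zero    e = C.refl
  Σ<-cong (suc n) e = +-cong (Σ<-cong n (λ k k<n → e k (ℕₚ.m<n⇒m<1+n k<n))) (e n (ℕₚ.n<1+n n))

  Σ<-0 : ∀ n {f} → (∀ k → k < n → f k ≈ 0#) → Σ< n f ≈ 0#
  Σ<-0 zero    e = C.refl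
  Σ<-0 (suc n) e = C.trans (+-cong (Σ<-0 n (λ k k<n → e k (ℕₚ.m<n⇒m<1+n k<n))) (e n (ℕₚ.n<1+n n))) (+-identityˡ _)

  Σ<-peel : ∀ n f → Σ< (suc n) f ≈ f 0 + Σ< n (λ k → f (suc k))
  Σ<-peel zero    f = +-comm _ _
  Σ<-peel (suc n) f = C.trans (+-congʳ (Σ<-peel n f)) (+-assoc _ _ _)

  Σ<-extend : ∀ n m {f} → (∀ k → n ≤ k → f k ≈ 0#) → Σ< (m ℕ.+ n) f ≈ Σ< n f
  Σ<-extend n zero    e = C.refl
  Σ<-extend n (suc m) e = C.trans (+-cong (Σ<-extend n m e) (e (m ℕ.+ n) (ℕₚ.m≤n+m n m))) (+-identityʳ _)

  ⊗-Σ< : ∀ (F H : PS) n → (F ⊗ H) n ≈ Σ< (suc n) (λ k → F k * H (n ∸ k))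
  ⊗-Σ< F H zero    = C.sym (+-identityˡ _)
  ⊗-Σ< F H (suc n) = C.trans (+-congˡ (⊗-Σ< (λ k → F (suc k)) H n)) (C.sym (Σ<-peel (suc n) _))

  extend : ∀ {n} → Vector Carrier n → ℕ → Carrier
  extend {zero}  t k       = 0#
  extend {suc n} t zero    = t zero
  extend {suc n} t (suc k) = extend (λ i → t (suc i)) k

  extend-toℕ : ∀ {n} (t : Vector Carrier n) i → extend t (toℕ i) ≡ t i
  extend-toℕ {suc n} t zero    = ≡.refl
  extend-toℕ {suc n} t (suc i) = extend-toℕ (λ i → t (suc i)) i

  sum-Σ< : ∀ {n} m (t : Vector Carrier n) (q : ℕ → Carrier) → n ≤ m →
           Σ< m (λ k → extend t k * q k) ≈ sum (λ i → t i * q (toℕ i))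
  sum-Σ< {zero}  m       t q _         = Σ<-0 m (λ k _ → zeroˡ _)
  sum-Σ< {suc n} (suc m) t q (s≤s n≤m) =
    C.trans (Σ<-peel m _) (+-congˡ (sum-Σ< m (λ i → t (suc i)) (λ k → q (suc k)) n≤m))

module _ {S : CRing} (dom : Domain S) where
  open CommutativeRing S using (Carrier; _≈_; _*_; 0#; semiring) renaming (trans to ≈-trans)
  open Domain dom
  open AlgebraicElements dom using (Dependent)
  open FiniteSums S
  open SemiringExp semiring using (_^_)

  -- The sum vanishes for every upper limit from N on, because a `Poly4` has a single bound for all
  -- four exponents and its range for T may have to exceed N.
  PolynomialRelation : Carrier → Set
  PolynomialRelation F = Σ (ℕ → Carrier) λ c → ∃ λ N → (∀ a → Pol (c a)) × (∀ a → N < a → c a ≡ 0#) ×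
    (∃ λ a → a ≤ N × Apart (c a)) × (∀ m → N ≤ m → Σ< (suc m) (λ a → c a * F ^ a) ≈ 0#)

  polynomial-relation : ∀ {N F} → Dependent {suc N} (λ i → F ^ toℕ i) → PolynomialRelation F
  polynomial-relation {N} {F} (c , pc , (i , ai) , eq) =
    extend c , N , pol-extend c pc , above c ,
    (toℕ i , ℕₚ.≤-pred (toℕ<n i) , ≡.subst Apart (≡.sym (extend-toℕ c i)) ai) ,
    λ m N≤m → ≈-trans (sum-Σ< (suc m) c (F ^_) (s≤s N≤m)) eq
    where
    pol-extend : ∀ {n} (c : Vector Carrier n) → (∀ i → Pol (c i)) → ∀ a → Pol (extend c a)
    pol-extend {zero}  c pc a       = IsSubring.has-0 pol
    pol-extend {suc n} c pc zero    = pc zero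
    pol-extend {suc n} c pc (suc a) = pol-extend (λ i → c (suc i)) (λ i → pc (suc i)) a
    above : ∀ {n} (c : Vector Carrier n) a → n ≤ a → extend c a ≡ 0#
    above {zero}  c a       _         = ≡.refl
    above {suc n} c (suc a) (s≤s n≤a) = above (λ i → c (suc i)) a n≤a

-- The kernel equation and its invariants

module RawNotation (R : RawRing 0ℓ 0ℓ) where
  open RawRing R public
  open RawSemiringDefinitions rawSemiring public using (_^_) renaming (_×_ to _×ᴿ_)

  infixl 6 _-_
  _-_ : Carrier → Carrier → Carrier
  a - b = a + - b

  infix 9 #_
  #_ : ℕ → Carrier
  # k = k ×ᴿ 1#

-- G(x,0) = a₀ + x (a₁ + x a₂) and G(0,y) = a₀ + y b₁; the argument X stands for t (G(x,0) - a₀).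
module KernelFormulas (R : RawRing 0ℓ 0ℓ) where
  open RawNotation R

  kernelUnit kernel : (t x y : Carrier) → Carrier
  kernelUnit t x y = (# 1 + y) * (# 1 + x * x * y)
  kernel     t x y = x * y - t * kernelUnit t x y

  section-x : (x a₀ a₁ a₂ : Carrier) → Carrier
  section-x x a₀ a₁ a₂ = a₀ + x * (a₁ + x * a₂)

  kernelRhs : (t x y a₀ b X : Carrier) → Carrier
  kernelRhs t x y a₀ b X = x * y - t * (# 1 + y) * b - X

  -- With U = X + 1/x and J = (x + 1/x)(1/t - x - 1/x) this is t x (U² - U/t + J + 2 - 2 t a₁). In
  -- U² - U/t + J the poles at x = 0 cancel when X = t x (a₁ + ...), and the constant 2 - 2 t a₁
  -- makes the value there zero.
  invariantN : (t x a₁ X : Carrier) → Carrier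
  invariantN t x a₁ X = x ^ 2 - t * x ^ 3 + # 2 * t * X - # 2 * t ^ 2 * a₁ * x + t * x * X ^ 2 - x * X

  -- y times the same combination as a function of y: modulo the kernel, when X = x y - t (1 + y) b,
  -- one has U = y/(t(1+y)) - t(1+y) b and J + 2 = y/(t²(1+y)²) + y + 1/y.
  invariantL : (t y a₁ b : Carrier) → Carrier
  invariantL t y a₁ b = # 1 + y ^ 2 - # 2 * t * a₁ * y + y * (# 1 - y) * b + t ^ 2 * y * (# 1 + y) ^ 2 * b ^ 2

  -- This is t (1 + y)(U + t a₀) as a function of y. It exists because the kernel gives x y + 1/x =
  -- y/(t(1+y)), splitting x y into a function of x and a function of y.
  decoupling : (t y a₀ b : Carrier) → Carrier
  decoupling t y a₀ b = y - t ^ 2 * (# 1 + y) ^ 2 * b + t ^ 2 * (# 1 + y) * a₀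

  -- The difference of the two sides of the invariant identity, multiplied by x²y.
  difference : (t x y a₀ a₁ b X : Carrier) → Carrier
  difference t x y a₀ a₁ b X =
    (# 1 + y) * y * invariantN t x a₁ X * (# 1 + x * X + t * x * a₀) - invariantL t y a₁ b * decoupling t y a₀ b * x ^ 2

  -- Quotient by the kernel of the value of difference at the X for which kernelRhs vanishes.
  cofactor : (t x y a₀ a₁ b : Carrier) → Carrier
  cofactor t x y a₀ a₁ b =
    # 2 * y * t * b + # 2 * y ^ 2 * t * b - x * y * b + # 2 * x * y * t * a₁
    - # 3 * x * y * t ^ 2 * b ^ 2 + # 2 * x * y * t ^ 2 * a₀ * b - # 2 * x * y ^ 2 + x * y ^ 2 * b
    - # 6 * x * y ^ 2 * t ^ 2 * b ^ 2 + # 2 * x * y ^ 2 * t ^ 2 * a₀ * b - # 3 * x * y ^ 3 * t ^ 2 * b ^ 2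
    - x ^ 2 * t * b + x ^ 2 * t * a₀ - x ^ 2 * y * t * b + # 3 * x ^ 2 * y ^ 2 * t * b
    - x ^ 2 * y ^ 2 * t * a₀ + # 3 * x ^ 2 * y ^ 3 * t * b + x ^ 3 * y - x ^ 3 * y ^ 3

  -- Divided difference of difference between X and the zero of kernelRhs.
  slope : (t x y a₀ a₁ b X : Carrier) → Carrier
  slope t x y a₀ a₁ b X =
    (# 1 + y) * y * ((n₁ * v + n₀ * x) + (n₂ * v + n₁ * x) * (X + X₀) + n₂ * x * (X ^ 2 + X * X₀ + X₀ ^ 2))
    where
    X₀ = x * y - t * (# 1 + y) * b
    n₀ = x ^ 2 - t * x ^ 3 - # 2 * t ^ 2 * a₁ * x
    n₁ = # 2 * t - x
    n₂ = t * x
    v  = # 1 + t * x * a₀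

  -- `invariantN` divided by x², at X = t x (a₁ + x a₂).
  catalytic : (t x a₁ a₂ : Carrier) → Carrier
  catalytic t x a₁ a₂ =
    # 1 - t * x + # 2 * t ^ 2 * a₂ + t ^ 3 * x * (a₁ + x * a₂) ^ 2 - t * (a₁ + x * a₂)

  catalyticSide : (t x a₀ a₁ a₂ : Carrier) → Carrier
  catalyticSide t x a₀ a₁ a₂ = catalytic t x a₁ a₂ * (# 1 + t * x * section-x x a₀ a₁ a₂)

  -- The second factor is `decoupling` divided by y; that y compensates the pole 1/y of the
  -- invariant.
  invariantLSide : (t y a₀ a₁ b₁ : Carrier) → Carrier
  invariantLSide t y a₀ a₁ b₁ =
    invariantL t y a₁ (a₀ + y * b₁) * (# 1 - t ^ 2 * (# 1 + y) * (a₀ + y * b₁ + b₁))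

module KernelIdentities (R : CRing) where
  open CommutativeRing R hiding (zero; _-_)
  open RawNotation rawRing using (_-_; _^_; #_)
  open Solver R
  module F = KernelFormulas rawRing
  private module E {n} = KernelFormulas (exprRing n)

  -- Expansion of `difference` in X around the zero of `kernelRhs`. For the generating function
  -- `kernelRhs` is K G, so both terms become multiples of K.
  difference-kernel : ∀ t x y a₀ a₁ b X → F.difference t x y a₀ a₁ b X ≈
    F.kernel t x y * F.cofactor t x y a₀ a₁ b - F.kernelRhs t x y a₀ b X * F.slope t x y a₀ a₁ b X
  difference-kernel t x y a₀ a₁ b X = solve 7 (λ { (t ∷ x ∷ y ∷ a₀ ∷ a₁ ∷ b ∷ X ∷ []) →
      E.difference t x y a₀ a₁ b X ,
      (E.kernel t x y :* E.cofactor t x y a₀ a₁ b) :+ (:- (E.kernelRhs t x y a₀ b X :* E.slope t x y a₀ a₁ b X)) })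
    ≡.refl (t ∷ x ∷ y ∷ a₀ ∷ a₁ ∷ b ∷ X ∷ [])

  difference-sides : ∀ t x y a₀ a₁ a₂ b₁ → F.difference t x y a₀ a₁ (a₀ + y * b₁) (t * (x * (a₁ + x * a₂))) ≈
    x * y * (x * ((1# + y) * F.catalyticSide t x a₀ a₁ a₂ - F.invariantLSide t y a₀ a₁ b₁))
  difference-sides t x y a₀ a₁ a₂ b₁ = solve 7 (λ { (t ∷ x ∷ y ∷ a₀ ∷ a₁ ∷ a₂ ∷ b₁ ∷ []) →
      E.difference t x y a₀ a₁ (a₀ :+ (y :* b₁)) (t :* (x :* (a₁ :+ (x :* a₂)))) ,
      (x :* y) :* (x :* (((:1 :+ y) :* E.catalyticSide t x a₀ a₁ a₂) :+ (:- E.invariantLSide t y a₀ a₁ b₁))) })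
    ≡.refl (t ∷ x ∷ y ∷ a₀ ∷ a₁ ∷ a₂ ∷ b₁ ∷ [])

module RingLemmas (R : CRing) where
  open CommutativeRing R hiding (zero)
  open RingProperties ring using (-0#≈0#)

  -- Brings hypotheses into reflected identities: `solve` writes a quantity as another plus
  -- multiples of differences l - r, and one `drop` for each hypothesis l ≈ r removes them.
  drop : ∀ {a c l r} → l ≈ r → a + c * (l - r) ≈ a
  drop {a} {c} {l} {r} l≈r =
    trans (+-congˡ (trans (*-congˡ (trans (+-congʳ l≈r) (-‿inverseʳ r))) (zeroʳ c))) (+-identityʳ a)

  difference-0 : ∀ {a b} → a ≈ b → a - b ≈ 0#
  difference-0 {a} {b} a≈b = trans (+-congʳ a≈b) (-‿inverseʳ b)

  equal-from-0 : ∀ {a b} → a - b ≈ 0# → a ≈ b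
  equal-from-0 {a} {b} e =
    trans (Solver.solve R 2 (λ { (a ∷ b ∷ []) → a , (a :+ (:- b)) :+ b }) ≡.refl (a ∷ b ∷ [])) (trans (+-congʳ e) (+-identityˡ b))

  sum-0 : ∀ {a b} → a ≈ 0# → b ≈ 0# → a + b ≈ 0#
  sum-0 a≈0 b≈0 = trans (+-cong a≈0 b≈0) (+-identityˡ 0#)

  neg-0 : ∀ {a} → a ≈ 0# → - a ≈ 0#
  neg-0 a≈0 = trans (-‿cong a≈0) -0#≈0#

-- Series in Q[[y]][[x]][[t]].
module TrivariateSeries (Q : CRing) (dom : Domain Q) where
  module Q = CommutativeRing Q
  module P¹ = PowerSeries Q
  ring₁ : CRing
  ring₁ = P¹.ps-ring
  module P² = PowerSeries ring₁
  ring₂ : CRing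
  ring₂ = P².ps-ring
  module P³ = PowerSeries ring₂
  ring₃ : CRing
  ring₃ = P³.ps-ring
  module R₁ = CommutativeRing ring₁
  module R₂ = CommutativeRing ring₂
  dom₁ : Domain ring₁
  dom₁ = ps-domain dom
  dom₂ : Domain ring₂
  dom₂ = ps-domain dom₁
  dom₃ : Domain ring₃
  dom₃ = ps-domain dom₂
  open CommutativeRing ring₃ hiding (zero; _-_) public
  open RawNotation rawRing using (_-_; _^_; #_) public
  module D₁ = Domain dom₁
  module D₂ = Domain dom₂
  module D = Domain dom₃
  module L₁ = RingLemmas ring₁
  module L₂ = RingLemmas ring₂
  module L = RingLemmas ring₃
  open Solver ring₃ public using (solve)

  y₁ : R₁.Carrier
  y₁ = P¹.X
  x₂ y₂ : R₂.Carrier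
  x₂ = P².X
  y₂ = P².const y₁
  t x y : Carrier
  t = P³.X
  x = P³.const x₂
  y = P³.const y₂

  t-zero : ∀ F → (t * F) 0 R₂.≈ R₂.0#
  t-zero = P³.X-⊗-zero
  t-suc : ∀ F n → (t * F) (suc n) R₂.≈ F n
  t-suc = P³.X-⊗-suc
  const-* : ∀ a F n → (P³.const a * F) n R₂.≈ a R₂.* F n
  const-* = P³.const-⊗
  x-zero : ∀ F n → (x * F) n 0 R₁.≈ R₁.0#
  x-zero F n j = Q.trans (const-* x₂ F n 0 j) (P².X-⊗-zero (F n) j)
  x-suc : ∀ F n i → (x * F) n (suc i) R₁.≈ F n i
  x-suc F n i j = Q.trans (const-* x₂ F n (suc i) j) (P².X-⊗-suc (F n) i j)
  y-at : ∀ F n i → (y * F) n i R₁.≈ y₁ R₁.* F n i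
  y-at F n i j = Q.trans (const-* y₂ F n i j) (P².const-⊗ y₁ (F n) i j)
  y-zero : ∀ F n i → (y * F) n i 0 Q.≈ Q.0#
  y-zero F n i = Q.trans (y-at F n i 0) (P¹.X-⊗-zero (F n i))
  y-suc : ∀ F n i j → (y * F) n i (suc j) Q.≈ F n i j
  y-suc F n i j = Q.trans (y-at F n i (suc j)) (P¹.X-⊗-suc (F n i) j)

  ∂x ∂y at-x₀ at-y₀ : Carrier → Carrier
  ∂x F n i j = F n (suc i) j
  ∂y F n i j = F n i (suc j)
  at-x₀ F n zero    j = F n 0 j
  at-x₀ F n (suc i) j = Q.0#
  at-y₀ F n i zero    = F n i 0
  at-y₀ F n i (suc j) = Q.0#

  split-x : ∀ F → at-x₀ F + x * ∂x F ≈ F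
  split-x F n zero    j = Q.trans (Q.+-congˡ (x-zero (∂x F) n j)) (Q.+-identityʳ _)
  split-x F n (suc i) j = Q.trans (Q.+-congˡ (x-suc (∂x F) n i j)) (Q.+-identityˡ _)

  split-y : ∀ F → at-y₀ F + y * ∂y F ≈ F
  split-y F n i zero    = Q.trans (Q.+-congˡ (y-zero (∂y F) n i)) (Q.+-identityʳ _)
  split-y F n i (suc j) = Q.trans (Q.+-congˡ (y-suc (∂y F) n i j)) (Q.+-identityˡ _)

  apart-X : ∀ {C} (d : Domain C) → Domain.Apart (ps-domain d) (PowerSeries.X C)
  apart-X {C} d = 1 , (λ { zero _ → CommutativeRing.refl C ; (suc _) (s≤s ()) }) , Domain.apart-1 d

  apart-const : ∀ {C} (d : Domain C) {a} → Domain.Apart d a → Domain.Apart (ps-domain d) (PowerSeries.const C a)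
  apart-const d p = 0 , (λ _ ()) , p

  apart-t : D.Apart t
  apart-t = apart-X dom₂
  apart-x : D.Apart x
  apart-x = apart-const dom₂ (apart-X dom₁)
  apart-y : D.Apart y
  apart-y = apart-const dom₂ (apart-const dom₁ (apart-X dom))

  apart-num : ∀ k → Domain.Apart dom (Solver.num Q k) → D.Apart (# k)
  apart-num k h = D.apart-resp (num-const k) (apart-const dom₂ (apart-const dom₁ (apart-const dom h)))
    where
    num-const : ∀ k → P³.const (P².const (P¹.const (Solver.num Q k))) ≈ # k
    num-const zero    zero    zero    zero    = Q.refl
    num-const zero    zero    zero    (suc j) = Q.refl
    num-const zero    zero    (suc i) j       = Q.refl
    num-const zero    (suc n) i       j       = Q.refl
    num-const (suc k) zero    zero    zero    = Q.+-congˡ (num-const k 0 0 0)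
    num-const (suc k) zero    zero    (suc j) = Q.trans (num-const k 0 0 (suc j)) (Q.sym (Q.+-identityˡ _))
    num-const (suc k) zero    (suc i) j       = Q.trans (num-const k 0 (suc i) j) (Q.sym (Q.+-identityˡ _))
    num-const (suc k) (suc n) i       j       = Q.trans (num-const k (suc n) i j) (Q.sym (Q.+-identityˡ _))

  pol-X : ∀ {C} (d : Domain C) → Domain.Pol (ps-domain d) (PowerSeries.X C)
  pol-X {C} d = (λ { zero → S.has-0 ; (suc zero) → S.has-1 ; (suc (suc _)) → S.has-0 }) ,
    2 , λ { (suc (suc n)) _ → CommutativeRing.refl C ; (suc zero) (s≤s ()) }
    where module S = IsSubring (Domain.pol d)

  pol-const : ∀ {C} (d : Domain C) {a} → Domain.Pol d a → Domain.Pol (ps-domain d) (PowerSeries.const C a)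
  pol-const {C} d p = (λ { zero → p ; (suc _) → S.has-0 }) , 1 , λ { (suc n) _ → CommutativeRing.refl C }
    where module S = IsSubring (Domain.pol d)

  pol-t : D.Pol t
  pol-t = pol-X dom₂
  pol-x : D.Pol x
  pol-x = pol-const dom₂ (pol-X dom₁)
  pol-y : D.Pol y
  pol-y = pol-const dom₂ (pol-const dom₁ (pol-X dom))

  apart-1+y : D.Apart (1# + y)
  apart-1+y = D.apart-resp 1+y (apart-const dom₂ (apart-const dom₁ (0 , (λ _ ()) ,
      Domain.apart-resp dom (Q.sym (Q.+-identityʳ Q.1#)) (Domain.apart-1 dom))))
    where
    1+y : P³.const (P².const (R₁.1# R₁.+ y₁)) ≈ 1# + y
    1+y zero    zero    j = Q.refl
    1+y zero    (suc i) j = Q.sym (Q.+-identityˡ _)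
    1+y (suc n) i       j = Q.sym (Q.+-identityˡ _)

  apart-kernel : D.Apart (KernelFormulas.kernel rawRing t x y)
  apart-kernel = 0 , (λ _ ()) , D₂.apart-resp (R₂.sym (R₂.trans
      (R₂.+-congˡ (L₂.neg-0 (t-zero (KernelFormulas.kernelUnit rawRing t x y)))) (R₂.+-identityʳ _)))
    (D₂.apart-* (apart-X dom₁) (apart-const dom₁ (apart-X dom)))

  tail : Carrier → Carrier
  tail F n = F (suc n)

  -- Multiplication by t only shifts coefficients and a is free of t, so divisibility by a passes
  -- from t F to F.
  const-quotient : ∀ a {F H} → t * F ≈ P³.const a * H → F ≈ P³.const a * tail H
  const-quotient a {F} {H} e n = R₂.trans (R₂.sym (t-suc F n))
    (R₂.trans (e (suc n)) (R₂.trans (const-* a H (suc n)) (R₂.sym (const-* a (tail H) n))))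

  x-free y-free : Carrier → Set
  x-free F = ∀ n i → F n (suc i) R₁.≈ R₁.0#
  y-free F = ∀ n i j → F n i (suc j) Q.≈ Q.0#

  private
    module S₁ = SeriesProperties Q
    module S₂ = SeriesProperties ring₁
    module S₃ = SeriesProperties ring₂

  x-free-subring : IsSubring ring₃ x-free
  x-free-subring = S₃.coefficientwise S₂.isConst
  y-free-subring : IsSubring ring₃ y-free
  y-free-subring = S₃.coefficientwise (S₂.coefficientwise S₁.isConst)

  x-free-t : x-free t
  x-free-t zero    i = R₁.refl
  x-free-t (suc zero) i = R₁.refl
  x-free-t (suc (suc n)) i = R₁.refl
  x-free-y : x-free y
  x-free-y zero    i = R₁.refl
  x-free-y (suc n) i = R₁.refl
  y-free-t : y-free t
  y-free-t zero          i       j = Q.refl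
  y-free-t (suc zero)    zero    j = Q.refl
  y-free-t (suc zero)    (suc i) j = Q.refl
  y-free-t (suc (suc n)) i       j = Q.refl
  y-free-x : y-free x
  y-free-x zero zero          j = Q.refl
  y-free-x zero (suc zero)    j = Q.refl
  y-free-x zero (suc (suc i)) j = Q.refl
  y-free-x (suc n) i          j = Q.refl

  x-free-at-x₀ : ∀ F → x-free (at-x₀ F)
  x-free-at-x₀ F n i j = Q.refl

  -- The inverse is lifted through y, x and t in turn from the constant coefficient 1.
  kernelUnit-inverse : ∃ λ v → KernelFormulas.kernelUnit rawRing t x y * v ≈ 1#
  kernelUnit-inverse = S₃.inverse u (S₂.inverse (u 0) (S₁.inverse (u 0 0) Q.1# u₀₀₀) u₀₀) u₀ , S₃.inverse-eq u _ u₀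
    where
    u : Carrier
    u = KernelFormulas.kernelUnit rawRing t x y
    u₀₀₀ : u 0 0 0 Q.* Q.1# Q.≈ Q.1#
    u₀₀₀ = Solver.solve Q 0 (λ { [] → (((:1 :+ :0) :+ :0) :* ((:1 :+ :0) :+ ((:0 :* :0) :* :0))) :* :1 , :1 }) ≡.refl []
    u₀₀ : u 0 0 R₁.* S₁.inverse (u 0 0) Q.1# u₀₀₀ R₁.≈ R₁.1#
    u₀₀ = S₁.inverse-eq (u 0 0) Q.1# u₀₀₀
    u₀ : u 0 R₂.* S₂.inverse (u 0) (S₁.inverse (u 0 0) Q.1# u₀₀₀) u₀₀ R₂.≈ R₂.1#
    u₀ = S₂.inverse-eq (u 0) _ u₀₀

  module F = KernelFormulas rawRing

  private
    K u : Carrier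
    K = F.kernel t x y
    u = F.kernelUnit t x y

  const-homo-* : ∀ a b → P³.const a * P³.const b ≈ P³.const (a R₂.* b)
  const-homo-* a b zero    = R₂.refl
  const-homo-* a b (suc n) = R₂.trans (const-* a (P³.const b) (suc n)) (R₂.zeroʳ a)

  private
    -- Modulo a divisor a of x y the kernel is -t times a unit; so a divides t H and, being free of
    -- t, divides H.
    kernel-quotient : ∀ a c {H V} → x * y ≈ P³.const a * c → K * H ≈ P³.const a * V →
                      ∃ λ H′ → H ≈ P³.const a * H′
    kernel-quotient a c {H} {V} xy e = _ , const-quotient a (begin
      t * H                                    ≈⟨ *-congˡ (*-identityˡ H) ⟨
      t * (1# * H)                             ≈⟨ *-congˡ {t} (*-congʳ {H} (proj₂ kernelUnit-inverse)) ⟨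
      t * (u * v * H)                          ≈⟨ solve 5 (λ { (t ∷ u ∷ v ∷ H ∷ xy ∷ []) →
                                                    t :* ((u :* v) :* H) , v :* ((xy :* H) :+ (:- ((xy :+ (:- (t :* u))) :* H))) }) ≡.refl (t ∷ u ∷ v ∷ H ∷ x * y ∷ []) ⟩
      v * (x * y * H - K * H)                  ≈⟨ *-congˡ {v} (+-cong (*-congʳ {H} xy) (-‿cong e)) ⟩
      v * (P³.const a * c * H - P³.const a * V) ≈⟨ solve 5 (λ { (v ∷ a ∷ c ∷ H ∷ V ∷ []) →
                                                    v :* (((a :* c) :* H) :+ (:- (a :* V))) , a :* (v :* ((c :* H) :+ (:- V))) }) ≡.refl (v ∷ P³.const a ∷ c ∷ H ∷ V ∷ []) ⟩
      P³.const a * (v * (c * H - V))           ∎)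
      where
      open SetoidReasoning setoid
      v = proj₁ kernelUnit-inverse

  -- `kernel-quotient` strips divisors of x y only, so the factor x² y is removed in two rounds, x y
  -- and then x.
  kernel-divides : ∀ {H W} → K * H ≈ x * y * (x * W) → ∃ λ H′ → K * H′ ≈ W
  kernel-divides {H} {W} e = H₂ , D.cancel apart-x (begin
      x * (K * H₂)       ≈⟨ solve 3 (λ { (x ∷ K ∷ H ∷ []) → x :* (K :* H) , K :* (x :* H) }) ≡.refl (x ∷ K ∷ H₂ ∷ []) ⟩
      K * (x * H₂)       ≈⟨ *-congˡ {K} H₁-eq ⟨
      K * H₁             ≈⟨ KH₁ ⟩
      x * W              ∎)
    where
    open SetoidReasoning setoid
    xy : P³.const (x₂ R₂.* y₂) ≈ x * y
    xy = sym (const-homo-* x₂ y₂)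
    step₁ : ∃ λ H′ → H ≈ P³.const (x₂ R₂.* y₂) * H′
    step₁ = kernel-quotient (x₂ R₂.* y₂) 1# (trans (sym xy) (sym (*-identityʳ _))) (trans e (*-congʳ {x * W} (sym xy)))
    H₁ : Carrier
    H₁ = proj₁ step₁
    KH₁ : K * H₁ ≈ x * W
    KH₁ = D.cancel (D.apart-* apart-x apart-y) (begin
      x * y * (K * H₁)   ≈⟨ solve 3 (λ { (x ∷ K ∷ H ∷ []) → x :* (K :* H) , K :* (x :* H) }) ≡.refl (x * y ∷ K ∷ H₁ ∷ []) ⟩
      K * (x * y * H₁)   ≈⟨ *-congˡ {K} (*-congʳ {H₁} xy) ⟨
      K * (P³.const (x₂ R₂.* y₂) * H₁) ≈⟨ *-congˡ {K} (proj₂ step₁) ⟨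
      K * H              ≈⟨ e ⟩
      x * y * (x * W)    ∎)
    step₂ : ∃ λ H′ → H₁ ≈ x * H′
    step₂ = kernel-quotient x₂ y refl KH₁
    H₂ : Carrier
    H₂ = proj₁ step₂
    H₁-eq : H₁ ≈ x * H₂
    H₁-eq = proj₂ step₂

  private
    -- At x^(i+1) the equation reads y H i = (1 + y) f (i+1), where f (i+1) is constant in y.
    -- Setting y = 0 kills f (i+1), and then H i vanishes as well.
    invariant-step : ∀ {H f h : R₂.Carrier} → (∀ i j → f i (suc j) Q.≈ Q.0#) → (∀ i → h (suc i) R₁.≈ R₁.0#) →
      x₂ R₂.* (y₂ R₂.* H) R₂.≈ (f R₂.+ y₂ R₂.* f) R₂.- h → H R₂.≈ R₂.0# × (∀ i → f (suc i) R₁.≈ R₁.0#)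
    invariant-step {H} {f} {h} yf xh e = H≈0 , f≈0
      where
      at : ∀ i → y₁ R₁.* H i R₁.≈ f (suc i) R₁.+ y₁ R₁.* f (suc i)
      at i = R₁.trans (R₁.sym (R₁.trans (P².X-⊗-suc (y₂ R₂.* H) i) (P².const-⊗ y₁ H i)))
        (R₁.trans (e (suc i)) (R₁.trans (R₁.+-congˡ (L₁.neg-0 (xh i)))
          (R₁.trans (R₁.+-identityʳ _) (R₁.+-congˡ (P².const-⊗ y₁ f (suc i))))))
      f≈0 : ∀ i → f (suc i) R₁.≈ R₁.0#
      f≈0 i (suc j) = yf (suc i) j
      f≈0 i zero    = Q.sym (Q.trans (Q.sym (P¹.X-⊗-zero (H i))) (Q.trans (at i 0)
        (Q.trans (Q.+-congˡ (P¹.X-⊗-zero (f (suc i)))) (Q.+-identityʳ _))))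
      H≈0 : H R₂.≈ R₂.0#
      H≈0 i = D₁.cancel-0 (apart-X dom) (R₁.trans (at i)
        (L₁.sum-0 (f≈0 i) (R₁.trans (R₁.*-congˡ {y₁} (f≈0 i)) (R₁.zeroʳ y₁))))

  -- Modulo the kernel, a series in x and t can only agree with a
  -- series in y and t if both are free of x and y, up to the factor 1 + y.
  invariant : ∀ {H f h} → y-free f → x-free h → K * H ≈ (f + y * f) - h → x-free f × f + y * f ≈ h
  invariant {H} {f} {h} yf xh e = (λ n → proj₂ (all n)) , L.equal-from-0 (trans (sym e)
      (trans (*-congˡ {K} (λ n → proj₁ (all n))) (zeroʳ K)))
    where
    Claim : ℕ → Set
    Claim n = H n R₂.≈ R₂.0# × (∀ i → f n (suc i) R₁.≈ R₁.0#)
    expand : K * H ≈ x * (y * H) - t * (u * H)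
    expand = solve 5 (λ { (x ∷ y ∷ t ∷ u ∷ H ∷ []) → ((x :* y) :+ (:- (t :* u))) :* H , (x :* (y :* H)) :+ (:- (t :* (u :* H))) })
      ≡.refl (x ∷ y ∷ t ∷ u ∷ H ∷ [])
    -- The coefficients of H below n vanish by induction, so at order n only the part x y of the
    -- kernel acts.
    tuH≈0 : ∀ n → (∀ {m} → m < n → Claim m) → (t * (u * H)) n R₂.≈ R₂.0#
    tuH≈0 zero    rec = t-zero (u * H)
    tuH≈0 (suc n) rec = R₂.trans (t-suc (u * H) n)
      (R₂.trans (S₃.⊗-local {u} {u} {H} {0#} n (λ _ _ → R₂.refl) (λ k k≤n → proj₁ (rec k≤n))) (zeroʳ u n))
    all : ∀ n → Claim n
    all = <-rec Claim λ n rec → invariant-step (yf n) (xh n) (R₂.trans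
      (R₂.sym (R₂.trans (R₂.+-cong (R₂.trans (const-* x₂ (y * H) n) (R₂.*-congˡ {x₂} (const-* y₂ H n))) (L₂.neg-0 (tuH≈0 n rec))) (R₂.+-identityʳ _)))
      (R₂.trans (R₂.trans (R₂.sym (expand n)) (e n)) (R₂.+-congʳ (R₂.+-congˡ {f n} (const-* y₂ f n)))))

module GesselEquations (Q : CRing) (dom : Domain Q) where
  open TrivariateSeries Q dom
  open KernelIdentities ring₃ using (difference-kernel; difference-sides)
  open SetoidReasoning setoid

  module _ (G : Carrier)
    (recurrence : G ≈ 1# + t * (∂x G + (∂x (∂y G) + (x * (y * G) + x * G)))) where

    a b a₀ a₁ a₂ b₁ : Carrier
    a  = at-y₀ G
    b  = at-x₀ G
    a₀ = at-y₀ b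
    a₁ = at-x₀ (∂x a)
    a₂ = ∂x (∂x a)
    b₁ = ∂y b

    a-split : F.section-x x a₀ a₁ a₂ ≈ a
    a-split = trans (+-cong a₀-at (*-congˡ {x} (split-x (∂x a)))) (split-x a)
      where
      a₀-at : a₀ ≈ at-x₀ a
      a₀-at n zero    zero    = Q.refl
      a₀-at n zero    (suc j) = Q.refl
      a₀-at n (suc i) zero    = Q.refl
      a₀-at n (suc i) (suc j) = Q.refl

    b-split : a₀ + y * b₁ ≈ b
    b-split = split-y b

    -- The recurrence times x y. Splitting `G`, `∂y G`, `b` and `a` at x = 0 or y = 0 turns x `∂x`
    -- and y `∂y` into differences; each splitting contributes one correction term.
    kernel-equation : F.kernelRhs t x y a₀ (a₀ + y * b₁) (t * (x * (a₁ + x * a₂))) ≈ F.kernel t x y * G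
    kernel-equation = begin
      F.kernelRhs t x y a₀ (a₀ + y * b₁) (t * (x * (a₁ + x * a₂)))
        ≈⟨ solve 12 (λ { (t ∷ x ∷ y ∷ G ∷ Gx ∷ Gxy ∷ Gy ∷ a₀ ∷ b₁ ∷ a′ ∷ a ∷ b ∷ []) →
             E.kernelRhs t x y a₀ (a₀ :+ (y :* b₁)) (t :* (x :* a′)) ,
             (((((E.kernel t x y :* G
               :+ ((:- (x :* y)) :* (G :- (:1 :+ (t :* (Gx :+ (Gxy :+ ((x :* (y :* G)) :+ (x :* G)))))))))
               :+ ((:- (t :* y)) :* ((b :+ (x :* Gx)) :- G)))
               :+ ((:- t) :* ((a :+ (y :* Gy)) :- G)))
               :+ ((:- (t :* y)) :* ((b₁ :+ (x :* Gxy)) :- Gy)))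
               :+ ((:- (t :* y)) :* ((a₀ :+ (y :* b₁)) :- b)))
               :+ ((:- t) :* ((a₀ :+ (x :* a′)) :- a)) }) ≡.refl
             (t ∷ x ∷ y ∷ G ∷ ∂x G ∷ ∂x (∂y G) ∷ ∂y G ∷ a₀ ∷ b₁ ∷ a₁ + x * a₂ ∷ a ∷ b ∷ []) ⟩
      _ ≈⟨ L.drop a-split ⟩
      _ ≈⟨ L.drop b-split ⟩
      _ ≈⟨ L.drop {l = b₁ + x * ∂x (∂y G)} (trans (+-congʳ b₁-at) (split-x (∂y G))) ⟩
      _ ≈⟨ L.drop (split-y G) ⟩
      _ ≈⟨ L.drop (split-x G) ⟩
      _ ≈⟨ L.drop recurrence ⟩
      F.kernel t x y * G ∎
      where
      module E {n} = KernelFormulas (exprRing n)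
      b₁-at : b₁ ≈ at-x₀ (∂y G)
      b₁-at n zero    j = Q.refl
      b₁-at n (suc i) j = Q.refl

    y-free-a₀ : y-free a₀
    y-free-a₀ n i j = Q.refl
    y-free-a₁ : y-free a₁
    y-free-a₁ n zero    j = Q.refl
    y-free-a₁ n (suc i) j = Q.refl
    y-free-a₂ : y-free a₂
    y-free-a₂ n i j = Q.refl
    x-free-a₀ : x-free a₀
    x-free-a₀ n i zero    = Q.refl
    x-free-a₀ n i (suc j) = Q.refl
    x-free-a₁ : x-free a₁
    x-free-a₁ n i j = Q.refl
    x-free-b₁ : x-free b₁
    x-free-b₁ n i j = Q.refl

    ε : Carrier
    ε = F.catalyticSide t x a₀ a₁ a₂

    private
      y-free-ε : y-free ε
      y-free-ε = has-⟦⟧ (E.catalyticSide (var zero) (var (suc zero)) (var (suc (suc zero))) (var (suc (suc (suc zero)))) (var (suc (suc (suc (suc zero))))))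
        (t ∷ x ∷ a₀ ∷ a₁ ∷ a₂ ∷ [])
        λ { zero → y-free-t ; (suc zero) → y-free-x ; (suc (suc zero)) → y-free-a₀
          ; (suc (suc (suc zero))) → y-free-a₁ ; (suc (suc (suc (suc zero)))) → y-free-a₂ }
        where
        open IsSubring y-free-subring
        module E = KernelFormulas (exprRing 5)

      x-free-h : x-free (F.invariantLSide t y a₀ a₁ b₁)
      x-free-h = has-⟦⟧ (E.invariantLSide (var zero) (var (suc zero)) (var (suc (suc zero))) (var (suc (suc (suc zero)))) (var (suc (suc (suc (suc zero))))))
        (t ∷ y ∷ a₀ ∷ a₁ ∷ b₁ ∷ [])
        λ { zero → x-free-t ; (suc zero) → x-free-y ; (suc (suc zero)) → x-free-a₀
          ; (suc (suc (suc zero))) → x-free-a₁ ; (suc (suc (suc (suc zero)))) → x-free-b₁ }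
        where
        open IsSubring x-free-subring
        module E = KernelFormulas (exprRing 5)

      -- `kernelRhs` is K G, so K divides `difference`; the common factor x² y of its two sides is
      -- then stripped.
      quotient : ∃ λ H → F.kernel t x y * H ≈ (ε + y * ε) - F.invariantLSide t y a₀ a₁ b₁
      quotient = kernel-divides {H = cof - G * sl} (begin
        K * (cof - G * sl)
          ≈⟨ solve 4 (λ { (K ∷ c ∷ G ∷ s ∷ []) → K :* (c :+ (:- (G :* s))) , (K :* c) :+ (:- ((K :* G) :* s)) }) ≡.refl (K ∷ cof ∷ G ∷ sl ∷ []) ⟩
        K * cof - K * G * sl
          ≈⟨ +-congˡ {K * cof} (-‿cong (*-congʳ {sl} kernel-equation)) ⟨
        K * cof - F.kernelRhs t x y a₀ (a₀ + y * b₁) X * sl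
          ≈⟨ difference-kernel t x y a₀ a₁ (a₀ + y * b₁) X ⟨
        F.difference t x y a₀ a₁ (a₀ + y * b₁) X
          ≈⟨ difference-sides t x y a₀ a₁ a₂ b₁ ⟩
        x * y * (x * ((1# + y) * ε - h))
          ≈⟨ *-congˡ {x * y} (*-congˡ {x} (+-congʳ {x = - h} (trans (distribʳ ε 1# y) (+-congʳ {x = y * ε} (*-identityˡ ε))))) ⟩
        x * y * (x * ((ε + y * ε) - h)) ∎)
        where
        K = F.kernel t x y
        X = t * (x * (a₁ + x * a₂))
        cof = F.cofactor t x y a₀ a₁ (a₀ + y * b₁)
        sl = F.slope t x y a₀ a₁ (a₀ + y * b₁) X
        h = F.invariantLSide t y a₀ a₁ b₁

    x-free-ε : x-free ε
    x-free-ε = proj₁ (invariant y-free-ε x-free-h (proj₂ quotient))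

    y-equation : ε + y * ε ≈ F.invariantLSide t y a₀ a₁ b₁
    y-equation = proj₂ (invariant y-free-ε x-free-h (proj₂ quotient))

-- The equation in one catalytic variable

-- catalyticSide = 1 + t (x (a₀ + x (a₁ + x a₂) - a₂ - 1) - a₁ + t remainder).
module CatalyticExpansion (R : RawRing 0ℓ 0ℓ) where
  open RawNotation R
  open KernelFormulas R

  remainder : (t x a₀ a₁ a₂ : Carrier) → Carrier
  remainder t x a₀ a₁ a₂ = β + α * s + t * (γ + β * s) + t ^ 2 * (γ * s)
    where
    s = x * section-x x a₀ a₁ a₂
    α = - (x + (a₁ + x * a₂))
    β = # 2 * a₂
    γ = x * (a₁ + x * a₂) ^ 2

module CatalyticUniqueness (Q : CRing) (dom : Domain Q) where
  open TrivariateSeries Q dom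
  open SeriesProperties ring₂ using (⟦⟧-agree)
  private
    module C = CatalyticExpansion rawRing
    module E {n} = CatalyticExpansion (exprRing n)
    module EF {n} = KernelFormulas (exprRing n)

  -- `a₂-bound` makes every coefficient in t a polynomial in x. It excludes perturbations such as
  -- the expansion of 1/(1 - x²) for a₂, which satisfy the linearised equation together with a
  -- constant change of a₀.
  record CatalyticSolution (a₀ a₁ a₂ ε : Carrier) : Set where
    field
      x-free-a₀ : x-free a₀
      x-free-a₁ : x-free a₁
      a₂-bound  : ∀ n i → n < i → a₂ n i R₁.≈ R₁.0#
      x-free-ε  : x-free ε
      equation  : F.catalyticSide t x a₀ a₁ a₂ ≈ ε

  module _ {a₀ a₁ a₂ ε a₀′ a₁′ a₂′ ε′}
    (S : CatalyticSolution a₀ a₁ a₂ ε) (S′ : CatalyticSolution a₀′ a₁′ a₂′ ε′) where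
    private
      module S = CatalyticSolution S
      module S′ = CatalyticSolution S′

      d₀ d₁ d₂ δε δΨ : Carrier
      d₀ = a₀ - a₀′
      d₁ = a₁ - a₁′
      d₂ = a₂ - a₂′
      δε = ε - ε′
      δΨ = C.remainder t x a₀ a₁ a₂ - C.remainder t x a₀′ a₁′ a₂′

      x-free-- : ∀ F H → x-free F → x-free H → x-free (F - H)
      x-free-- F H xF xH = IsSubring.has-+ x-free-subring {F} { - H} xF (IsSubring.has-- x-free-subring {H} xH)

      x-free-d₀ : x-free d₀
      x-free-d₀ = x-free-- a₀ a₀′ S.x-free-a₀ S′.x-free-a₀
      x-free-d₁ : x-free d₁
      x-free-d₁ = x-free-- a₁ a₁′ S.x-free-a₁ S′.x-free-a₁
      x-free-δε : x-free δε
      x-free-δε = x-free-- ε ε′ S.x-free-ε S′.x-free-ε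

      difference : t * ((x * (d₀ + x * (d₁ + x * d₂) - d₂) - d₁) + t * δΨ) ≈ δε
      difference = trans (solve 10 (λ { (t ∷ x ∷ a ∷ b ∷ c ∷ a′ ∷ b′ ∷ c′ ∷ ε ∷ ε′ ∷ []) →
          t :* ((x :* ((a :- a′) :+ x :* ((b :- b′) :+ x :* (c :- c′)) :- (c :- c′)) :- (b :- b′))
                :+ t :* (E.remainder t x a b c :- E.remainder t x a′ b′ c′)) ,
          EF.catalyticSide t x a b c :- EF.catalyticSide t x a′ b′ c′ })
          ≡.refl (t ∷ x ∷ a₀ ∷ a₁ ∷ a₂ ∷ a₀′ ∷ a₁′ ∷ a₂′ ∷ ε ∷ ε′ ∷ []))
        (+-cong S.equation (-‿cong S′.equation))

      Claim : ℕ → Set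
      Claim n = d₀ n R₂.≈ R₂.0# × d₁ n R₂.≈ R₂.0# × d₂ n R₂.≈ R₂.0#

      remainder-below : ∀ n → (∀ {m} → m < n → Claim m) → (t * δΨ) n R₂.≈ R₂.0#
      remainder-below zero    rec = t-zero δΨ
      remainder-below (suc n) rec = R₂.trans (t-suc δΨ n) (L₂.difference-0
          (⟦⟧-agree (E.remainder (var zero) (var (suc zero)) (var (suc (suc zero))) (var (suc (suc (suc zero)))) (var (suc (suc (suc (suc zero))))))
            {t ∷ x ∷ a₀ ∷ a₁ ∷ a₂ ∷ []} {t ∷ x ∷ a₀′ ∷ a₁′ ∷ a₂′ ∷ []}
            (λ { zero → λ _ _ → R₂.refl ; (suc zero) → λ _ _ → R₂.refl
               ; (suc (suc zero)) → λ k k≤n → L₂.equal-from-0 (proj₁ (rec k≤n))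
               ; (suc (suc (suc zero))) → λ k k≤n → L₂.equal-from-0 (proj₁ (proj₂ (rec k≤n)))
               ; (suc (suc (suc (suc zero)))) → λ k k≤n → L₂.equal-from-0 (proj₂ (proj₂ (rec k≤n))) })
            n (ℕₚ.n<1+n n)))

      -- At order n the two equations differ by x r - d₁, which must be free of x; hence r = 0, that
      -- is, d₂ = d₀ + x d₁ + x² d₂. The coefficients of d₂ thus begin with those of d₀ and d₁ and
      -- repeat with period two, while those beyond index n are 0.
      step : ∀ n → (∀ {m} → m < n → Claim m) → Claim n
      step n rec = (λ { zero → R₁.trans d₀₀ (d₂≈0 0) ; (suc i) → x-free-d₀ n i })
                 , (λ { zero → R₁.trans d₁₀ (d₂≈0 1) ; (suc i) → x-free-d₁ n i })
                 , d₂≈0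
        where
        r : Carrier
        r = d₀ + x * (d₁ + x * d₂) - d₂
        linear : (x * r - d₁) n R₂.≈ δε (suc n)
        linear = R₂.trans (R₂.sym (R₂.trans (R₂.+-congˡ (remainder-below n rec)) (R₂.+-identityʳ _)))
          (R₂.trans (R₂.sym (t-suc ((x * r - d₁) + t * δΨ) n)) (difference (suc n)))
        r≈0 : ∀ i → r n i R₁.≈ R₁.0#
        r≈0 i = R₁.trans (R₁.sym (R₁.trans (R₁.+-cong (x-suc r n i) (L₁.neg-0 (x-free-d₁ n i))) (R₁.+-identityʳ _)))
          (R₁.trans (linear (suc i)) (x-free-δε (suc n) i))
        d₀₀ : d₀ n 0 R₁.≈ d₂ n 0
        d₀₀ = L₁.equal-from-0 (R₁.trans (R₁.+-congʳ (R₁.sym (R₁.trans (R₁.+-congˡ (x-zero _ n)) (R₁.+-identityʳ _)))) (r≈0 0))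
        shifted : ∀ i → (d₁ + x * d₂) n i R₁.≈ d₂ n (suc i)
        shifted i = L₁.equal-from-0 (R₁.trans (R₁.+-congʳ (R₁.sym (R₁.trans
          (R₁.+-cong (x-free-d₀ n i) (x-suc (d₁ + x * d₂) n i)) (R₁.+-identityˡ _)))) (r≈0 (suc i)))
        d₁₀ : d₁ n 0 R₁.≈ d₂ n 1
        d₁₀ = R₁.trans (R₁.sym (R₁.trans (R₁.+-congˡ (x-zero d₂ n)) (R₁.+-identityʳ _))) (shifted 0)
        two-periodic : ∀ k → d₂ n k R₁.≈ d₂ n (suc (suc k))
        two-periodic k = R₁.trans (R₁.sym (R₁.trans
          (R₁.+-cong (x-free-d₁ n k) (x-suc d₂ n k)) (R₁.+-identityˡ _))) (shifted (suc k))
        vanish : ∀ m k → n < m ℕ.+ k → d₂ n k R₁.≈ R₁.0#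
        vanish zero    k n<k = L₁.sum-0 (S.a₂-bound n k n<k) (L₁.neg-0 (S′.a₂-bound n k n<k))
        vanish (suc m) k n<k = R₁.trans (two-periodic k) (vanish m (suc (suc k))
          (ℕₚ.<-≤-trans n<k (ℕₚ.≤-trans (ℕₚ.≤-reflexive (≡.sym (ℕₚ.+-suc m k))) (ℕₚ.+-monoʳ-≤ m (ℕₚ.n≤1+n (suc k))))))
        d₂≈0 : ∀ k → d₂ n k R₁.≈ R₁.0#
        d₂≈0 k = vanish (suc n) k (ℕ.s≤s (ℕₚ.m≤m+n n k))

      claim : ∀ n → Claim n
      claim = <-rec Claim step

    unique-a₀ : a₀ ≈ a₀′
    unique-a₀ = L.equal-from-0 (λ n → proj₁ (claim n))
    unique-a₁ : a₁ ≈ a₁′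
    unique-a₁ = L.equal-from-0 (λ n → proj₁ (proj₂ (claim n)))
    unique-a₂ : a₂ ≈ a₂′
    unique-a₂ = L.equal-from-0 (λ n → proj₂ (proj₂ (claim n)))

-- With s = t² and w = t x, the curve is parametrised by ζ (for t) and r (for x):
--   s Z⁶ = p q³,  w Z³ D g = q³ v,  1 + w G(x,0) = g / D²,
-- and σ = s a₀, τ = t³ a₁, ε are the functions ν-σ / Z³, ν-τ / Z⁶, c⁴ / (Z³ q³) of ζ alone.
module Parametrisation (R : RawRing 0ℓ 0ℓ) where
  open RawNotation R

  Z q p c h ν-σ ν-τ : Carrier → Carrier
  Z ζ = # 1 + # 2 * ζ
  q ζ = # 1 + ζ + ζ ^ 2
  p ζ = ζ * (# 1 + ζ)
  c ζ = # 1 + # 2 * p ζ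
  ν-σ ζ = ζ * (# 1 + # 2 * ζ ^ 3)
  ν-τ ζ = ζ ^ 2 * (# 1 + ζ - ζ ^ 2 + ζ ^ 3 + # 5 * ζ ^ 4 + # 4 * ζ ^ 5 + ζ ^ 6)
  -- (1 + ζ) q³ = 1 + ζ h
  h ζ = # 4 + # 9 * ζ + # 13 * ζ ^ 2 + # 13 * ζ ^ 3 + # 9 * ζ ^ 4 + # 4 * ζ ^ 5 + ζ ^ 6

  D g v D₁ M : Carrier → Carrier → Carrier
  D ζ r = (# 1 + p ζ * r) * (# 1 - ζ ^ 3 * r)
  g ζ r = # 1 + c ζ * r
  v ζ r = (# 1 + ζ) * r * (# 1 + ζ ^ 2 * r)
  -- D = 1 + r D₁ and g = D² + r M
  D₁ ζ r = p ζ - ζ ^ 3 - p ζ * ζ ^ 3 * r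
  M ζ r = c ζ - # 2 * D₁ ζ r - r * D₁ ζ r ^ 2

  -- η = t η-step, where ζ = t η
  η-step : (η t : Carrier) → Carrier
  η-step η t = Z (t * η) ^ 6 - η ^ 2 * h (t * η)

  -- r̃ = 1 + ζ step₁ + w step₂, where r = w r̃
  step₁ step₂ : (r̃ ζ w : Carrier) → Carrier
  step₁ r̃ ζ w = # 6 + # 12 * ζ + # 8 * ζ ^ 2 - h ζ * r̃
  step₂ r̃ ζ w =
    Z ζ ^ 3 * r̃ * ((p ζ - ζ ^ 3 + c ζ) + (p ζ * c ζ - p ζ * ζ ^ 3 - ζ ^ 3 * c ζ) * (w * r̃)
                    - p ζ * ζ ^ 3 * c ζ * (w * r̃) ^ 2)
    - (# 1 + ζ * h ζ) * ζ ^ 2 * r̃ ^ 2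

  -- This is w³ (`catalyticSide` - ε) for w = t x, s = t², m = 1 + w G(x,0), σ = s a₀ and τ = t³ a₁;
  -- then b = w t² (G(x,0) - a₀).
  curve : (w s m σ τ ε : Carrier) → Carrier
  curve w s m σ τ ε =
    m * (w ^ 3 - w ^ 4 + # 2 * s ^ 2 * (m - # 1) - # 2 * s * σ * w - # 2 * τ * w ^ 2 + b ^ 2 - w * b) - w ^ 3 * ε
    where b = s * (m - # 1) - σ * w

  -- curve with denominators cleared: w = w′ / (z D g), m = m′ / D², s = s′ / z², σ = σ′ / z, τ = τ′ / z², ε = ε′ / (z q).
  cleared : (z D g q w′ m′ s′ σ′ τ′ ε′ : Carrier) → Carrier
  cleared z D g q w′ m′ s′ σ′ τ′ ε′ =
    m′ * q * (w′ ^ 3 * z * D * g - w′ ^ 4 + # 2 * s′ ^ 2 * (m′ - D ^ 2) * D ^ 2 * g ^ 4 - # 2 * s′ * σ′ * w′ * D ^ 3 * g ^ 3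
              - # 2 * τ′ * w′ ^ 2 * D ^ 2 * g ^ 2 + b ^ 2 * g ^ 2 - w′ * b * z * D * g ^ 2)
    - w′ ^ 3 * ε′ * D ^ 3 * g
    where b = s′ * (m′ - D ^ 2) * g - σ′ * w′ * D

  -- What remains of `cleared` on the parametrisation after its common factor. The arguments z and q
  -- will be the cubes of `Z` and `q`.
  reduced : (z D g q v p σ′ τ′ ε′ : Carrier) → Carrier
  reduced z D g q v p σ′ τ′ ε′ =
    q * v ^ 3 * z * D * g - q ^ 2 * v ^ 4 + # 2 * p ^ 2 * (g - D ^ 2) * D ^ 2 * g ^ 4 - # 2 * p * σ′ * v * D ^ 3 * g ^ 3
    - # 2 * τ′ * v ^ 2 * D ^ 2 * g ^ 2 + b ^ 2 * g ^ 2 - v * b * z * D * g ^ 2 - v ^ 3 * ε′ * D ^ 3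
    where b = p * (g - D ^ 2) * g - σ′ * v * D

  -- curve divided by w, for m = 1 + w A.
  wForm : (t x a₀ a₁ a₂ σ τ ε : Carrier) → Carrier
  wForm t x a₀ a₁ a₂ σ τ ε =
    (# 1 + w * A) * (w ^ 2 - w ^ 3 + # 2 * t ^ 2 * b - # 2 * τ * w + w * b ^ 2 - w * b) - w ^ 2 * ε
    where
    A = a₀ + x * (a₁ + x * a₂)
    w = t * x
    b = t ^ 2 * A - σ

  -- The coefficient of x⁰ in `wForm` is 2 t² (t² a₀ - σ) and, once σ = t² a₀, that of x¹ is 2 t (t³
  -- a₁ - τ). So a series solution of the curve forces σ and τ to be the initial coefficients they
  -- stand for; these are the remaining terms.
  rest₁ rest₂ : (t x a₀ a₁ a₂ σ τ ε : Carrier) → Carrier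
  rest₁ t x a₀ a₁ a₂ σ τ ε =
    # 2 * t ^ 4 * (a₁ + x * a₂) + # 2 * t ^ 3 * A * b
    + (# 1 + t * x * A) * (t ^ 2 * x - t ^ 3 * x ^ 2 - # 2 * τ * t + t * b ^ 2 - t * b) - t ^ 2 * x * ε
    where
    A = a₀ + x * (a₁ + x * a₂)
    b = t ^ 2 * A - σ
  rest₂ t x a₀ a₁ a₂ σ τ ε =
    (# 1 + t * x * A) * (t ^ 2 - t ^ 3 * x + # 2 * t ^ 4 * a₂ + t ^ 5 * x * A′ ^ 2 - t ^ 3 * A′)
    + t * A * (# 2 * t ^ 4 * a₁ - # 2 * t * τ) - t ^ 2 * ε
    where
    A′ = a₁ + x * a₂
    A = a₀ + x * A′

module ParametrisationIdentities (R : CRing) where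
  open CommutativeRing R hiding (zero; _-_)
  open RawNotation rawRing using (_-_; _^_; #_)
  open Solver R
  module Param = Parametrisation rawRing
  private
    module E {n} = Parametrisation (exprRing n)
    module N {n} = RawNotation (exprRing n)
    module K {n} = KernelFormulas (exprRing n)

  η-identity : ∀ t η → t ^ 2 * Param.Z (t * η) ^ 6 ≈
    Param.p (t * η) * Param.q (t * η) ^ 3 + - t * (η - t * Param.η-step η t)
  η-identity t η = solve 2 (λ { (t ∷ η ∷ []) → t N.^ 2 :* E.Z (t :* η) N.^ 6 ,
    E.p (t :* η) :* E.q (t :* η) N.^ 3 :+ (:- t) :* (η :- t :* E.η-step η t) }) ≡.refl (t ∷ η ∷ [])

  r̃-identity : ∀ r̃ ζ w → let r = w * r̃ in
    Param.Z ζ ^ 3 * Param.D ζ r * Param.g ζ r * w ≈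
    Param.q ζ ^ 3 * Param.v ζ r + - w * (r̃ - (1# + ζ * Param.step₁ r̃ ζ w + w * Param.step₂ r̃ ζ w))
  r̃-identity r̃ ζ w = solve 3 (λ { (r̃ ∷ ζ ∷ w ∷ []) →
    E.Z ζ N.^ 3 :* E.D ζ (w :* r̃) :* E.g ζ (w :* r̃) :* w ,
    E.q ζ N.^ 3 :* E.v ζ (w :* r̃) :+ (:- w) :* (r̃ :- (:1 :+ ζ :* E.step₁ r̃ ζ w :+ w :* E.step₂ r̃ ζ w)) })
    ≡.refl (r̃ ∷ ζ ∷ w ∷ [])

  D-identity : ∀ ζ r → Param.D ζ r ≈ 1# + r * Param.D₁ ζ r
  D-identity ζ r = solve 2 (λ { (ζ ∷ r ∷ []) → E.D ζ r , :1 :+ r :* E.D₁ ζ r }) ≡.refl (ζ ∷ r ∷ [])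

  m-identity : ∀ ζ r r̃ w i → let D = Param.D ζ r; M = Param.M ζ r in
    D ^ 2 * (1# + w * (r̃ * M * i ^ 2)) ≈
    (Param.g ζ r + M * D ^ 2 * i ^ 2 * (w * r̃ - r)) + r * M * (D * i + 1#) * (D * i - 1#)
  m-identity ζ r r̃ w i = solve 5 (λ { (ζ ∷ r ∷ r̃ ∷ w ∷ i ∷ []) →
    E.D ζ r N.^ 2 :* (:1 :+ w :* (r̃ :* E.M ζ r :* i N.^ 2)) ,
    (E.g ζ r :+ E.M ζ r :* E.D ζ r N.^ 2 :* i N.^ 2 :* (w :* r̃ :- r)) :+ r :* E.M ζ r :* (E.D ζ r :* i :+ :1) :* (E.D ζ r :* i :- :1) })
    ≡.refl (ζ ∷ r ∷ r̃ ∷ w ∷ i ∷ [])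

  clear : ∀ z D g q w s m σ τ ε →
    z ^ 4 * D ^ 6 * g ^ 4 * q * Param.curve w s m σ τ ε ≈
    Param.cleared z D g q (z * D * g * w) (D ^ 2 * m) (z ^ 2 * s) (z * σ) (z ^ 2 * τ) (z * q * ε)
  clear z D g q w s m σ τ ε = solve 10 (λ { (z ∷ D ∷ g ∷ q ∷ w ∷ s ∷ m ∷ σ ∷ τ ∷ ε ∷ []) →
    z N.^ 4 :* D N.^ 6 :* g N.^ 4 :* q :* E.curve w s m σ τ ε ,
    E.cleared z D g q (z :* D :* g :* w) (D N.^ 2 :* m) (z N.^ 2 :* s) (z :* σ) (z N.^ 2 :* τ) (z :* q :* ε) })
    ≡.refl (z ∷ D ∷ g ∷ q ∷ w ∷ s ∷ m ∷ σ ∷ τ ∷ ε ∷ [])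

  reduce : ∀ z D g q v p σ′ τ′ ε′ →
    Param.cleared z D g q (q * v) g (p * q) σ′ τ′ ε′ ≈ g * q ^ 3 * Param.reduced z D g q v p σ′ τ′ ε′
  reduce z D g q v p σ′ τ′ ε′ = solve 9 (λ { (z ∷ D ∷ g ∷ q ∷ v ∷ p ∷ σ ∷ τ ∷ ε ∷ []) →
    E.cleared z D g q (q :* v) g (p :* q) σ τ ε , g :* q N.^ 3 :* E.reduced z D g q v p σ τ ε })
    ≡.refl (z ∷ D ∷ g ∷ q ∷ v ∷ p ∷ σ′ ∷ τ′ ∷ ε′ ∷ [])

  reduced-0 : ∀ ζ r →
    Param.reduced (Param.Z ζ ^ 3) (Param.D ζ r) (Param.g ζ r) (Param.q ζ ^ 3) (Param.v ζ r) (Param.p ζ)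
      (Param.ν-σ ζ) (Param.ν-τ ζ) (Param.c ζ ^ 4) ≈ 0#
  reduced-0 ζ r = solve 2 (λ { (ζ ∷ r ∷ []) →
    E.reduced (E.Z ζ N.^ 3) (E.D ζ r) (E.g ζ r) (E.q ζ N.^ 3) (E.v ζ r) (E.p ζ) (E.ν-σ ζ) (E.ν-τ ζ) (E.c ζ N.^ 4) , :0 })
    ≡.refl (ζ ∷ r ∷ [])

  curve-wForm : ∀ t x a₀ a₁ a₂ σ τ ε →
    Param.curve (t * x) (t ^ 2) (1# + t * x * (a₀ + x * (a₁ + x * a₂))) σ τ ε ≈ t * x * Param.wForm t x a₀ a₁ a₂ σ τ ε
  curve-wForm t x a₀ a₁ a₂ σ τ ε = solve 8 (λ { (t ∷ x ∷ a₀ ∷ a₁ ∷ a₂ ∷ σ ∷ τ ∷ ε ∷ []) →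
    E.curve (t :* x) (t N.^ 2) (:1 :+ t :* x :* (a₀ :+ x :* (a₁ :+ x :* a₂))) σ τ ε , t :* x :* E.wForm t x a₀ a₁ a₂ σ τ ε })
    ≡.refl (t ∷ x ∷ a₀ ∷ a₁ ∷ a₂ ∷ σ ∷ τ ∷ ε ∷ [])

  wForm-x⁰ : ∀ t x a₀ a₁ a₂ σ τ ε → Param.wForm t x a₀ a₁ a₂ σ τ ε ≈
    # 2 * t ^ 2 * (t ^ 2 * a₀ - σ) + x * Param.rest₁ t x a₀ a₁ a₂ σ τ ε
  wForm-x⁰ t x a₀ a₁ a₂ σ τ ε = solve 8 (λ { (t ∷ x ∷ a₀ ∷ a₁ ∷ a₂ ∷ σ ∷ τ ∷ ε ∷ []) →
    E.wForm t x a₀ a₁ a₂ σ τ ε , N.# 2 :* t N.^ 2 :* (t N.^ 2 :* a₀ :- σ) :+ x :* E.rest₁ t x a₀ a₁ a₂ σ τ ε })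
    ≡.refl (t ∷ x ∷ a₀ ∷ a₁ ∷ a₂ ∷ σ ∷ τ ∷ ε ∷ [])

  wForm-x¹ : ∀ t x a₀ a₁ a₂ τ ε → Param.wForm t x a₀ a₁ a₂ (t ^ 2 * a₀) τ ε ≈
    x * (# 2 * t * (t ^ 3 * a₁ - τ) + x * Param.rest₂ t x a₀ a₁ a₂ (t ^ 2 * a₀) τ ε)
  wForm-x¹ t x a₀ a₁ a₂ τ ε = solve 7 (λ { (t ∷ x ∷ a₀ ∷ a₁ ∷ a₂ ∷ τ ∷ ε ∷ []) →
    E.wForm t x a₀ a₁ a₂ (t N.^ 2 :* a₀) τ ε ,
    x :* (N.# 2 :* t :* (t N.^ 3 :* a₁ :- τ) :+ x :* E.rest₂ t x a₀ a₁ a₂ (t N.^ 2 :* a₀) τ ε) })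
    ≡.refl (t ∷ x ∷ a₀ ∷ a₁ ∷ a₂ ∷ τ ∷ ε ∷ [])

  wForm-catalytic : ∀ t x a₀ a₁ a₂ ε → Param.wForm t x a₀ a₁ a₂ (t ^ 2 * a₀) (t ^ 3 * a₁) ε ≈
    (t * x) ^ 2 * (KernelFormulas.catalyticSide rawRing t x a₀ a₁ a₂ - ε)
  wForm-catalytic t x a₀ a₁ a₂ ε = solve 6 (λ { (t ∷ x ∷ a₀ ∷ a₁ ∷ a₂ ∷ ε ∷ []) →
    E.wForm t x a₀ a₁ a₂ (t N.^ 2 :* a₀) (t N.^ 3 :* a₁) ε , (t :* x) N.^ 2 :* (K.catalyticSide t x a₀ a₁ a₂ :- ε) })
    ≡.refl (t ∷ x ∷ a₀ ∷ a₁ ∷ a₂ ∷ ε ∷ [])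

-- The parametrised solution of the catalytic equation

module Candidate (Q : CRing) (dom : Domain Q) (apart-2 : Domain.Apart dom (Solver.num Q 2)) where
  open TrivariateSeries Q dom
  open CatalyticUniqueness Q dom using (CatalyticSolution)
  open ParametrisationIdentities ring₃
  open SeriesProperties ring₂
    using (solution; solution-eq; solution-preserves; inverse; inverse-eq; inverse-preserves; ⊗-coefficient)
  open Solver ring₃ using (⟦_⟧; ⟦⟧-cong)
  open SetoidReasoning setoid
  private
    module S₂ = SeriesProperties ring₁
    module E {n} = Parametrisation (exprRing n)

  Cone : ℕ → R₂.Carrier → Set
  Cone n a = ∀ i → n < i → a i R₁.≈ R₁.0#

  -- Degrees in x and exponents of t both add under multiplication, so the bound of the one by the
  -- other survives.
  cone : IsSubring ring₃ (λ F → ∀ n → Cone n (F n))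
  cone = record
    { resp  = λ F≈H cF n i n<i → R₁.trans (R₁.sym (F≈H n i)) (cF n i n<i)
    ; has-0 = λ n i n<i → R₁.refl
    ; has-1 = λ { zero (suc i) _ → R₁.refl ; (suc n) i _ → R₁.refl }
    ; has-+ = λ cF cH n i n<i → L₁.sum-0 (cF n i n<i) (cH n i n<i)
    ; has-* = λ {F} {H} cF cH n → ⊗-coefficient (Cone n) (λ ca cb i n<i → L₁.sum-0 (ca i n<i) (cb i n<i)) {F} {H} n
        (λ { k l ≡.refl i k+l<i → S₂.⊗-above {F k} {H l} k l (cF k) (cH l) i k+l<i })
    ; has-- = λ cF n i n<i → L₁.neg-0 (cF n i n<i)
    }

  XFree : ℕ → R₂.Carrier → Set
  XFree _ a = ∀ i → a (suc i) R₁.≈ R₁.0#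

  private
    module Cn = IsSubring cone
    module Xf = IsSubring x-free-subring

  at-0 : ∀ {F H} → F ≈ 1# + t * H → F 0 R₂.≈ R₂.1#
  at-0 {F} {H} e = R₂.trans (e 0) (R₂.trans (R₂.+-congˡ (t-zero H)) (R₂.+-identityʳ _))

  apart-unit : ∀ {F} → F 0 R₂.≈ R₂.1# → D.Apart F
  apart-unit F₀ = 0 , (λ _ ()) , D₂.apart-resp (R₂.sym F₀) D₂.apart-1

  apart-^ : ∀ {a} n → D.Apart a → D.Apart (a ^ n)
  apart-^ zero    h = D.apart-1
  apart-^ (suc n) h = D.apart-* h (apart-^ n h)

  t₀ : t 0 R₂.≈ R₂.0#
  t₀ = R₂.refl

  -- The equation for ζ is ζ = t² Z⁶ - ζ² h, whose quadratic term lacks a small factor; ζ = t η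
  -- supplies one.
  η ζ : Carrier
  η = solution 0# t 0# t₀ R₂.refl (E.η-step (var zero) (var (suc zero))) :0 (t ∷ [])
  ζ = t * η

  η-eq : η ≈ t * Param.η-step η t
  η-eq = trans (solution-eq 0# t 0# t₀ R₂.refl (E.η-step (var zero) (var (suc zero))) :0 (t ∷ []))
    (solve 1 (λ { (a ∷ []) → (:0 :+ a) :+ :0 :* :0 , a }) ≡.refl (t * Param.η-step η t ∷ []))

  cone-t : ∀ n → Cone n (t n)
  cone-t zero          i       _ = R₁.refl
  cone-t (suc zero)    (suc i) _ = R₁.refl
  cone-t (suc (suc n)) i       _ = R₁.refl

  cone-ζ : ∀ n → Cone n (ζ n)
  cone-ζ = Cn.has-* {t} {η} cone-t (solution-preserves 0# t 0# t₀ R₂.refl (E.η-step (var zero) (var (suc zero))) :0 (t ∷ [])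
    Cone cone Cn.has-0 cone-t Cn.has-0 (λ { zero → cone-t }))

  x-free-ζ : x-free ζ
  x-free-ζ = Xf.has-* {t} {η} x-free-t (solution-preserves 0# t 0# t₀ R₂.refl (E.η-step (var zero) (var (suc zero))) :0 (t ∷ [])
    XFree x-free-subring Xf.has-0 x-free-t Xf.has-0 (λ { zero → x-free-t }))

  ζ-eq : t ^ 2 * Param.Z ζ ^ 6 ≈ Param.p ζ * Param.q ζ ^ 3
  ζ-eq = trans (η-identity t η) (L.drop η-eq)

  z q₃ : Carrier
  z  = Param.Z ζ ^ 3
  q₃ = Param.q ζ ^ 3

  z₀ : z 0 R₂.* R₂.1# R₂.≈ R₂.1#
  z₀ = R₂.trans (R₂.*-identityʳ _) (at-0 (solve 2 (λ { (t ∷ η ∷ []) → E.Z (t :* η) :* (E.Z (t :* η) :* (E.Z (t :* η) :* :1)) ,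
    :1 :+ t :* (η :* ((E.Z (t :* η) :* E.Z (t :* η) :+ E.Z (t :* η) :+ :1) :* (:1 :+ :1))) }) ≡.refl (t ∷ η ∷ [])))

  q₀ : q₃ 0 R₂.* R₂.1# R₂.≈ R₂.1#
  q₀ = R₂.trans (R₂.*-identityʳ _) (at-0 (solve 2 (λ { (t ∷ η ∷ []) → E.q (t :* η) :* (E.q (t :* η) :* (E.q (t :* η) :* :1)) ,
    :1 :+ t :* (η :* ((E.q (t :* η) :* E.q (t :* η) :+ E.q (t :* η) :+ :1) :* (:1 :+ t :* η))) }) ≡.refl (t ∷ η ∷ [])))

  zi qi : Carrier
  zi = inverse z R₂.1# z₀
  qi = inverse q₃ R₂.1# q₀

  z-zi : z * zi ≈ 1#
  z-zi = inverse-eq z R₂.1# z₀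
  q-qi : q₃ * qi ≈ 1#
  q-qi = inverse-eq q₃ R₂.1# q₀

  σ τ ε : Carrier
  σ = Param.ν-σ ζ * zi
  τ = Param.ν-τ ζ * zi * zi
  ε = Param.c ζ ^ 4 * zi * qi

  σ-eq : z * σ ≈ Param.ν-σ ζ
  σ-eq = trans (solve 3 (λ { (z ∷ n ∷ i ∷ []) → z :* (n :* i) , n :+ n :* (z :* i :- :1) }) ≡.refl (z ∷ Param.ν-σ ζ ∷ zi ∷ [])) (L.drop z-zi)

  τ-eq : z ^ 2 * τ ≈ Param.ν-τ ζ
  τ-eq = trans (solve 3 (λ { (z ∷ n ∷ i ∷ []) → (z :* (z :* :1)) :* (n :* i :* i) , n :+ n :* (z :* i :+ :1) :* (z :* i :- :1) }) ≡.refl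
    (z ∷ Param.ν-τ ζ ∷ zi ∷ [])) (L.drop z-zi)

  ε-eq : z * q₃ * ε ≈ Param.c ζ ^ 4
  ε-eq = trans (solve 5 (λ { (z ∷ q ∷ c ∷ i ∷ j ∷ []) → z :* q :* (c :* i :* j) , (c :+ c :* (z :* i :- :1)) :+ c :* z :* i :* (q :* j :- :1) }) ≡.refl
    (z ∷ q₃ ∷ Param.c ζ ^ 4 ∷ zi ∷ qi ∷ [])) (trans (L.drop q-qi) (L.drop z-zi))

  w : Carrier
  w = t * x

  w₀ : w 0 R₂.≈ R₂.0#
  w₀ = t-zero x

  -- In w Z³ D g = q³ v the series r starts with w. Dividing by w leaves an equation for `r̃` that
  -- contracts through `ζ` and `w`.
  r̃ r : Carrier
  r̃ = solution 1# ζ w (t-zero η) w₀ (E.step₁ (var zero) (var (suc zero)) (var (suc (suc zero)))) (E.step₂ (var zero) (var (suc zero)) (var (suc (suc zero)))) (ζ ∷ w ∷ [])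
  r = w * r̃

  r̃-eq : r̃ ≈ 1# + ζ * Param.step₁ r̃ ζ w + w * Param.step₂ r̃ ζ w
  r̃-eq = solution-eq 1# ζ w (t-zero η) w₀ (E.step₁ (var zero) (var (suc zero)) (var (suc (suc zero)))) (E.step₂ (var zero) (var (suc zero)) (var (suc (suc zero)))) (ζ ∷ w ∷ [])

  cone-w : ∀ n → Cone n (w n)
  cone-w zero i _ = R₁.trans (t-zero x i) R₁.refl
  cone-w (suc zero) (suc (suc i)) _ = t-suc x 0 (suc (suc i))
  cone-w (suc zero) (suc zero) (ℕ.s≤s ())
  cone-w (suc (suc n)) i _ = t-suc x (suc n) i

  cone-r̃ : ∀ n → Cone n (r̃ n)
  cone-r̃ = solution-preserves 1# ζ w (t-zero η) w₀ (E.step₁ (var zero) (var (suc zero)) (var (suc (suc zero)))) (E.step₂ (var zero) (var (suc zero)) (var (suc (suc zero)))) (ζ ∷ w ∷ [])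
    Cone cone Cn.has-1 cone-ζ cone-w (λ { zero → cone-ζ ; (suc zero) → cone-w })

  D′ g′ : Carrier
  D′ = Param.D ζ r
  g′ = Param.g ζ r

  D₀ : D′ 0 R₂.* R₂.1# R₂.≈ R₂.1#
  D₀ = R₂.trans (R₂.*-identityʳ _) (at-0 (trans (D-identity ζ r) (+-congˡ {1#}
    (solve 4 (λ { (t ∷ x ∷ r̃ ∷ d ∷ []) → t :* x :* r̃ :* d , t :* (x :* r̃ :* d) }) ≡.refl (t ∷ x ∷ r̃ ∷ Param.D₁ ζ r ∷ [])))))

  g₀ : g′ 0 R₂.≈ R₂.1#
  g₀ = at-0 (solve 4 (λ { (t ∷ x ∷ r̃ ∷ c ∷ []) → (:1 :+ :0) :+ c :* (t :* x :* r̃) , :1 :+ t :* (c :* (x :* r̃)) }) ≡.refl (t ∷ x ∷ r̃ ∷ Param.c ζ ∷ []))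

  -- Since g = D² + r M and r = w r̃, one has g / D² = 1 + w A: `A` is the candidate for G(x,0).
  Di A : Carrier
  Di = inverse D′ R₂.1# D₀
  A = r̃ * Param.M ζ r * Di ^ 2

  cone-ζr : ∀ i n → Cone n (Vec.lookup (ζ ∷ r ∷ []) i n)
  cone-ζr zero       = cone-ζ
  cone-ζr (suc zero) = Cn.has-* {w} {r̃} cone-w cone-r̃

  cone-A : ∀ n → Cone n (A n)
  cone-A = Cn.has-* {r̃ * Param.M ζ r} {Di ^ 2} (Cn.has-* {r̃} {Param.M ζ r} cone-r̃ (Cn.has-⟦⟧ (E.M (var zero) (var (suc zero))) (ζ ∷ r ∷ []) cone-ζr))
    (Cn.has-* {Di} {Di * 1#} cone-Di (Cn.has-* {Di} {1#} cone-Di Cn.has-1))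
    where
    cone-Di : ∀ n → Cone n (Di n)
    cone-Di = inverse-preserves D′ R₂.1# D₀ Cone cone (Cn.has-⟦⟧ (E.D (var zero) (var (suc zero))) (ζ ∷ r ∷ []) cone-ζr) Cn.has-1

  w-eq : z * D′ * g′ * w ≈ q₃ * Param.v ζ r
  w-eq = trans (r̃-identity r̃ ζ w) (L.drop r̃-eq)

  m : Carrier
  m = 1# + w * A

  m-eq : D′ ^ 2 * m ≈ g′
  m-eq = trans (m-identity ζ r r̃ w Di) (trans (L.drop (inverse-eq D′ R₂.1# D₀)) (L.drop refl))

  s-eq : z ^ 2 * t ^ 2 ≈ Param.p ζ * q₃
  s-eq = trans (solve 2 (λ { (t ∷ Z ∷ []) → (Z ³) :* ((Z ³) :* :1) :* t , t :* (Z :* (Z :* (Z :* (Z ³)))) }) ≡.refl (t ^ 2 ∷ Param.Z ζ ∷ [])) ζ-eq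
    where
    _³ : ∀ {n} → Expr n → Expr n
    e ³ = e :* (e :* (e :* :1))

  -- Multiplication by the cleared denominators, whose constant term in t is 1, leaves a polynomial
  -- identity in ζ and r alone.
  curve-0 : Param.curve w (t ^ 2) m σ τ ε ≈ 0#
  curve-0 = D.cancel-0 apart-factor (begin
    z ^ 4 * D′ ^ 6 * g′ ^ 4 * q₃ * Param.curve w (t ^ 2) m σ τ ε
      ≈⟨ clear z D′ g′ q₃ w (t ^ 2) m σ τ ε ⟩
    Param.cleared z D′ g′ q₃ (z * D′ * g′ * w) (D′ ^ 2 * m) (z ^ 2 * t ^ 2) (z * σ) (z ^ 2 * τ) (z * q₃ * ε)
      ≈⟨ ⟦⟧-cong cleared-expr {ρ = z ∷ D′ ∷ g′ ∷ q₃ ∷ z * D′ * g′ * w ∷ D′ ^ 2 * m ∷ z ^ 2 * t ^ 2 ∷ z * σ ∷ z ^ 2 * τ ∷ z * q₃ * ε ∷ []}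
           {ρ′ = z ∷ D′ ∷ g′ ∷ q₃ ∷ q₃ * Param.v ζ r ∷ g′ ∷ Param.p ζ * q₃ ∷ Param.ν-σ ζ ∷ Param.ν-τ ζ ∷ Param.c ζ ^ 4 ∷ []}
           (λ { zero → refl ; (suc zero) → refl ; (suc (suc zero)) → refl ; (suc (suc (suc zero))) → refl
              ; (suc (suc (suc (suc zero)))) → w-eq
              ; (suc (suc (suc (suc (suc zero))))) → m-eq
              ; (suc (suc (suc (suc (suc (suc zero)))))) → s-eq
              ; (suc (suc (suc (suc (suc (suc (suc zero))))))) → σ-eq
              ; (suc (suc (suc (suc (suc (suc (suc (suc zero)))))))) → τ-eq
              ; (suc (suc (suc (suc (suc (suc (suc (suc (suc zero))))))))) → ε-eq }) ⟩
    Param.cleared z D′ g′ q₃ (q₃ * Param.v ζ r) g′ (Param.p ζ * q₃) (Param.ν-σ ζ) (Param.ν-τ ζ) (Param.c ζ ^ 4)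
      ≈⟨ reduce z D′ g′ q₃ (Param.v ζ r) (Param.p ζ) (Param.ν-σ ζ) (Param.ν-τ ζ) (Param.c ζ ^ 4) ⟩
    g′ * q₃ ^ 3 * _
      ≈⟨ *-congˡ {g′ * q₃ ^ 3} (reduced-0 ζ r) ⟩
    g′ * q₃ ^ 3 * 0#
      ≈⟨ zeroʳ _ ⟩
    0# ∎)
    where
    cleared-expr : Expr 10
    cleared-expr = E.cleared (var zero) (var (suc zero)) (var (suc (suc zero))) (var (suc (suc (suc zero))))
      (var (suc (suc (suc (suc zero))))) (var (suc (suc (suc (suc (suc zero)))))) (var (suc (suc (suc (suc (suc (suc zero)))))))
      (var (suc (suc (suc (suc (suc (suc (suc zero)))))))) (var (suc (suc (suc (suc (suc (suc (suc (suc zero)))))))))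
      (var (suc (suc (suc (suc (suc (suc (suc (suc (suc zero))))))))))
    unit : ∀ {F} → F 0 R₂.* R₂.1# R₂.≈ R₂.1# → D.Apart F
    unit e = apart-unit (R₂.trans (R₂.sym (R₂.*-identityʳ _)) e)
    apart-factor : D.Apart (z ^ 4 * D′ ^ 6 * g′ ^ 4 * q₃)
    apart-factor = D.apart-* (D.apart-* (D.apart-* (apart-^ 4 (unit z₀)) (apart-^ 6 (unit D₀))) (apart-^ 4 (apart-unit g₀))) (unit q₀)

  a₀ a₁ a₂ : Carrier
  a₀ = at-x₀ A
  a₁ = at-x₀ (∂x A)
  a₂ = ∂x (∂x A)

  A-split : a₀ + x * (a₁ + x * a₂) ≈ A
  A-split = trans (+-congˡ {a₀} (*-congˡ {x} (split-x (∂x A)))) (split-x A)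

  apart-w : D.Apart w
  apart-w = D.apart-* apart-t apart-x

  wForm-0 : Param.wForm t x a₀ a₁ a₂ σ τ ε ≈ 0#
  wForm-0 = D.cancel-0 apart-w (trans (sym (curve-wForm t x a₀ a₁ a₂ σ τ ε))
    (trans (⟦⟧-cong (E.curve (var zero) (var (suc zero)) (var (suc (suc zero))) (var (suc (suc (suc zero)))) (var (suc (suc (suc (suc zero))))) (var (suc (suc (suc (suc (suc zero)))))))
        {ρ = w ∷ t ^ 2 ∷ 1# + w * (a₀ + x * (a₁ + x * a₂)) ∷ σ ∷ τ ∷ ε ∷ []} {ρ′ = w ∷ t ^ 2 ∷ m ∷ σ ∷ τ ∷ ε ∷ []}
        (λ { zero → refl ; (suc zero) → refl ; (suc (suc zero)) → +-congˡ {1#} (*-congˡ {w} A-split)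
           ; (suc (suc (suc zero))) → refl ; (suc (suc (suc (suc zero)))) → refl ; (suc (suc (suc (suc (suc zero))))) → refl }))
      curve-0))

  x-free-part : ∀ {P R} → x-free P → P + x * R ≈ 0# → P ≈ 0#
  x-free-part {P} {R} xP e n zero    = R₁.trans (R₁.sym (R₁.trans (R₁.+-congˡ (x-zero R n)) (R₁.+-identityʳ _))) (e n 0)
  x-free-part         xP e n (suc i) = xP n i

  apart-2t : ∀ k → D.Apart (# 2 * t ^ k)
  apart-2t k = D.apart-* (apart-num 2 apart-2) (apart-^ k apart-t)

  x-free-^t : ∀ k → x-free (t ^ k)
  x-free-^t zero    = Xf.has-1
  x-free-^t (suc k) = Xf.has-* {t} {t ^ k} x-free-t (x-free-^t k)

  x-free-2t : ∀ k → x-free (# 2 * t ^ k)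
  x-free-2t k = Xf.has-* {# 2} {t ^ k} (Xf.has-× 2) (x-free-^t k)

  x-free-zi : x-free zi
  x-free-zi = inverse-preserves z R₂.1# z₀ XFree x-free-subring
    (Xf.has-⟦⟧ (E.Z (var zero) :* (E.Z (var zero) :* (E.Z (var zero) :* :1))) (ζ ∷ []) (λ { zero → x-free-ζ })) Xf.has-1
  x-free-qi : x-free qi
  x-free-qi = inverse-preserves q₃ R₂.1# q₀ XFree x-free-subring
    (Xf.has-⟦⟧ (E.q (var zero) :* (E.q (var zero) :* (E.q (var zero) :* :1))) (ζ ∷ []) (λ { zero → x-free-ζ })) Xf.has-1

  x-free-σ : x-free σ
  x-free-σ = Xf.has-* {Param.ν-σ ζ} {zi} (Xf.has-⟦⟧ (E.ν-σ (var zero)) (ζ ∷ []) (λ { zero → x-free-ζ })) x-free-zi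
  x-free-τ : x-free τ
  x-free-τ = Xf.has-* {Param.ν-τ ζ * zi} {zi} (Xf.has-* {Param.ν-τ ζ} {zi}
    (Xf.has-⟦⟧ (E.ν-τ (var zero)) (ζ ∷ []) (λ { zero → x-free-ζ })) x-free-zi) x-free-zi
  x-free-ε : x-free ε
  x-free-ε = Xf.has-* {Param.c ζ ^ 4 * zi} {qi} (Xf.has-* {Param.c ζ ^ 4} {zi}
    (Xf.has-⟦⟧ (E.c (var zero) :* (E.c (var zero) :* (E.c (var zero) :* (E.c (var zero) :* :1)))) (ζ ∷ []) (λ { zero → x-free-ζ })) x-free-zi) x-free-qi

  x-free-- : ∀ F H → x-free F → x-free H → x-free (F - H)
  x-free-- F H xF xH = Xf.has-+ {F} { - H} xF (Xf.has-- {H} xH)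

  a₀-eq : t ^ 2 * a₀ ≈ σ
  a₀-eq = L.equal-from-0 (D.cancel-0 (apart-2t 2) (x-free-part
    (Xf.has-* {# 2 * t ^ 2} {t ^ 2 * a₀ - σ} (x-free-2t 2)
      (x-free-- (t ^ 2 * a₀) σ (Xf.has-* {t ^ 2} {a₀} (x-free-^t 2) (x-free-at-x₀ A)) x-free-σ))
    (trans (sym (wForm-x⁰ t x a₀ a₁ a₂ σ τ ε)) wForm-0)))

  wForm-expr : Expr 8
  wForm-expr = E.wForm (var zero) (var (suc zero)) (var (suc (suc zero))) (var (suc (suc (suc zero))))
      (var (suc (suc (suc (suc zero))))) (var (suc (suc (suc (suc (suc zero)))))) (var (suc (suc (suc (suc (suc (suc zero)))))))
      (var (suc (suc (suc (suc (suc (suc (suc zero))))))))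

  wForm-cong : ∀ {σ σ′ τ τ′} → σ ≈ σ′ → τ ≈ τ′ → Param.wForm t x a₀ a₁ a₂ σ τ ε ≈ Param.wForm t x a₀ a₁ a₂ σ′ τ′ ε
  wForm-cong {σ} {σ′} {τ} {τ′} e f = ⟦⟧-cong wForm-expr {ρ = t ∷ x ∷ a₀ ∷ a₁ ∷ a₂ ∷ σ ∷ τ ∷ ε ∷ []} {ρ′ = t ∷ x ∷ a₀ ∷ a₁ ∷ a₂ ∷ σ′ ∷ τ′ ∷ ε ∷ []}
    (λ { zero → refl ; (suc zero) → refl ; (suc (suc zero)) → refl ; (suc (suc (suc zero))) → refl
       ; (suc (suc (suc (suc zero)))) → refl ; (suc (suc (suc (suc (suc zero))))) → e
       ; (suc (suc (suc (suc (suc (suc zero)))))) → f ; (suc (suc (suc (suc (suc (suc (suc zero))))))) → refl })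

  a₁-eq : t ^ 3 * a₁ ≈ τ
  a₁-eq = L.equal-from-0 (D.cancel-0 (D.apart-resp (*-congˡ {# 2} (*-identityʳ t)) (apart-2t 1)) (x-free-part
    (Xf.has-* {# 2 * t} {t ^ 3 * a₁ - τ} (Xf.has-* {# 2} {t} (Xf.has-× 2) x-free-t)
      (x-free-- (t ^ 3 * a₁) τ (Xf.has-* {t ^ 3} {a₁} (x-free-^t 3) (x-free-at-x₀ (∂x A))) x-free-τ))
    (D.cancel-0 apart-x (trans (sym (wForm-x¹ t x a₀ a₁ a₂ τ ε)) (trans (wForm-cong a₀-eq refl) wForm-0)))))

  candidate : CatalyticSolution a₀ a₁ a₂ ε
  candidate = record
    { x-free-a₀ = x-free-at-x₀ A
    ; x-free-a₁ = x-free-at-x₀ (∂x A)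
    ; a₂-bound  = λ n i n<i → cone-A n (suc (suc i)) (ℕₚ.m<n⇒m<1+n (ℕₚ.m<n⇒m<1+n n<i))
    ; x-free-ε  = x-free-ε
    ; equation  = L.equal-from-0 (D.cancel-0 (apart-^ 2 apart-w)
        (trans (sym (wForm-catalytic t x a₀ a₁ a₂ ε)) (trans (wForm-cong a₀-eq a₁-eq) wForm-0)))
    }

-- Coefficients of the cubic equations satisfied by G(x,0) and G(0,y).
module CubicCoefficients (R : RawRing 0ℓ 0ℓ) where
  open RawNotation R

  module _ (t x a₀ a₁ ε : Carrier) where
    private
      n₀ n₁ n₂ : Carrier
      n₀ = x ^ 2 - t * x ^ 3 - # 2 * t ^ 2 * a₀ - # 2 * t ^ 2 * a₁ * x + t ^ 3 * x * a₀ ^ 2 + t * x * a₀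
      n₁ = # 2 * t ^ 2 - t * x - # 2 * t ^ 3 * x * a₀
      n₂ = t ^ 3 * x
    xc₀ xc₁ xc₂ : Carrier
    xc₀ = x ^ 2 * ε - n₀
    xc₁ = - (n₁ + t * x * n₀)
    xc₂ = - (n₂ + t * x * n₁)

  module _ (t y a₀ a₁ ε : Carrier) where
    private
      l₀ l₁ m₀ m₁ m₂ : Carrier
      l₀ = y + t ^ 2 * (1# + y) * a₀
      l₁ = - (t ^ 2 * (1# + y) ^ 2)
      m₀ = 1# + y ^ 2 - # 2 * t * a₁ * y
      m₁ = y * (1# - y)
      m₂ = t ^ 2 * y * (1# + y) ^ 2
    yc₀ yc₁ yc₂ : Carrier
    yc₀ = m₀ * l₀ - y * (1# + y) * ε
    yc₁ = m₀ * l₁ + m₁ * l₀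
    yc₂ = m₁ * l₁ + m₂ * l₀

-- The tower of finite extensions containing G

module Algebraicity (Q : CRing) (dom : Domain Q) (char-0 : ∀ n → Domain.Apart dom (Solver.num Q (suc n))) where
  open TrivariateSeries Q dom
  open CatalyticUniqueness Q dom
  open GesselEquations Q dom
  open ParametrisationIdentities ring₃ using (module Param)
  open AlgebraicElements dom₃
  open SetoidReasoning setoid
  private
    module C = Candidate Q dom (char-0 1)
    module E {n} = Parametrisation (exprRing n)
    module N {n} = RawNotation (exprRing n)
    module Cubic {n} = CubicCoefficients (exprRing n)
    module Pl = IsSubring D.pol

    pol-# : ∀ k → D.Pol (# k)
    pol-# = Pl.has-×

    apart-# : ∀ k → D.Apart (# (suc k))
    apart-# k = apart-num (suc k) (char-0 k)

    pol-t^ : ∀ k → D.Pol (t ^ k)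
    pol-t^ zero    = Pl.has-1
    pol-t^ (suc k) = Pl.has-* {t} {t ^ k} pol-t (pol-t^ k)

    apart-t^ : ∀ k → D.Apart (t ^ k)
    apart-t^ k = C.apart-^ k apart-t

  Z : Carrier
  Z = Param.Z C.ζ

  module Z-relation where
    open Adjoin fractions Z
    open IsSubring (FiniteExtension.subring fractions)

    private
      frac-num : ∀ k → Fractions (# k)
      frac-num k = has-× k

      monomial : ∀ n {q} → Deg< n q → Deg< (suc n) (Z * q)
      monomial n {q} h = 0# , q , has-0 , h , sym (+-identityˡ _)

      with-constant : ∀ n {c q} → Fractions c → Deg< n q → Deg< (suc n) (c + Z * q)
      with-constant n {c} {q} fc h = c , q , fc , h , refl

      top : Carrier
      top = # 256 * t ^ 2 - # 8

      frac-top : Fractions top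
      frac-top = FiniteExtension.has-pol fractions (Pl.has-+ {# 256 * t ^ 2} { - # 8}
        (Pl.has-* {# 256} {t ^ 2} (pol-# 256) (pol-t^ 2)) (Pl.has-- {# 8} (pol-# 8)))

    -- As (Z² - 1)(Z² + 3)³ = Z⁸ + 8 Z⁶ + 18 Z⁴ - 27, the equation is Z⁸ = 27 - 18 Z⁴ + (256 t² - 8)
    -- Z⁶. The 256 comes from 4 p = Z² - 1 and 4 q = Z² + 3.
    relation : Deg< 8 (1# * Z ^ 8)
    relation = deg-resp 8 (begin
        # 27 + Z * (Z * (Z * (Z * (- # 18 + Z * (Z * (top + Z * (Z * 0#)))))))
          ≈⟨ solve 2 (λ { (t ∷ ζ ∷ []) → let Z = E.Z ζ in
               N.# 27 :+ Z :* (Z :* (Z :* (Z :* ((:- N.# 18) :+ Z :* (Z :* ((N.# 256 :* t N.^ 2 :- N.# 8) :+ Z :* (Z :* :0))))))) ,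
               :1 :* Z N.^ 8 :+ N.# 256 :* (t N.^ 2 :* Z N.^ 6 :- E.p ζ :* E.q ζ N.^ 3) }) ≡.refl (t ∷ C.ζ ∷ []) ⟩
        1# * Z ^ 8 + # 256 * (t ^ 2 * Z ^ 6 - Param.p C.ζ * Param.q C.ζ ^ 3)
          ≈⟨ L.drop C.ζ-eq ⟩
        1# * Z ^ 8 ∎)
      (with-constant 7 (frac-num 27) (monomial 6 (monomial 5 (monomial 4
        (with-constant 3 (has-- {# 18} (frac-num 18)) (monomial 2 (with-constant 1 frac-top (monomial 0 refl))))))))

    module Ext = Over 7 Pl.has-1 D.apart-1 relation

  module ParameterField {L} (ext : FiniteExtension L) (has-Z : L Z) where
    open FiniteExtension ext
    open IsSubring subring

    has-ζ : L C.ζ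
    has-ζ = saturated (pol-# 2) (apart-# 1) (resp
      (solve 1 (λ { (ζ ∷ []) → E.Z ζ :+ (:- :1) , N.# 2 :* ζ }) ≡.refl (C.ζ ∷ [])) (has-+ has-Z (has-- has-1)))

    private
      has-^ : ∀ {a} n → L a → L (a ^ n)
      has-^ zero    h = has-1
      has-^ (suc n) h = has-* h (has-^ n h)

      has-t : L t
      has-t = has-pol pol-t

      k : Carrier
      k = Z ^ 6 + # 8 * Z ^ 4 + # 18 * Z ^ 2 - # 256 * t ^ 2 * Z ^ 4

      has-k : L k
      has-k = has-+ (has-+ (has-+ (has-^ 6 has-Z) (has-* (has-× 8) (has-^ 4 has-Z))) (has-* (has-× 18) (has-^ 2 has-Z)))
        (has-- (has-* (has-* (has-× 256) (has-^ 2 has-t)) (has-^ 4 has-Z)))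

      -- The nonzero constant term 27 makes the inverse of Z a polynomial in Z: 1/Z = Z k / 27, and
      -- therefore 27³ / Z³ = Z³ k³.
      Z²k : # 27 ≈ Z ^ 2 * k
      Z²k = trans (solve 2 (λ { (t ∷ ζ ∷ []) → let Z = E.Z ζ in N.# 27 ,
          Z N.^ 2 :* (Z N.^ 6 :+ N.# 8 :* Z N.^ 4 :+ N.# 18 :* Z N.^ 2 :- N.# 256 :* t N.^ 2 :* Z N.^ 4)
          :+ N.# 256 :* (t N.^ 2 :* Z N.^ 6 :- E.p ζ :* E.q ζ N.^ 3) }) ≡.refl (t ∷ C.ζ ∷ []))
        (L.drop C.ζ-eq)

    has-zi : L C.zi
    has-zi = saturated (Pl.has-* (pol-# 27) (Pl.has-* (pol-# 27) (pol-# 27))) (D.apart-* (apart-# 26) (D.apart-* (apart-# 26) (apart-# 26)))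
      (resp (sym (begin
        # 27 * (# 27 * # 27) * C.zi
          ≈⟨ *-congʳ {C.zi} (*-cong Z²k (*-cong Z²k Z²k)) ⟩
        Z ^ 2 * k * (Z ^ 2 * k * (Z ^ 2 * k)) * C.zi
          ≈⟨ solve 3 (λ { (Z ∷ k ∷ i ∷ []) → Z N.^ 2 :* k :* (Z N.^ 2 :* k :* (Z N.^ 2 :* k)) :* i ,
               Z N.^ 3 :* k N.^ 3 :+ Z N.^ 3 :* k N.^ 3 :* (Z N.^ 3 :* i :- :1) }) ≡.refl (Z ∷ k ∷ C.zi ∷ []) ⟩
        Z ^ 3 * k ^ 3 + Z ^ 3 * k ^ 3 * (Z ^ 3 * C.zi - 1#)
          ≈⟨ L.drop C.z-zi ⟩
        Z ^ 3 * k ^ 3 ∎))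
      (has-* (has-^ 3 has-Z) (has-^ 3 has-k)))

    private
      has-expr : ∀ (e : Expr 1) → L (Solver.⟦_⟧ ring₃ e (C.ζ ∷ []))
      has-expr e = has-⟦⟧ e (C.ζ ∷ []) (λ { zero → has-ζ })

    -- From t² Z⁶ = p q³ comes t² / q³ = p / Z⁶, so only Z had to be inverted.
    has-qi : L C.qi
    has-qi = saturated (pol-t^ 2) (apart-t^ 2) (resp
      (sym (trans (solve 6 (λ { (s ∷ q ∷ z ∷ i ∷ p ∷ q₃ ∷ []) → s :* q ,
          ((p :* i N.^ 2 :+ i N.^ 2 :* q :* (z N.^ 2 :* s :- p :* q₃)) :+ p :* i N.^ 2 :* (q₃ :* q :- :1))
          :+ (:- (s :* q :* (z :* i :+ :1))) :* (z :* i :- :1) }) ≡.refl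
          (t ^ 2 ∷ C.qi ∷ C.z ∷ C.zi ∷ Param.p C.ζ ∷ C.q₃ ∷ []))
        (trans (L.drop C.z-zi) (trans (L.drop C.q-qi) (L.drop C.s-eq)))))
      (has-* (has-expr (E.p (var zero))) (has-^ 2 has-zi)))

    has-a₀ : L C.a₀
    has-a₀ = saturated (pol-t^ 2) (apart-t^ 2) (resp (sym C.a₀-eq) (has-* (has-expr (E.ν-σ (var zero))) has-zi))

    has-a₁ : L C.a₁
    has-a₁ = saturated (pol-t^ 3) (apart-t^ 3) (resp (sym C.a₁-eq) (has-* (has-* (has-expr (E.ν-τ (var zero))) has-zi) has-zi))

    has-ε : L C.ε
    has-ε = has-* (has-* (has-^ 4 (has-expr (E.c (var zero)))) has-zi) has-qi

  module _ (G : Carrier)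
    (recurrence : G ≈ 1# + t * (∂x G + (∂x (∂y G) + (x * (y * G) + x * G))))
    (G-cone : ∀ n i j → n < i → G n i j Q.≈ Q.0#) where

    α₀ α₁ α₂ β₁ ε′ α β : Carrier
    α₀ = a₀ G recurrence
    α₁ = a₁ G recurrence
    α₂ = a₂ G recurrence
    β₁ = b₁ G recurrence
    ε′ = ε G recurrence
    α  = F.section-x x α₀ α₁ α₂
    β  = α₀ + y * β₁

    walk-solution : CatalyticSolution α₀ α₁ α₂ ε′
    walk-solution = record
      { x-free-a₀ = x-free-a₀ G recurrence
      ; x-free-a₁ = x-free-a₁ G recurrence
      ; a₂-bound  = λ { n i n<i zero → G-cone n (suc (suc i)) 0 (ℕₚ.m<n⇒m<1+n (ℕₚ.m<n⇒m<1+n n<i)) ; n i n<i (suc j) → Q.refl }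
      ; x-free-ε  = x-free-ε G recurrence
      ; equation  = refl
      }

    α₀-eq : C.a₀ ≈ α₀
    α₀-eq = unique-a₀ C.candidate walk-solution
    α₁-eq : C.a₁ ≈ α₁
    α₁-eq = unique-a₁ C.candidate walk-solution
    α₂-eq : C.a₂ ≈ α₂
    α₂-eq = unique-a₂ C.candidate walk-solution

    ε-eq : C.ε ≈ ε′
    ε-eq = trans (sym (CatalyticSolution.equation C.candidate))
      (Solver.⟦⟧-cong ring₃ (KF.catalyticSide (var zero) (var (suc zero)) (var (suc (suc zero))) (var (suc (suc (suc zero)))) (var (suc (suc (suc (suc zero))))))
        {ρ = t ∷ x ∷ C.a₀ ∷ C.a₁ ∷ C.a₂ ∷ []} {ρ′ = t ∷ x ∷ α₀ ∷ α₁ ∷ α₂ ∷ []}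
        (λ { zero → refl ; (suc zero) → refl ; (suc (suc zero)) → α₀-eq ; (suc (suc (suc zero))) → α₁-eq ; (suc (suc (suc (suc zero)))) → α₂-eq }))
      where module KF = KernelFormulas (exprRing 5)

    private
      v₀ v₁ v₂ v₃ v₄ : Expr 5
      v₀ = var zero
      v₁ = var (suc zero)
      v₂ = var (suc (suc zero))
      v₃ = var (suc (suc (suc zero)))
      v₄ = var (suc (suc (suc (suc zero))))

    module _ {L} (ext : FiniteExtension L) (has-α₀ : L α₀) (has-α₁ : L α₁) (has-ε : L ε′) where
      open FiniteExtension ext
      open IsSubring subring

      private
        c : Expr 5 → Carrier → Carrier
        c e u = Solver.⟦_⟧ ring₃ e (t ∷ u ∷ α₀ ∷ α₁ ∷ ε′ ∷ [])

        has-c : ∀ e {u} → D.Pol u → L (c e u)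
        has-c e {u} pu = has-⟦⟧ e (t ∷ u ∷ α₀ ∷ α₁ ∷ ε′ ∷ []) λ
          { zero → has-pol pol-t ; (suc zero) → has-pol pu ; (suc (suc zero)) → has-α₀
          ; (suc (suc (suc zero))) → has-α₁ ; (suc (suc (suc (suc zero)))) → has-ε }

      -- Substituting x² a₂ = α - a₀ - x a₁ eliminates a₂ and costs a factor x².
      x-cubic : Adjoin.Deg< ext α 3 (t ^ 4 * x ^ 2 * α ^ 3)
      x-cubic = _ , _ , has-c (Cubic.xc₀ v₀ v₁ v₂ v₃ v₄) pol-x ,
        (_ , _ , has-c (Cubic.xc₁ v₀ v₁ v₂ v₃ v₄) pol-x , (_ , _ , has-c (Cubic.xc₂ v₀ v₁ v₂ v₃ v₄) pol-x , refl , refl) , refl) ,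
        trans (solve 6 (λ { (t ∷ x ∷ a₀ ∷ a₁ ∷ a₂ ∷ ε ∷ []) → let α = KF.section-x x a₀ a₁ a₂ in
            t N.^ 4 :* x N.^ 2 :* α N.^ 3 ,
            (Cubic.xc₀ t x a₀ a₁ ε :+ α :* (Cubic.xc₁ t x a₀ a₁ ε :+ α :* (Cubic.xc₂ t x a₀ a₁ ε :+ α :* :0)))
            :+ x N.^ 2 :* (KF.catalyticSide t x a₀ a₁ a₂ :- ε) }) ≡.refl
            (t ∷ x ∷ α₀ ∷ α₁ ∷ α₂ ∷ ε′ ∷ []))
          (L.drop refl)
        where module KF {n} = KernelFormulas (exprRing n)

      -- Substituting y b₁ = β - a₀ eliminates b₁ and costs a factor y. The leading coefficient is
      -- t² y (1 + y)² from `invariantL` times t² (1 + y)² from `decoupling`, up to sign.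
      y-cubic : Adjoin.Deg< ext β 3 (t ^ 4 * y * (1# + y) ^ 4 * β ^ 3)
      y-cubic = _ , _ , has-c (Cubic.yc₀ v₀ v₁ v₂ v₃ v₄) pol-y ,
        (_ , _ , has-c (Cubic.yc₁ v₀ v₁ v₂ v₃ v₄) pol-y , (_ , _ , has-c (Cubic.yc₂ v₀ v₁ v₂ v₃ v₄) pol-y , refl , refl) , refl) ,
        trans (solve 6 (λ { (t ∷ y ∷ a₀ ∷ a₁ ∷ b₁ ∷ ε ∷ []) → let β = a₀ :+ y :* b₁ in
            t N.^ 4 :* y :* (:1 :+ y) N.^ 4 :* β N.^ 3 ,
            (Cubic.yc₀ t y a₀ a₁ ε :+ β :* (Cubic.yc₁ t y a₀ a₁ ε :+ β :* (Cubic.yc₂ t y a₀ a₁ ε :+ β :* :0)))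
            :+ y :* ((ε :+ y :* ε) :- KF.invariantLSide t y a₀ a₁ b₁) }) ≡.refl
            (t ∷ y ∷ α₀ ∷ α₁ ∷ β₁ ∷ ε′ ∷ []))
          (L.drop (y-equation G recurrence))
        where module KF {n} = KernelFormulas (exprRing n)

    algebraic-G : PolynomialRelation dom₃ G
    algebraic-G = polynomial-relation dom₃ (proj₂ (algebraic ext₃ has-G))
      where
      module P₁ = ParameterField {Z-relation.Ext.Adjoined} Z-relation.Ext.adjoin Z-relation.Ext.adjoined-z
      ext₁ = Z-relation.Ext.adjoin
      resp₁ = IsSubring.resp (FiniteExtension.subring ext₁)
      has₁-α₀ : Z-relation.Ext.Adjoined α₀
      has₁-α₀ = resp₁ α₀-eq P₁.has-a₀
      has₁-α₁ : Z-relation.Ext.Adjoined α₁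
      has₁-α₁ = resp₁ α₁-eq P₁.has-a₁
      has₁-ε : Z-relation.Ext.Adjoined ε′
      has₁-ε = resp₁ ε-eq P₁.has-ε
      pol-d : D.Pol (t ^ 4 * x ^ 2)
      pol-d = Pl.has-* {t ^ 4} {x ^ 2} (pol-t^ 4) (Pl.has-* {x} {x * 1#} pol-x (Pl.has-* {x} {1#} pol-x Pl.has-1))
      apart-d : D.Apart (t ^ 4 * x ^ 2)
      apart-d = D.apart-* (apart-t^ 4) (C.apart-^ 2 apart-x)
      module A₂ = Adjoin.Over ext₁ α 2 pol-d apart-d (x-cubic ext₁ has₁-α₀ has₁-α₁ has₁-ε)
      pol-1+y : D.Pol (1# + y)
      pol-1+y = Pl.has-+ {1#} {y} Pl.has-1 pol-y
      pol-1+y^ : ∀ k → D.Pol ((1# + y) ^ k)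
      pol-1+y^ zero    = Pl.has-1
      pol-1+y^ (suc k) = Pl.has-* {1# + y} {(1# + y) ^ k} pol-1+y (pol-1+y^ k)
      pol-d′ : D.Pol (t ^ 4 * y * (1# + y) ^ 4)
      pol-d′ = Pl.has-* {t ^ 4 * y} {(1# + y) ^ 4} (Pl.has-* {t ^ 4} {y} (pol-t^ 4) pol-y) (pol-1+y^ 4)
      apart-d′ : D.Apart (t ^ 4 * y * (1# + y) ^ 4)
      apart-d′ = D.apart-* (D.apart-* (apart-t^ 4) apart-y) (C.apart-^ 4 apart-1+y)
      has₂-α₀ : A₂.Adjoined α₀
      has₂-α₀ = A₂.adjoined-base has₁-α₀
      module A₃ = Adjoin.Over A₂.adjoin β 2 pol-d′ apart-d′
        (y-cubic A₂.adjoin has₂-α₀ (A₂.adjoined-base has₁-α₁) (A₂.adjoined-base has₁-ε))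
      ext₃ = A₃.adjoin
      open FiniteExtension ext₃
      open IsSubring subring
      pol-kernel : D.Pol (F.kernel t x y)
      pol-kernel = Pl.has-⟦⟧ (KernelFormulas.kernel (exprRing 3) (var zero) (var (suc zero)) (var (suc (suc zero)))) (t ∷ x ∷ y ∷ [])
        (λ { zero → pol-t ; (suc zero) → pol-x ; (suc (suc zero)) → pol-y })
      has-rhs : A₃.Adjoined (F.kernelRhs t x y α₀ β (t * (α - α₀)))
      has-rhs = has-⟦⟧ (KernelFormulas.kernelRhs (exprRing 6) (var zero) (var (suc zero)) (var (suc (suc zero))) v₃′ (var (suc (suc (suc (suc zero)))))
            (var zero :* (var (suc (suc (suc (suc (suc zero))))) :- v₃′)))
          (t ∷ x ∷ y ∷ α₀ ∷ β ∷ α ∷ [])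
          λ { zero → has-pol pol-t ; (suc zero) → has-pol pol-x ; (suc (suc zero)) → has-pol pol-y
            ; (suc (suc (suc zero))) → A₃.adjoined-base has₂-α₀
            ; (suc (suc (suc (suc zero)))) → A₃.adjoined-z
            ; (suc (suc (suc (suc (suc zero))))) → A₃.adjoined-base A₂.adjoined-z }
        where
        v₃′ : Expr 6
        v₃′ = var (suc (suc (suc zero)))
      -- G is `kernelRhs` divided by the nonzero polynomial K, with x (a₁ + x a₂) expressed as α -
      -- α₀.
      has-G : A₃.Adjoined G
      has-G = saturated pol-kernel apart-kernel (resp (trans
        (+-congˡ (-‿cong (*-congˡ {t} (solve 2 (λ { (a ∷ b ∷ []) → (a :+ b) :- a , b }) ≡.refl (α₀ ∷ x * (α₁ + x * α₂) ∷ [])))))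
        (kernel-equation G recurrence)) has-rhs)

-- Gessel walks

open import Defs
open import Data.Unit using (⊤; tt)
open import Data.Nat using (_+_; _*_)
open import Data.Integer as ℤ using (+_)
import Data.Integer.Properties as ℤₚ
open import Data.List using (filter; map)
open import Data.Product.Properties using (≡-dec)
open import Data.Rational as ℚ using (ℚ; 0ℚ; 1ℚ)
import Data.Rational.Properties as ℚₚ
open import Data.Rational.Unnormalised as ℚᵘ using (mkℚᵘ; *≡*)
import Data.Rational.Unnormalised.Properties as ℚᵘₚ
open import Function using (_∘_)
open import Relation.Nullary using (¬_; Dec; yes; no; does)
open import Relation.Nullary.Decidable using (_×-dec_)
open import Relation.Unary using (Decidable)
open import Relation.Binary.Definitions using (DecidableEquality)
open import Relation.Binary.PropositionalEquality using (refl; sym; trans; cong; cong₂)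

count : ∀ {A : Set} → (A → Bool) → List A → ℕ
count f []       = 0
count f (x ∷ xs) = if f x then suc (count f xs) else count f xs

module _ {A : Set} where

  length-filter : ∀ {P : A → Set} (P? : Decidable P) xs → length (filter P? xs) ≡ count (does ∘ P?) xs
  length-filter P? []       = refl
  length-filter P? (x ∷ xs) with does (P? x)
  ... | true  = cong suc (length-filter P? xs)
  ... | false = length-filter P? xs

  count-++ : ∀ (f : A → Bool) xs ys → count f (xs ++ ys) ≡ count f xs + count f ys
  count-++ f []       ys = refl
  count-++ f (x ∷ xs) ys with f x
  ... | true  = cong suc (count-++ f xs ys)
  ... | false = count-++ f xs ys

  count-map : ∀ {B : Set} (f : A → Bool) (h : B → A) xs → count f (map h xs) ≡ count (f ∘ h) xs
  count-map f h []       = refl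
  count-map f h (x ∷ xs) with f (h x)
  ... | true  = cong suc (count-map f h xs)
  ... | false = count-map f h xs

  count-false : ∀ (xs : List A) → count (λ _ → false) xs ≡ 0
  count-false []       = refl
  count-false (x ∷ xs) = count-false xs

-- Quadrant walks split at the first and at the last step

data Shift : Set where
  down up stay : Shift

reverse : Shift → Shift
reverse down = up
reverse up   = down
reverse stay = stay

-- Junk value 0 when a shift would leave ℕ.
sh : Shift → (ℕ → ℕ) → ℕ → ℕ
sh down f zero    = 0
sh down f (suc a) = f a
sh up   f a       = f (suc a)
sh stay f a       = f a

horizontal vertical : Step → Shift
horizontal W  = down
horizontal SW = down
horizontal NE = up
horizontal E  = up
vertical W  = stay
vertical SW = down
vertical NE = up
vertical E  = stay

reverseStep : Step → Step
reverseStep W  = E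
reverseStep SW = NE
reverseStep NE = SW
reverseStep E  = W

after : Step → (ℕ → ℕ → ℕ) → ℕ → ℕ → ℕ
after s f a b = sh (horizontal s) (λ a → sh (vertical s) (f a) b) a

transfer : (ℕ → ℕ → ℕ) → ℕ → ℕ → ℕ
transfer f a b = after W f a b + (after SW f a b + (after NE f a b + after E f a b))

δ : ℕ → ℕ → ℕ
δ zero    zero    = 1
δ zero    (suc _) = 0
δ (suc _) zero    = 0
δ (suc a) (suc b) = δ a b

-- Quadrant walks from (a , b) to (i , j), decomposed by first step as words is.
walks : ℕ → ℕ → ℕ → ℕ → ℕ → ℕ
walks zero    a b i j = δ a i * δ b j
walks (suc n) a b i j = transfer (λ a b → walks n a b i j) a b

private
  arrives? : (p : Point) (i j : ℕ) (w : List Step) → Dec (StaysIn p w × (endpoint p w ≡ (+ i , + j)))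
  arrives? p i j w = staysIn? p w ×-dec ≡-dec ℤ._≟_ ℤ._≟_ (endpoint p w) (+ i , + j)

  does-≡-dec : ∀ {A B : Set} (_≟ᴬ_ : DecidableEquality A) (_≟ᴮ_ : DecidableEquality B) a b i j →
    does (≡-dec _≟ᴬ_ _≟ᴮ_ (a , b) (i , j)) ≡ does (a ≟ᴬ i) ∧ does (b ≟ᴮ j)
  does-≡-dec _≟ᴬ_ _≟ᴮ_ a b i j with a ≟ᴬ i
  ... | no _     = refl
  ... | yes refl = refl

  δ-does : ∀ a i → δ a i ≡ (if does (a ℕ.≟ i) then 1 else 0)
  δ-does zero    zero    = refl
  δ-does zero    (suc i) = refl
  δ-does (suc a) zero    = refl
  δ-does (suc a) (suc i) = δ-does a i

  count-after : ∀ n i j → (∀ a b → count (does ∘ arrives? (+ a , + b) i j) (words n) ≡ walks n a b i j) →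
    ∀ s a b → count (does ∘ arrives? (+ a , + b) i j ∘ (s ∷_)) (words n) ≡ after s (λ a b → walks n a b i j) a b
  count-after n i j ih W  zero    b       = count-false (words n)
  count-after n i j ih W  (suc a) b       = ih a b
  count-after n i j ih SW zero    b       = count-false (words n)
  count-after n i j ih SW (suc a) zero    = count-false (words n)
  count-after n i j ih SW (suc a) (suc b) = ih a b
  -- `move` produces a + 1, while `walks` is indexed by suc a.
  count-after n i j ih NE a       b rewrite ℕₚ.+-comm a 1 | ℕₚ.+-comm b 1 = ih (suc a) (suc b)
  count-after n i j ih E  a       b rewrite ℕₚ.+-comm a 1 = ih (suc a) b

  count-arrives : ∀ n i j a b → count (does ∘ arrives? (+ a , + b) i j) (words n) ≡ walks n a b i j
  count-arrives zero i j a b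
    rewrite δ-does a i | δ-does b j | does-≡-dec ℤ._≟_ ℤ._≟_ (+ a) (+ b) (+ i) (+ j)
    with does (a ℕ.≟ i) | does (b ℕ.≟ j)
  ... | true  | true  = refl
  ... | true  | false = refl
  ... | false | true  = refl
  ... | false | false = refl
  count-arrives (suc n) i j a b = begin
    count f (map (W ∷_) ws ++ (map (SW ∷_) ws ++ (map (NE ∷_) ws ++ (map (E ∷_) ws ++ []))))
      ≡⟨ count-++ f (map (W ∷_) ws) _ ⟩
    _ ≡⟨ cong₂ _+_ (first W) (trans (count-++ f (map (SW ∷_) ws) _) (cong₂ _+_ (first SW)
          (trans (count-++ f (map (NE ∷_) ws) _) (cong₂ _+_ (first NE)
          (trans (count-++ f (map (E ∷_) ws) []) (trans (ℕₚ.+-identityʳ _) (first E))))))) ⟩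
    transfer (λ a b → walks n a b i j) a b ∎
    where
    open ≡-Reasoning
    f = does ∘ arrives? (+ a , + b) i j
    ws = words n
    first : ∀ s → count f (map (s ∷_) ws) ≡ after s (λ a b → walks n a b i j) a b
    first s = trans (count-map f (s ∷_) ws) (count-after n i j (count-arrives n i j) s a b)

g≡walks : ∀ n i j → g n i j ≡ walks n 0 0 i j
g≡walks n i j = trans (length-filter (gesselWalkTo? i j) (words n)) (count-arrives n i j 0 0)

sh-cong : ∀ s {f h : ℕ → ℕ} → (∀ a → f a ≡ h a) → ∀ a → sh s f a ≡ sh s h a
sh-cong down e zero    = refl
sh-cong down e (suc a) = e a
sh-cong up   e a       = e (suc a)
sh-cong stay e a       = e a

sh-0 : ∀ s a → sh s (λ _ → 0) a ≡ 0
sh-0 down zero    = refl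
sh-0 down (suc a) = refl
sh-0 up   a       = refl
sh-0 stay a       = refl

sh-comm : ∀ s r (F : ℕ → ℕ → ℕ) a i → sh s (λ a → sh r (F a) i) a ≡ sh r (λ i → sh s (λ a → F a i) a) i
sh-comm down r F zero    i = sym (sh-0 r i)
sh-comm down r F (suc a) i = refl
sh-comm up   r F a       i = refl
sh-comm stay r F a       i = refl

sh-+ : ∀ s (f h : ℕ → ℕ) a → sh s (λ a → f a + h a) a ≡ sh s f a + sh s h a
sh-+ down f h zero    = refl
sh-+ down f h (suc a) = refl
sh-+ up   f h a       = refl
sh-+ stay f h a       = refl

after-cong : ∀ s {f h : ℕ → ℕ → ℕ} → (∀ a b → f a b ≡ h a b) → ∀ a b → after s f a b ≡ after s h a b
after-cong s e a b = sh-cong (horizontal s) (λ a → sh-cong (vertical s) (e a) b) a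

after-+ : ∀ s (f h : ℕ → ℕ → ℕ) a b → after s (λ a b → f a b + h a b) a b ≡ after s f a b + after s h a b
after-+ s f h a b =
  trans (sh-cong (horizontal s) (λ a → sh-+ (vertical s) (f a) (h a) b) a) (sh-+ (horizontal s) _ _ a)

after-comm : ∀ s r (F : ℕ → ℕ → ℕ → ℕ → ℕ) a b i j →
  after s (λ a b → after r (F a b) i j) a b ≡ after r (λ i j → after s (λ a b → F a b i j) a b) i j
after-comm s r F a b i j = begin
  sh h (λ a → sh v (λ b → sh h′ (λ i → sh v′ (F a b i) j) i) b) a
    ≡⟨ sh-cong h (λ a → sh-comm v h′ (λ b i → sh v′ (F a b i) j) b i) a ⟩
  sh h (λ a → sh h′ (λ i → sh v (λ b → sh v′ (F a b i) j) b) i) a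
    ≡⟨ sh-comm h h′ (λ a i → sh v (λ b → sh v′ (F a b i) j) b) a i ⟩
  sh h′ (λ i → sh h (λ a → sh v (λ b → sh v′ (F a b i) j) b) a) i
    ≡⟨ sh-cong h′ (λ i → sh-cong h (λ a → sh-comm v v′ (λ b → F a b i) b j) a) i ⟩
  sh h′ (λ i → sh h (λ a → sh v′ (λ j → sh v (λ b → F a b i j) b) j) a) i
    ≡⟨ sh-cong h′ (λ i → sh-comm h v′ (λ a j → sh v (λ b → F a b i j) b) a j) i ⟩
  sh h′ (λ i → sh v′ (λ j → sh h (λ a → sh v (λ b → F a b i j) b) a) j) i ∎
  where
  open ≡-Reasoning
  h = horizontal s
  v = vertical s
  h′ = horizontal r
  v′ = vertical r

-- Acts on the end point by the last step. The order of summands is that of the reverses of W, SW,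
-- NE, E, so that a single step matches `transfer` term by term.
transfer′ : (ℕ → ℕ → ℕ) → ℕ → ℕ → ℕ
transfer′ f i j = after E f i j + (after NE f i j + (after SW f i j + after W f i j))

after-transfer′ : ∀ s (F : ℕ → ℕ → ℕ → ℕ → ℕ) a b i j →
  after s (λ a b → transfer′ (F a b) i j) a b ≡ transfer′ (λ i j → after s (λ a b → F a b i j) a b) i j
after-transfer′ s F a b i j =
  trans (after-+ s _ _ a b) (cong₂ _+_ (after-comm s E F a b i j)
    (trans (after-+ s _ _ a b) (cong₂ _+_ (after-comm s NE F a b i j)
      (trans (after-+ s _ _ a b) (cong₂ _+_ (after-comm s SW F a b i j) (after-comm s W F a b i j))))))

-- One operator acts on the start point and the other on the end point; the default 0 at the
-- boundary is compatible with this too.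
transfer-comm : ∀ (F : ℕ → ℕ → ℕ → ℕ → ℕ) a b i j →
  transfer (λ a b → transfer′ (F a b) i j) a b ≡ transfer′ (λ i j → transfer (λ a b → F a b i j) a b) i j
transfer-comm F a b i j = begin
  transfer (λ a b → transfer′ (F a b) i j) a b
    ≡⟨ cong₂ _+_ (after-transfer′ W F a b i j) (cong₂ _+_ (after-transfer′ SW F a b i j)
        (cong₂ _+_ (after-transfer′ NE F a b i j) (after-transfer′ E F a b i j))) ⟩
  transfer′ (c W) i j + (transfer′ (c SW) i j + (transfer′ (c NE) i j + transfer′ (c E) i j))
    ≡⟨ cong (_+_ (transfer′ (c W) i j)) (cong (_+_ (transfer′ (c SW) i j)) (transfer′-+ (c NE) (c E))) ⟨
  transfer′ (c W) i j + (transfer′ (c SW) i j + transfer′ (λ i j → c NE i j + c E i j) i j)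
    ≡⟨ cong (_+_ (transfer′ (c W) i j)) (transfer′-+ (c SW) _) ⟨
  transfer′ (c W) i j + transfer′ (λ i j → c SW i j + (c NE i j + c E i j)) i j
    ≡⟨ transfer′-+ (c W) _ ⟨
  transfer′ (λ i j → transfer (λ a b → F a b i j) a b) i j ∎
  where
  open ≡-Reasoning
  c : Step → ℕ → ℕ → ℕ
  c s i j = after s (λ a b → F a b i j) a b
  transfer′-+ : ∀ f h → transfer′ (λ i j → f i j + h i j) i j ≡ transfer′ f i j + transfer′ h i j
  transfer′-+ f h
    rewrite after-+ E f h i j | after-+ NE f h i j | after-+ SW f h i j | after-+ W f h i j =
    trans (cong (_+_ (after E f i j + after E h i j))
             (trans (cong (_+_ (after NE f i j + after NE h i j)) (interchange (after SW f i j) (after SW h i j) _ _))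
                    (interchange (after NE f i j) (after NE h i j) _ _)))
          (interchange (after E f i j) (after E h i j) _ _)
    where open CommutativeSemigroupProperties ℕₚ.+-commutativeSemigroup using (interchange)

-- Shifting the start forwards or the end backwards is the same. At the boundary the default 0
-- agrees with `δ (suc a) 0`.
sh-δ : ∀ s a i → sh s (λ a → δ a i) a ≡ sh (reverse s) (δ a) i
sh-δ down zero    i       = refl
sh-δ down (suc a) i       = refl
sh-δ up   a       zero    = refl
sh-δ up   a       (suc i) = refl
sh-δ stay a       i       = refl

sh-* : ∀ s r (f h : ℕ → ℕ) a b → sh s (λ a → sh r (λ b → f a * h b) b) a ≡ sh s f a * sh r h b
sh-* s down f h a zero    = trans (sh-0 s a) (sym (ℕₚ.*-zeroʳ (sh s f a)))
sh-* s down f h a (suc b) = sh-*ʳ s f (h b) a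
  where
  sh-*ʳ : ∀ s (f : ℕ → ℕ) k a → sh s (λ a → f a * k) a ≡ sh s f a * k
  sh-*ʳ down f k zero    = refl
  sh-*ʳ down f k (suc a) = refl
  sh-*ʳ up   f k a       = refl
  sh-*ʳ stay f k a       = refl
sh-* down up   f h zero    b = refl
sh-* down up   f h (suc a) b = refl
sh-* up   up   f h a       b = refl
sh-* stay up   f h a       b = refl
sh-* down stay f h zero    b = refl
sh-* down stay f h (suc a) b = refl
sh-* up   stay f h a       b = refl
sh-* stay stay f h a       b = refl

-- `words` splits off the first step, the functional equation needs the last. With a free start
-- point the induction closes: a walk of one step is reversed by `sh-δ`, and for longer walks the
-- two operators commute.
walks-last : ∀ n a b i j → walks (suc n) a b i j ≡ transfer′ (λ i j → walks n a b i j) i j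
walks-last zero a b i j = cong₂ _+_ (flip W) (cong₂ _+_ (flip SW) (cong₂ _+_ (flip NE) (flip E)))
  where
  flip : ∀ s → after s (λ a b → δ a i * δ b j) a b ≡ after (reverseStep s) (λ i j → δ a i * δ b j) i j
  flip s = trans (sh-* (horizontal s) (vertical s) (λ a → δ a i) (λ b → δ b j) a b)
    (trans (cong₂ _*_ (trans (sh-δ (horizontal s) a i) (hor s)) (trans (sh-δ (vertical s) b j) (ver s)))
      (sym (sh-* (horizontal (reverseStep s)) (vertical (reverseStep s)) (δ a) (δ b) i j)))
    where
    hor : ∀ s → sh (reverse (horizontal s)) (δ a) i ≡ sh (horizontal (reverseStep s)) (δ a) i
    hor W  = refl
    hor SW = refl
    hor NE = refl
    hor E  = refl
    ver : ∀ s → sh (reverse (vertical s)) (δ b) j ≡ sh (vertical (reverseStep s)) (δ b) j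
    ver W  = refl
    ver SW = refl
    ver NE = refl
    ver E  = refl
walks-last (suc n) a b i j =
  trans (cong₂ _+_ (step W) (cong₂ _+_ (step SW) (cong₂ _+_ (step NE) (step E))))
    (transfer-comm (λ a b i j → walks n a b i j) a b i j)
  where
  step : ∀ s → after s (λ a b → walks (suc n) a b i j) a b ≡ after s (λ a b → transfer′ (walks n a b) i j) a b
  step s = after-cong s (λ a b → walks-last n a b i j) a b

g-last : ∀ n i j → g (suc n) i j ≡ transfer′ (g n) i j
g-last n i j = trans (g≡walks (suc n) i j) (trans (walks-last n 0 0 i j)
  (sym (cong₂ _+_ (step E) (cong₂ _+_ (step NE) (cong₂ _+_ (step SW) (step W))))))
  where
  step : ∀ s → after s (g n) i j ≡ after s (walks n 0 0) i j
  step s = after-cong s (g≡walks n) i j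

-- A step changes the abscissa by one.
g-cone : ∀ n i j → n ℕ.< i → g n i j ≡ 0
g-cone zero    (suc i) j _ = g≡walks 0 (suc i) j
g-cone (suc n) (suc i) j (ℕ.s≤s n<i) = trans (g-last n (suc i) j)
  (cong₂ _+_ (g-cone n (suc (suc i)) j (ℕₚ.m<n⇒m<1+n (ℕₚ.m<n⇒m<1+n n<i)))
    (cong₂ _+_ (g-cone n (suc (suc i)) (suc j) (ℕₚ.m<n⇒m<1+n (ℕₚ.m<n⇒m<1+n n<i)))
      (cong₂ _+_ (trans (sh-cong down (λ j → g-cone n i j n<i) j) (sh-0 down j)) (g-cone n i j n<i))))

ℚ-domain : Domain ℚₚ.+-*-commutativeRing
ℚ-domain = record
  { Apart      = _≢ 0ℚ
  ; apart-resp = λ { refl p≢0 → p≢0 }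
  ; apart-1    = λ ()
  ; apart-*    = λ p≢0 q≢0 pq≡0 → q≢0 (cancel-0 p≢0 pq≡0)
  ; cancel-0   = cancel-0
  ; Pol        = λ _ → ⊤
  ; pol        = _
  ; zero?      = λ {p} _ → zero? p
  }
  where
  cancel-0 : ∀ {p q} → p ≢ 0ℚ → p ℚ.* q ≡ 0ℚ → q ≡ 0ℚ
  cancel-0 {p} {q} p≢0 pq≡0 = begin
    q                    ≡⟨ ℚₚ.*-identityˡ q ⟨
    1ℚ ℚ.* q             ≡⟨ cong (ℚ._* q) (ℚₚ.*-inverseˡ p) ⟨
    ℚ.1/ p ℚ.* p ℚ.* q   ≡⟨ ℚₚ.*-assoc (ℚ.1/ p) p q ⟩
    ℚ.1/ p ℚ.* (p ℚ.* q) ≡⟨ cong (ℚ.1/ p ℚ.*_) pq≡0 ⟩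
    ℚ.1/ p ℚ.* 0ℚ        ≡⟨ ℚₚ.*-zeroʳ (ℚ.1/ p) ⟩
    0ℚ                   ∎
    where
    open ≡-Reasoning
    instance _ = ℚ.≢-nonZero p≢0
  zero? : ∀ p → p ≡ 0ℚ ⊎ p ≢ 0ℚ
  zero? p with p ℚₚ.≟ 0ℚ
  ... | yes p≡0 = inj₁ p≡0
  ... | no  p≢0 = inj₂ p≢0

-- T.ring₃ = ℚ[[y]][[x]][[t]] has carrier Series.
private
  module T = TrivariateSeries ℚₚ.+-*-commutativeRing ℚ-domain

-- Translation to the sums and shifts of the statement

private
  module Σ⁰ = FiniteSums ℚₚ.+-*-commutativeRing
  module Σ¹ = FiniteSums T.ring₁
  module Σ² = FiniteSums T.ring₂
  module Σ³ = FiniteSums T.ring₃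

sumBelow≡Σ< : ∀ n f → sumBelow n f ≡ Σ⁰.Σ< n f
sumBelow≡Σ< zero    f = refl
sumBelow≡Σ< (suc n) f = cong (ℚ._+ f n) (sumBelow≡Σ< n f)

Σ¹-at : ∀ n f j → Σ¹.Σ< n f j ≡ sumBelow n (λ k → f k j)
Σ¹-at zero    f j = refl
Σ¹-at (suc n) f j = cong (ℚ._+ f n j) (Σ¹-at n f j)

Σ²-at : ∀ n f i j → Σ².Σ< n f i j ≡ sumBelow n (λ k → f k i j)
Σ²-at zero    f i j = refl
Σ²-at (suc n) f i j = cong (ℚ._+ f n i j) (Σ²-at n f i j)

Σ³-at : ∀ m f n i j → Σ³.Σ< m f n i j ≡ sumBelow m (λ k → f k n i j)
Σ³-at zero    f n i j = refl
Σ³-at (suc m) f n i j = cong (ℚ._+ f m n i j) (Σ³-at m f n i j)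

sumBelow-cong : ∀ n {f h : ℕ → ℚ} → (∀ k → f k ≡ h k) → sumBelow n f ≡ sumBelow n h
sumBelow-cong zero    e = refl
sumBelow-cong (suc n) e = cong₂ ℚ._+_ (sumBelow-cong n e) (e n)

sumBelow-0 : ∀ n {f : ℕ → ℚ} → (∀ k → f k ≡ 0ℚ) → sumBelow n f ≡ 0ℚ
sumBelow-0 zero    e = refl
sumBelow-0 (suc n) e = trans (cong₂ ℚ._+_ (sumBelow-0 n e) (e n)) (ℚₚ.+-identityˡ 0ℚ)

⊛≡⊗ : ∀ F H n i j → (F ⊛ H) n i j ≡ (F T.* H) n i j
⊛≡⊗ F H n i j = sym (begin
  (F T.* H) n i j
    ≡⟨ Σ².⊗-Σ< F H n i j ⟩
  Σ².Σ< (suc n) (λ a → F a T.R₂.* H (n ∸ a)) i j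
    ≡⟨ Σ²-at (suc n) _ i j ⟩
  sumBelow (suc n) (λ a → (F a T.R₂.* H (n ∸ a)) i j)
    ≡⟨ sumBelow-cong (suc n) (λ a → trans (Σ¹.⊗-Σ< (F a) (H (n ∸ a)) i j) (trans (Σ¹-at (suc i) _ j)
         (sumBelow-cong (suc i) (λ b → trans (Σ⁰.⊗-Σ< (F a b) (H (n ∸ a) (i ∸ b)) j) (sym (sumBelow≡Σ< (suc j) _)))))) ⟩
  (F ⊛ H) n i j ∎)
  where open ≡-Reasoning

^S≡^ : ∀ F a n i j → (F ^S a) n i j ≡ (F T.^ a) n i j
^S≡^ F zero zero    zero    zero    = refl
^S≡^ F zero zero    zero    (suc j) = refl
^S≡^ F zero zero    (suc i) j       = refl
^S≡^ F zero (suc n) i       j       = refl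
^S≡^ F (suc a) n i j = trans (⊛≡⊗ F (F ^S a) n i j) (T.*-congˡ {F} (^S≡^ F a) n i j)

-- D is an exclusive bound, to match the range of `sumBelow D`.
Bounded : ℕ → Series → Set
Bounded D p = ∀ n i j → D ≤ n ⊎ D ≤ i ⊎ D ≤ j → p n i j ≡ 0ℚ

private
  -- In a nested polynomial the inner degree bounds vary with the outer index; the maximum of
  -- finitely many gives a uniform one.
  bounded-below : (Q : ℕ → ℕ → Set) → (∀ {n B B′} → B ≤ B′ → Q n B → Q n B′) → (∀ n → ∃ (Q n)) →
                  ∀ N → ∃ λ B → ∀ n → n < N → Q n B
  bounded-below Q mono q zero    = 0 , λ _ ()
  bounded-below Q mono q (suc N) =
    let (B , h) = bounded-below Q mono q N in
    proj₁ (q N) ℕ.⊔ B , λ n n≤N →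
      [ (λ n<N → mono (ℕₚ.m≤n⊔m (proj₁ (q N)) B) (h n n<N))
      , (λ { refl → mono (ℕₚ.m≤m⊔n (proj₁ (q N)) B) (proj₂ (q N)) }) ] (ℕₚ.m<1+n⇒m<n∨m≡n n≤N)

  bounded¹ : ∀ {p} → Domain.Pol T.dom₁ p → ∃ λ D → ∀ j → D ≤ j → p j ≡ 0ℚ
  bounded¹ (_ , B , z) = B , z

  bounded² : ∀ {p} → Domain.Pol T.dom₂ p → ∃ λ D → ∀ i j → D ≤ i ⊎ D ≤ j → p i j ≡ 0ℚ
  bounded² {p} (q , N , z) =
    let (B , h) = bounded-below (λ i D → ∀ j → D ≤ j → p i j ≡ 0ℚ) (λ B≤B′ h j B′≤j → h j (ℕₚ.≤-trans B≤B′ B′≤j)) (λ i → bounded¹ (q i)) N in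
    N ℕ.⊔ B , λ { i j (inj₁ D≤i) → z i (ℕₚ.≤-trans (ℕₚ.m≤m⊔n N B) D≤i) j
                ; i j (inj₂ D≤j) → [ (λ i<N → h i i<N j (ℕₚ.≤-trans (ℕₚ.m≤n⊔m N B) D≤j)) , (λ N≤i → z i N≤i j) ] (ℕₚ.<-≤-connex i N) }

bounded : ∀ {p} → Domain.Pol T.dom₃ p → ∃ λ D → Bounded D p
bounded {p} (q , N , z) =
  let (B , h) = bounded-below (λ n D → ∀ i j → D ≤ i ⊎ D ≤ j → p n i j ≡ 0ℚ)
                  (λ B≤B′ h i j → λ { (inj₁ B′≤i) → h i j (inj₁ (ℕₚ.≤-trans B≤B′ B′≤i)) ; (inj₂ B′≤j) → h i j (inj₂ (ℕₚ.≤-trans B≤B′ B′≤j)) })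
                  (λ n → bounded² (q n)) N in
  N ℕ.⊔ B , λ { n i j (inj₁ D≤n) → z n (ℕₚ.≤-trans (ℕₚ.m≤m⊔n N B) D≤n) i j
              ; n i j (inj₂ D≤ij) → [ (λ n<N → h n n<N i j ([ (λ l → inj₁ (ℕₚ.≤-trans (ℕₚ.m≤n⊔m N B) l)) , (λ l → inj₂ (ℕₚ.≤-trans (ℕₚ.m≤n⊔m N B) l)) ] D≤ij))
                                    , (λ N≤n → z n N≤n i j) ] (ℕₚ.<-≤-connex n N) }

private
  when : ℕ → ℕ → ℚ → ℚ
  when b n x = if does (b ℕ.≤? n) then x else 0ℚ

  when-≤ : ∀ {b n} x → b ≤ n → when b n x ≡ x
  when-≤ {b} {n} x b≤n with b ℕ.≤ᵇ n in eq
  ... | true  = refl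
  ... | false = ⊥-elim (≡.subst Data.Bool.T eq (ℕₚ.≤⇒≤ᵇ b≤n))

  when-> : ∀ {b n} x → n < b → when b n x ≡ 0ℚ
  when-> {b} {n} x n<b with b ℕ.≤ᵇ n in eq
  ... | false = refl
  ... | true  = ⊥-elim (ℕₚ.<⇒≱ n<b (ℕₚ.≤ᵇ⇒≤ b n (≡.subst Data.Bool.T (sym eq) tt)))

  when-* : ∀ b n p x → p ℚ.* when b n x ≡ when b n (p ℚ.* x)
  when-* b n p x with b ℕ.≤ᵇ n
  ... | true  = refl
  ... | false = ℚₚ.*-zeroʳ p

  when-Σ : ∀ b n D (f : ℕ → ℚ) → sumBelow D (λ k → when b n (f k)) ≡ when b n (sumBelow D f)
  when-Σ b n D f with b ℕ.≤ᵇ n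
  ... | true  = refl
  ... | false = sumBelow-0 D (λ _ → refl)

  -- Both sums are sums over all b of the terms with b ≤ n and b < D.
  Σ-when : ∀ n D (f : ℕ → ℚ) → (∀ b → D ≤ b → f b ≡ 0ℚ) →
           sumBelow (suc n) f ≡ sumBelow D (λ b → when b n (f b))
  Σ-when n D f h = begin
    sumBelow (suc n) f                            ≡⟨ sumBelow≡Σ< (suc n) f ⟩
    Σ⁰.Σ< (suc n) f                               ≡⟨ Σ⁰.Σ<-cong (suc n) (λ k k≤n → sym (when-≤ (f k) (ℕₚ.≤-pred k≤n))) ⟩
    Σ⁰.Σ< (suc n) w                               ≡⟨ Σ⁰.Σ<-extend (suc n) D (λ k n<k → when-> (f k) n<k) ⟨
    Σ⁰.Σ< (D ℕ.+ suc n) w                         ≡⟨ cong (λ m → Σ⁰.Σ< m w) (ℕₚ.+-comm D (suc n)) ⟩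
    Σ⁰.Σ< (suc n ℕ.+ D) w                         ≡⟨ Σ⁰.Σ<-extend D (suc n) (λ k D≤k → trans (cong (when k n) (h k D≤k)) (when-0 k)) ⟩
    Σ⁰.Σ< D w                                     ≡⟨ sumBelow≡Σ< D w ⟨
    sumBelow D w                                  ∎
    where
    open ≡-Reasoning
    w : ℕ → ℚ
    w b = when b n (f b)
    when-0 : ∀ k → when k n 0ℚ ≡ 0ℚ
    when-0 k with k ℕ.≤ᵇ n
    ... | true  = refl
    ... | false = refl

-- The convolution runs up to the exponents n, i, j, the polynomial evaluation up to the degree
-- bound. Terms outside the common range vanish, through p in the first sum and through `shift` in
-- the second.
⊛-shift : ∀ D p F n i j → Bounded D p →
  (p ⊛ F) n i j ≡ sumBelow D λ b → sumBelow D λ c → sumBelow D λ d → p b c d ℚ.* shift b c d F n i j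
⊛-shift D p F n i j bp = begin
  (p ⊛ F) n i j
    ≡⟨ Σ-when n D _ (λ b D≤b → sumBelow-0 (suc i) (λ c → sumBelow-0 (suc j) (λ d → zero-term b c d (inj₁ D≤b)))) ⟩
  sumBelow D (λ b → when b n (sumBelow (suc i) λ c → sumBelow (suc j) λ d → term b c d))
    ≡⟨ sumBelow-cong D (λ b → cong (when b n) (trans
         (Σ-when i D _ (λ c D≤c → sumBelow-0 (suc j) (λ d → zero-term b c d (inj₂ (inj₁ D≤c)))))
         (sumBelow-cong D (λ c → cong (when c i) (Σ-when j D _ (λ d D≤d → zero-term b c d (inj₂ (inj₂ D≤d)))))))) ⟩
  sumBelow D (λ b → when b n (sumBelow D λ c → when c i (sumBelow D λ d → when d j (term b c d))))
    ≡⟨ sumBelow-cong D (λ b → trans (sym (when-Σ b n D _)) (sumBelow-cong D (λ c → trans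
         (cong (when b n) (sym (when-Σ c i D _))) (trans (sym (when-Σ b n D _)) (sumBelow-cong D (λ d → sym (factor b c d))))))) ⟩
  sumBelow D (λ b → sumBelow D λ c → sumBelow D λ d → p b c d ℚ.* shift b c d F n i j) ∎
  where
  open ≡-Reasoning
  term : ℕ → ℕ → ℕ → ℚ
  term b c d = p b c d ℚ.* F (n ∸ b) (i ∸ c) (j ∸ d)
  zero-term : ∀ b c d → D ≤ b ⊎ D ≤ c ⊎ D ≤ d → term b c d ≡ 0ℚ
  zero-term b c d h = trans (cong (ℚ._* F (n ∸ b) (i ∸ c) (j ∸ d)) (bp b c d h)) (ℚₚ.*-zeroˡ (F (n ∸ b) (i ∸ c) (j ∸ d)))
  factor : ∀ b c d → p b c d ℚ.* shift b c d F n i j ≡ when b n (when c i (when d j (term b c d)))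
  factor b c d = trans (when-* b n (p b c d) _) (cong (when b n) (trans (when-* c i (p b c d) _) (cong (when c i) (when-* d j (p b c d) _))))

annihilator : ∀ {F} → PolynomialRelation T.dom₃ F →
              Σ Poly4 λ P → NonzeroPoly P × (∀ n i j → evalAt P F n i j ≡ 0ℚ)
annihilator {F} (c , N , pc , above , (a₀ , a₀≤N , b₀ , _ , c₀ , _ , d₀ , _ , c≢0) , eq) =
  poly4 deg c , nonzero , vanishes
  where
  bounds : ∃ λ B → ∀ a → a < suc N → Bounded B (c a)
  bounds = bounded-below (λ a B → Bounded B (c a))
    (λ B≤B′ h n i j → λ { (inj₁ l) → h n i j (inj₁ (ℕₚ.≤-trans B≤B′ l))
                        ; (inj₂ (inj₁ l)) → h n i j (inj₂ (inj₁ (ℕₚ.≤-trans B≤B′ l)))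
                        ; (inj₂ (inj₂ l)) → h n i j (inj₂ (inj₂ (ℕₚ.≤-trans B≤B′ l))) })
    (λ a → bounded (pc a)) (suc N)

  -- One bound for all exponents: N for T, the degrees of the coefficients for t, x, y.
  deg : ℕ
  deg = N ℕ.⊔ proj₁ bounds

  c-bounded : ∀ a → Bounded (suc deg) (c a)
  c-bounded a n i j h with ℕₚ.<-≤-connex a (suc N)
  ... | inj₁ a<N = proj₂ bounds a a<N n i j ([ (λ l → inj₁ (weaken l)) , [ (λ l → inj₂ (inj₁ (weaken l))) , (λ l → inj₂ (inj₂ (weaken l))) ] ] h)
    where
    weaken : ∀ {k} → suc deg ≤ k → proj₁ bounds ≤ k
    weaken l = ℕₚ.≤-trans (ℕₚ.m≤n⇒m≤1+n (ℕₚ.m≤n⊔m N _)) l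
  ... | inj₂ N<a = cong (λ f → f n i j) (above a N<a)

  -- The apartness of `c a₀` unfolds to the exponents of an actual nonzero coefficient; they respect
  -- the bound because coefficients beyond it are 0.
  nonzero : NonzeroPoly (poly4 deg c)
  nonzero = a₀ , b₀ , c₀ , d₀ , ℕₚ.≤-trans a₀≤N (ℕₚ.m≤m⊔n N _) ,
    ℕₚ.≮⇒≥ (λ l → c≢0 (c-bounded a₀ b₀ c₀ d₀ (inj₁ l))) ,
    ℕₚ.≮⇒≥ (λ l → c≢0 (c-bounded a₀ b₀ c₀ d₀ (inj₂ (inj₁ l)))) ,
    ℕₚ.≮⇒≥ (λ l → c≢0 (c-bounded a₀ b₀ c₀ d₀ (inj₂ (inj₂ l)))) , c≢0

  vanishes : ∀ n i j → evalAt (poly4 deg c) F n i j ≡ 0ℚ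
  vanishes n i j = begin
    evalAt (poly4 deg c) F n i j
      ≡⟨ sumBelow-cong (suc deg) (λ a → sym (⊛-shift (suc deg) (c a) (F ^S a) n i j (c-bounded a))) ⟩
    sumBelow (suc deg) (λ a → (c a ⊛ (F ^S a)) n i j)
      ≡⟨ sumBelow-cong (suc deg) (λ a → trans (⊛≡⊗ (c a) (F ^S a) n i j) (T.*-congˡ {c a} (^S≡^ F a) n i j)) ⟩
    sumBelow (suc deg) (λ a → (c a T.* F T.^ a) n i j)
      ≡⟨ Σ³-at (suc deg) (λ a → c a T.* F T.^ a) n i j ⟨
    Σ³.Σ< (suc deg) (λ a → c a T.* F T.^ a) n i j
      ≡⟨ eq deg (ℕₚ.m≤m⊔n N _) n i j ⟩
    0ℚ ∎
    where open ≡-Reasoning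

-- Counting coefficients in ℚ and the functional equation

fromℕ : ℕ → ℚ
fromℕ n = (+ n) ℚ./ 1

fromℕ-+ : ∀ a b → fromℕ (a ℕ.+ b) ≡ fromℕ a ℚ.+ fromℕ b
fromℕ-+ a b = ℚₚ.toℚᵘ-injective (begin
  ℚ.toℚᵘ (fromℕ (a ℕ.+ b))                    ≈⟨ ℚₚ.toℚᵘ-fromℚᵘ (mkℚᵘ (+ (a ℕ.+ b)) 0) ⟩
  mkℚᵘ (+ (a ℕ.+ b)) 0                        ≈⟨ *≡* (cong (ℤ._* + 1) (sym (cong₂ ℤ._+_ (ℤₚ.*-identityʳ (+ a)) (ℤₚ.*-identityʳ (+ b))))) ⟩
  mkℚᵘ (+ a) 0 ℚᵘ.+ mkℚᵘ (+ b) 0              ≈⟨ ℚᵘₚ.+-cong (ℚₚ.toℚᵘ-fromℚᵘ (mkℚᵘ (+ a) 0)) (ℚₚ.toℚᵘ-fromℚᵘ (mkℚᵘ (+ b) 0)) ⟨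
  ℚ.toℚᵘ (fromℕ a) ℚᵘ.+ ℚ.toℚᵘ (fromℕ b)      ≈⟨ ℚₚ.toℚᵘ-homo-+ (fromℕ a) (fromℕ b) ⟨
  ℚ.toℚᵘ (fromℕ a ℚ.+ fromℕ b)                ∎)
  where open import Relation.Binary.Reasoning.Setoid ℚᵘₚ.≃-setoid

fromℕ-suc≢0 : ∀ n → fromℕ (suc n) ≢ 0ℚ
fromℕ-suc≢0 n e with ℚᵘₚ.≃-trans (ℚᵘₚ.≃-sym (ℚₚ.toℚᵘ-fromℚᵘ (mkℚᵘ (+ suc n) 0))) (ℚₚ.toℚᵘ-cong e)
... | *≡* ()

num≡fromℕ : ∀ n → Solver.num ℚₚ.+-*-commutativeRing n ≡ fromℕ n
num≡fromℕ zero    = refl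
num≡fromℕ (suc n) = trans (cong (1ℚ ℚ.+_) (num≡fromℕ n)) (sym (fromℕ-+ 1 n))

char-0 : ∀ n → Solver.num ℚₚ.+-*-commutativeRing (suc n) ≢ 0ℚ
char-0 n e = fromℕ-suc≢0 n (trans (sym (num≡fromℕ (suc n))) e)

-- A last step W or SW reaches (i, j) from abscissa i + 1, hence `∂x` and `∂y`. Predecessors outside
-- the quadrant count 0, like the lowest coefficients after multiplication by x or y.
recurrence : G T.≈ T.1# T.+ T.t T.* (T.∂x G T.+ (T.∂x (T.∂y G) T.+ (T.x T.* (T.y T.* G) T.+ T.x T.* G)))
recurrence zero i j = trans (start i j) (sym (trans (cong (T.1# 0 i j ℚ.+_) (T.t-zero step i j)) (ℚₚ.+-identityʳ _)))
  where
  step : Series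
  step = T.∂x G T.+ (T.∂x (T.∂y G) T.+ (T.x T.* (T.y T.* G) T.+ T.x T.* G))
  start : ∀ i j → G 0 i j ≡ T.1# 0 i j
  start zero    zero    = refl
  start zero    (suc j) = cong fromℕ (g≡walks 0 0 (suc j))
  start (suc i) zero    = cong fromℕ (g≡walks 0 (suc i) 0)
  start (suc i) (suc j) = cong fromℕ (g≡walks 0 (suc i) (suc j))
recurrence (suc n) i j = trans (last i j) (sym (trans (cong (T.1# (suc n) i j ℚ.+_) (T.t-suc step n i j)) (ℚₚ.+-identityˡ _)))
  where
  step : Series
  step = T.∂x G T.+ (T.∂x (T.∂y G) T.+ (T.x T.* (T.y T.* G) T.+ T.x T.* G))
  expand : ∀ i j → G (suc n) i j ≡ G n (suc i) j ℚ.+ (G n (suc i) (suc j) ℚ.+ (fromℕ (after SW (g n) i j) ℚ.+ fromℕ (after W (g n) i j)))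
  expand i j = trans (cong fromℕ (g-last n i j)) (trans (fromℕ-+ (after E (g n) i j) _) (cong (G n (suc i) j ℚ.+_)
    (trans (fromℕ-+ (after NE (g n) i j) _) (cong (G n (suc i) (suc j) ℚ.+_) (fromℕ-+ (after SW (g n) i j) (after W (g n) i j))))))
  left : ∀ i j → fromℕ (after W (g n) i j) ≡ (T.x T.* G) n i j
  left zero    j = sym (T.x-zero G n j)
  left (suc i) j = sym (T.x-suc G n i j)
  diagonal : ∀ i j → fromℕ (after SW (g n) i j) ≡ (T.x T.* (T.y T.* G)) n i j
  diagonal zero    j       = sym (T.x-zero (T.y T.* G) n j)
  diagonal (suc i) zero    = sym (trans (T.x-suc (T.y T.* G) n i 0) (T.y-zero G n i))
  diagonal (suc i) (suc j) = sym (trans (T.x-suc (T.y T.* G) n i (suc j)) (T.y-suc G n i j))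
  last : ∀ i j → G (suc n) i j ≡ step n i j
  last i j = trans (expand i j) (cong (G n (suc i) j ℚ.+_) (cong (G n (suc i) (suc j) ℚ.+_) (cong₂ ℚ._+_ (diagonal i j) (left i j))))

theorem3 : Σ Poly4 λ P → NonzeroPoly P × (∀ (n i j : ℕ) → evalAt P G n i j ≡ 0ℚ)
theorem3 = annihilator (Algebraicity.algebraic-G ℚₚ.+-*-commutativeRing ℚ-domain char-0 G recurrence
  (λ n i j n<i → cong fromℕ (g-cone n i j n<i)))
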